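{- (1) Let $q=p_1^{k_1}p_2^{k_2}$ with $p_1,p_2$ distinct primes and $k_1,k_2\geq1$, and let $N\geq 1$. A dephased matrix $H\in M_{2\times N}(\mathbb Z_q)$ with multiplicity matrix $A\in M_{p_1^{k_1}\times p_2^{k_2}}(\mathbb N)$, written with double indices $A_{ij,xy}$ where $i\in\mathbb Z_{p_1}$, $j\in\mathbb Z_{p_1^{k_1-1}}$, $x\in\mathbb Z_{p_2}$, $y\in\mathbb Z_{p_2^{k_2-1}}$, is partial Butson if and only if there exist $B_{ijy},C_{jxy}\in\mathbb N$ such that $$A_{ij,xy}=B_{ijy}+C_{jxy}\quad\text{for all } i,j,x,y.$$ Thus the dephased partial Butson matrices $H\in M_{2\times N}(\mathbb Z_q)$, up to permutation of the columns, are indexed by the matrices $A$ of this form whose entries sum to $N$. (2) In particular, for $q=2p$ with $p\geq3$ prime and any $N\geq1$, the probability $P_2$ for a uniformly random matrix $H\in M_{2\times N}(\mathbb Z_q)$ to be partial Butson equals the probability for a length $N$ simple random walk on $\mathbb Z^p$, started at the origin, to end up on the diagonal, i.e. at a position of type $(t,\ldots,t)$ with $t\in\mathbb Z$.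
   Context: $\mathbb N=\{0,1,2,\ldots\}$. As a set of matrix entries, $\mathbb Z_q\subset\mathbb C^\times$ denotes the multiplicative group of complex $q$-th roots of unity, and $M_{M\times N}(\mathbb Z_q)$ is the set of $M\times N$ matrices with all entries in it. (When used for index sets, $\mathbb Z_m$ is just identified with $\{0,1,\ldots,m-1\}$.) A matrix $H\in M_{M\times N}(\mathbb Z_q)$ is partial Butson if its rows are pairwise orthogonal in $\mathbb C^N$ with the usual Hermitian scalar product. It is dephased if its first row consists of $1$ entries only. Multiplicity matrix: every $q$-th root of unity is uniquely a product $\alpha\beta$ with $\alpha^{p_1^{k_1}}=1$ and $\beta^{p_2^{k_2}}=1$. Write $\alpha=e^{2\pi \mathrm{i}(j+p_1^{k_1-1}i)/p_1^{k_1}}$ and $\beta=e^{2\pi \mathrm{i}(y+p_2^{k_2-1}x)/p_2^{k_2}}$ with $0\leq i<p_1$, $0\leq j<p_1^{k_1-1}$, $0\leq x<p_2$, $0\leq y<p_2^{k_2-1}$ (here the upright $\mathrm{i}$ is the imaginary unit). For a dephased $H\in M_{2\times N}(\mathbb Z_q)$, $A_{ij,xy}$ is the number of entries of its second row equal to the root $\alpha\beta$ indexed by $(i,j,x,y)$. The simple random walk on $\mathbb Z^p$ makes at each step, independently, one of the $2p$ moves $\pm e_1,\ldots,\pm e_p$ with equal probability $\frac{1}{2p}$, where $e_1,\dots,e_p$ is the standard basis. -}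

module Defs where

open import Algebra.Bundles.Raw using (RawRing)
import Algebra.Definitions.RawMonoid as RawMonoidDefinitions
import Algebra.Definitions.RawSemiring as RawSemiringDefinitions
open import Data.Bool.Base using (if_then_else_)
open import Data.Fin.Base using (Fin; zero; suc; toℕ)
import Data.Fin.Properties as Fin
open import Data.Fin.Permutation
  using (Permutation′; _⟨$⟩ʳ_; _⟨$⟩ˡ_; flip; _∘ₚ_; inverseʳ)
import Data.Fin.Permutation as Perm
open import Data.Fin.Subset using (Subset; _∈_; ∣_∣)
open import Data.Integer.Base using (ℤ; +_; 0ℤ; 1ℤ)
import Data.Integer.Base as ℤ
open import Data.Nat.Base using (ℕ; suc; _∸_)
import Data.Nat.Base as ℕ
import Data.Nat.Properties as ℕ
open import Data.Product.Base using (∃; ∃₂; Σ; _×_; _,_; proj₁; proj₂)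
open import Data.Rational.Base using (ℚ; 0ℚ; 1ℚ; ½)
import Data.Rational.Base as ℚ
import Data.Rational.Properties as ℚ
open import Data.Rational.Solver using (module +-*-Solver)
open import Data.Sign.Base using (Sign)
open import Data.Vec.Base using (Vec; foldr′)
open import Data.Vec.Functional using (Vector)
import Data.Vec.Functional.Relation.Binary.Equality.Setoid as VecEquality
open import Function.Bundles using (Inverse; _⇔_)
open import Level using (0ℓ)
open import Relation.Binary.Bundles using (Setoid)
import Relation.Binary.Construct.On as On
open import Relation.Binary.PropositionalEquality
  using (_≡_; _≢_; refl; sym; trans; cong; cong₂; subst; setoid)
open import Relation.Nullary using (¬_)
open import Relation.Nullary.Decidable using (⌊_⌋)

------------------------------------------------------------------------
-- Real numbers: Cauchy sequences of rationals, modulo null sequences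

dist : ℚ → ℚ → ℚ
dist a b = ℚ.∣ a ℚ.- b ∣

Cauchy : (ℕ → ℚ) → Set
Cauchy s = ∀ ε → 0ℚ ℚ.< ε →
  ∃ λ K → ∀ m n → K ℕ.≤ m → K ℕ.≤ n → dist (s m) (s n) ℚ.< ε

record ℝ : Set where
  constructor mkℝ
  field
    seq    : ℕ → ℚ
    cauchy : Cauchy seq

open ℝ public

infix 4 _≈ℝ_

record _≈ℝ_ (x y : ℝ) : Set where
  constructor mk≈ℝ
  field
    close : ∀ ε → 0ℚ ℚ.< ε →
      ∃ λ K → ∀ n → K ℕ.≤ n → dist (seq x n) (seq y n) ℚ.< ε

open _≈ℝ_ public

half-pos : ∀ {ε} → 0ℚ ℚ.< ε → 0ℚ ℚ.< ½ ℚ.* ε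
half-pos 0<ε = ℚ.*-monoʳ-<-pos ½ 0<ε

halves : ∀ ε → ½ ℚ.* ε ℚ.+ ½ ℚ.* ε ≡ ε
halves ε = trans (sym (ℚ.*-distribʳ-+ ε ½ ½)) (ℚ.*-identityˡ ε)

dist-refl : ∀ a → dist a a ≡ 0ℚ
dist-refl a = cong ℚ.∣_∣ (ℚ.+-inverseʳ a)

dist-sym : ∀ a b → dist a b ≡ dist b a
dist-sym a b = trans
  (cong ℚ.∣_∣ (solve 2 (λ a b → a :- b := :- (b :- a)) refl a b))
  (ℚ.∣-p∣≡∣p∣ (b ℚ.- a))
  where open +-*-Solver

dist-triangle : ∀ a b c → dist a c ℚ.≤ dist a b ℚ.+ dist b c
dist-triangle a b c = subst (ℚ._≤ dist a b ℚ.+ dist b c)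
  (cong ℚ.∣_∣
    (solve 3 (λ a b c → (a :- b) :+ (b :- c) := a :- c) refl a b c))
  (ℚ.∣p+q∣≤∣p∣+∣q∣ (a ℚ.- b) (b ℚ.- c))
  where open +-*-Solver

dist-+ : ∀ a b c d →
         dist (a ℚ.+ b) (c ℚ.+ d) ℚ.≤ dist a c ℚ.+ dist b d
dist-+ a b c d = subst (ℚ._≤ dist a c ℚ.+ dist b d)
  (cong ℚ.∣_∣ (solve 4
    (λ a b c d → (a :- c) :+ (b :- d) := (a :+ b) :- (c :+ d))
    refl a b c d))
  (ℚ.∣p+q∣≤∣p∣+∣q∣ (a ℚ.- c) (b ℚ.- d))
  where open +-*-Solver

dist-neg : ∀ a b → dist (ℚ.- a) (ℚ.- b) ≡ dist a b
dist-neg a b = trans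
  (cong ℚ.∣_∣
    (solve 2 (λ a b → (:- a) :- (:- b) := :- (a :- b)) refl a b))
  (ℚ.∣-p∣≡∣p∣ (a ℚ.- b))
  where open +-*-Solver

dist-* : ∀ a b c d →
         dist (a ℚ.* b) (c ℚ.* d) ℚ.≤
         dist a c ℚ.* ℚ.∣ b ∣ ℚ.+ ℚ.∣ c ∣ ℚ.* dist b d
dist-* a b c d = begin
  dist (a ℚ.* b) (c ℚ.* d)
    ≡⟨ cong ℚ.∣_∣ (solve 4
         (λ a b c d → a :* b :- c :* d
                   := (a :- c) :* b :+ c :* (b :- d))
         refl a b c d) ⟩
  ℚ.∣ (a ℚ.- c) ℚ.* b ℚ.+ c ℚ.* (b ℚ.- d) ∣
    ≤⟨ ℚ.∣p+q∣≤∣p∣+∣q∣ ((a ℚ.- c) ℚ.* b) (c ℚ.* (b ℚ.- d)) ⟩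
  ℚ.∣ (a ℚ.- c) ℚ.* b ∣ ℚ.+ ℚ.∣ c ℚ.* (b ℚ.- d) ∣
    ≡⟨ cong₂ ℚ._+_ (ℚ.∣p*q∣≡∣p∣*∣q∣ (a ℚ.- c) b)
                   (ℚ.∣p*q∣≡∣p∣*∣q∣ c (b ℚ.- d)) ⟩
  dist a c ℚ.* ℚ.∣ b ∣ ℚ.+ ℚ.∣ c ∣ ℚ.* dist b d ∎
  where
  open ℚ.≤-Reasoning
  open +-*-Solver

const-cauchy : ∀ r → Cauchy (λ _ → r)
const-cauchy r ε 0<ε =
  0 , λ _ _ _ _ → subst (ℚ._< ε) (sym (dist-refl r)) 0<ε

+-cauchy : ∀ x y → Cauchy (λ n → seq x n ℚ.+ seq y n)
+-cauchy x y ε 0<ε with cauchy x _ (half-pos 0<ε)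
                      | cauchy y _ (half-pos 0<ε)
... | K , p | L , q = K ℕ.⊔ L , λ m n M≤m M≤n →
  ℚ.≤-<-trans (dist-+ (seq x m) (seq y m) (seq x n) (seq y n))
    (subst (_ ℚ.<_) (halves ε) (ℚ.+-mono-<
      (p m n (ℕ.m⊔n≤o⇒m≤o K L M≤m) (ℕ.m⊔n≤o⇒m≤o K L M≤n))
      (q m n (ℕ.m⊔n≤o⇒n≤o K L M≤m) (ℕ.m⊔n≤o⇒n≤o K L M≤n))))

neg-cauchy : ∀ x → Cauchy (λ n → ℚ.- seq x n)
neg-cauchy x ε 0<ε with cauchy x ε 0<ε
... | K , p = K , λ m n K≤m K≤n →
  subst (ℚ._< ε) (sym (dist-neg (seq x m) (seq x n))) (p m n K≤m K≤n)

0<1 : 0ℚ ℚ.< 1ℚ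
0<1 = ℚ.positive⁻¹ 1ℚ

bounded : ∀ x → ∃₂ λ K B → 0ℚ ℚ.< B ×
          (∀ n → K ℕ.≤ n → ℚ.∣ seq x n ∣ ℚ.≤ B)
bounded x with cauchy x 1ℚ 0<1
... | K , p = K , 1ℚ ℚ.+ ℚ.∣ a ∣ , 0<B , bound
  where
  a = seq x K
  0<B : 0ℚ ℚ.< 1ℚ ℚ.+ ℚ.∣ a ∣
  0<B = ℚ.+-mono-<-≤ 0<1 (ℚ.0≤∣p∣ a)
  open ℚ.≤-Reasoning
  open +-*-Solver
  bound : ∀ n → K ℕ.≤ n → ℚ.∣ seq x n ∣ ℚ.≤ 1ℚ ℚ.+ ℚ.∣ a ∣
  bound n K≤n = begin
    ℚ.∣ seq x n ∣
      ≡⟨ cong ℚ.∣_∣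
           (solve 2 (λ b a → b := (b :- a) :+ a) refl (seq x n) a) ⟩
    ℚ.∣ (seq x n ℚ.- a) ℚ.+ a ∣
      ≤⟨ ℚ.∣p+q∣≤∣p∣+∣q∣ (seq x n ℚ.- a) a ⟩
    dist (seq x n) a ℚ.+ ℚ.∣ a ∣
      ≤⟨ ℚ.+-monoˡ-≤ ℚ.∣ a ∣ (ℚ.<⇒≤ (p n K K≤n ℕ.≤-refl)) ⟩
    1ℚ ℚ.+ ℚ.∣ a ∣ ∎

divide : ∀ {ε B} → 0ℚ ℚ.< ε → 0ℚ ℚ.< B →
         ∃ λ δ → 0ℚ ℚ.< δ × δ ℚ.* B ≡ ε
divide {ε} {B} 0<ε 0<B = ε ℚ.* B⁻¹ , 0<δ , δB≡ε
  where
  instance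
    B-pos : ℚ.Positive B
    B-pos = ℚ.positive 0<B
    B-nz : ℚ.NonZero B
    B-nz = ℚ.pos⇒nonZero B
    ε-pos : ℚ.Positive ε
    ε-pos = ℚ.positive 0<ε
  B⁻¹ = ℚ.1/ B
  instance
    B⁻¹-pos : ℚ.Positive B⁻¹
    B⁻¹-pos = ℚ.1/pos⇒pos B
  0<δ : 0ℚ ℚ.< ε ℚ.* B⁻¹
  0<δ = ℚ.positive⁻¹ (ε ℚ.* B⁻¹) {{ℚ.pos*pos⇒pos ε B⁻¹}}
  δB≡ε : ε ℚ.* B⁻¹ ℚ.* B ≡ ε
  δB≡ε = trans (ℚ.*-assoc ε B⁻¹ B)
    (trans (cong (ε ℚ.*_) (ℚ.*-inverseˡ B)) (ℚ.*-identityʳ ε))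

*-mono-<-bound : ∀ {d δ b B ε} → 0ℚ ℚ.≤ d → d ℚ.< δ → b ℚ.≤ B →
                 0ℚ ℚ.< B → δ ℚ.* B ≡ ε → d ℚ.* b ℚ.< ε
*-mono-<-bound {d} {δ} {b} {B} {ε} 0≤d d<δ b≤B 0<B eq = begin-strict
  d ℚ.* b  ≤⟨ ℚ.*-monoˡ-≤-nonNeg d {{ℚ.nonNegative 0≤d}} b≤B ⟩
  d ℚ.* B  <⟨ ℚ.*-monoˡ-<-pos B {{ℚ.positive 0<B}} d<δ ⟩
  δ ℚ.* B  ≡⟨ eq ⟩
  ε        ∎
  where open ℚ.≤-Reasoning

dist-*-< : ∀ {δ η B C ε} a b c d →
           dist a c ℚ.< η → ℚ.∣ b ∣ ℚ.≤ C → 0ℚ ℚ.< C → η ℚ.* C ≡ ½ ℚ.* ε →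
           dist b d ℚ.< δ → ℚ.∣ c ∣ ℚ.≤ B → 0ℚ ℚ.< B → δ ℚ.* B ≡ ½ ℚ.* ε →
           dist (a ℚ.* b) (c ℚ.* d) ℚ.< ε
dist-*-< {δ} {η} {B} {C} {ε} a b c d ac<η b≤C 0<C ηC bd<δ c≤B 0<B δB =
  begin-strict
    dist (a ℚ.* b) (c ℚ.* d)
      ≤⟨ dist-* a b c d ⟩
    dist a c ℚ.* ℚ.∣ b ∣ ℚ.+ ℚ.∣ c ∣ ℚ.* dist b d
      ≡⟨ cong (dist a c ℚ.* ℚ.∣ b ∣ ℚ.+_)
           (ℚ.*-comm ℚ.∣ c ∣ (dist b d)) ⟩
    dist a c ℚ.* ℚ.∣ b ∣ ℚ.+ dist b d ℚ.* ℚ.∣ c ∣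
      <⟨ ℚ.+-mono-<
           (*-mono-<-bound {dist a c} {η} {ℚ.∣ b ∣} {C}
             (ℚ.0≤∣p∣ (a ℚ.- c)) ac<η b≤C 0<C ηC)
           (*-mono-<-bound {dist b d} {δ} {ℚ.∣ c ∣} {B}
             (ℚ.0≤∣p∣ (b ℚ.- d)) bd<δ c≤B 0<B δB) ⟩
    ½ ℚ.* ε ℚ.+ ½ ℚ.* ε
      ≡⟨ halves ε ⟩
    ε ∎
  where open ℚ.≤-Reasoning

*-cauchy : ∀ x y → Cauchy (λ n → seq x n ℚ.* seq y n)
*-cauchy x y ε 0<ε =
  let K , B , 0<B , xB = bounded x
      L , C , 0<C , yC = bounded y
      δ , 0<δ , δB     = divide (half-pos 0<ε) 0<B
      η , 0<η , ηC     = divide (half-pos 0<ε) 0<C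
      K′ , p           = cauchy x η 0<η
      L′ , q           = cauchy y δ 0<δ
      M₁ = K ℕ.⊔ L
      M₂ = K′ ℕ.⊔ L′
  in M₁ ℕ.⊔ M₂ , λ m n M≤m M≤n →
    let M₁≤m = ℕ.m⊔n≤o⇒m≤o M₁ M₂ M≤m
        M₂≤m = ℕ.m⊔n≤o⇒n≤o M₁ M₂ M≤m
        M₁≤n = ℕ.m⊔n≤o⇒m≤o M₁ M₂ M≤n
        M₂≤n = ℕ.m⊔n≤o⇒n≤o M₁ M₂ M≤n
    in dist-*-< {δ} {η} {B} {C} {ε}
         (seq x m) (seq y m) (seq x n) (seq y n)
         (p m n (ℕ.m⊔n≤o⇒m≤o K′ L′ M₂≤m) (ℕ.m⊔n≤o⇒m≤o K′ L′ M₂≤n))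
         (yC m (ℕ.m⊔n≤o⇒n≤o K L M₁≤m)) 0<C ηC
         (q m n (ℕ.m⊔n≤o⇒n≤o K′ L′ M₂≤m) (ℕ.m⊔n≤o⇒n≤o K′ L′ M₂≤n))
         (xB n (ℕ.m⊔n≤o⇒m≤o K L M₁≤n)) 0<B δB

infixl 6 _+ℝ_
infixl 7 _*ℝ_
infix  8 -ℝ_

0ℝ 1ℝ : ℝ
0ℝ = mkℝ (λ _ → 0ℚ) (const-cauchy 0ℚ)
1ℝ = mkℝ (λ _ → 1ℚ) (const-cauchy 1ℚ)

_+ℝ_ _*ℝ_ : ℝ → ℝ → ℝ
x +ℝ y = mkℝ (λ n → seq x n ℚ.+ seq y n) (+-cauchy x y)
x *ℝ y = mkℝ (λ n → seq x n ℚ.* seq y n) (*-cauchy x y)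

-ℝ_ : ℝ → ℝ
-ℝ x = mkℝ (λ n → ℚ.- seq x n) (neg-cauchy x)

≈ℝ-refl : ∀ {x} → x ≈ℝ x
≈ℝ-refl {x} = mk≈ℝ λ ε 0<ε →
  0 , λ n _ → subst (ℚ._< ε) (sym (dist-refl (seq x n))) 0<ε

≈ℝ-sym : ∀ {x y} → x ≈ℝ y → y ≈ℝ x
≈ℝ-sym {x} {y} x≈y = mk≈ℝ λ ε 0<ε →
  let K , p = close x≈y ε 0<ε
  in K , λ n K≤n →
    subst (ℚ._< ε) (dist-sym (seq x n) (seq y n)) (p n K≤n)

≈ℝ-trans : ∀ {x y z} → x ≈ℝ y → y ≈ℝ z → x ≈ℝ z
≈ℝ-trans {x} {y} {z} x≈y y≈z = mk≈ℝ λ ε 0<ε →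
  let K , p = close x≈y _ (half-pos 0<ε)
      L , q = close y≈z _ (half-pos 0<ε)
  in K ℕ.⊔ L , λ n M≤n →
    ℚ.≤-<-trans (dist-triangle (seq x n) (seq y n) (seq z n))
      (subst (_ ℚ.<_) (halves ε) (ℚ.+-mono-<
        (p n (ℕ.m⊔n≤o⇒m≤o K L M≤n)) (q n (ℕ.m⊔n≤o⇒n≤o K L M≤n))))

------------------------------------------------------------------------
-- Complex numbers

record ℂ : Set where
  constructor _+i_
  field
    re im : ℝ

open ℂ public

infix 4 _≈_

record _≈_ (z w : ℂ) : Set where
  constructor _≈,_
  field
    re-≈ : re z ≈ℝ re w
    im-≈ : im z ≈ℝ im w

open _≈_ public

ℂ-rawRing : RawRing 0ℓ 0ℓ
ℂ-rawRing = record
  { Carrier = ℂ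
  ; _≈_     = _≈_
  ; _+_     = λ z w → (re z +ℝ re w) +i (im z +ℝ im w)
  ; _*_     = λ z w → ((re z *ℝ re w) +ℝ (-ℝ (im z *ℝ im w)))
                   +i ((re z *ℝ im w) +ℝ (im z *ℝ re w))
  ; -_      = λ z → (-ℝ re z) +i (-ℝ im z)
  ; 0#      = 0ℝ +i 0ℝ
  ; 1#      = 1ℝ +i 0ℝ
  }

open RawRing ℂ-rawRing public
  using ()
  renaming (_+_ to _+ℂ_; _*_ to _*ℂ_; -_ to -ℂ_; 0# to 0ℂ; 1# to 1ℂ)
open RawSemiringDefinitions (RawRing.rawSemiring ℂ-rawRing) public
  using () renaming (_^_ to _^ℂ_; sum to sumℂ)

conj : ℂ → ℂ
conj z = re z +i (-ℝ im z)

ℂ-setoid : Setoid 0ℓ 0ℓ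
ℂ-setoid = record
  { Carrier       = ℂ
  ; _≈_           = _≈_
  ; isEquivalence = record
    { refl  = ≈ℝ-refl ≈, ≈ℝ-refl
    ; sym   = λ (p ≈, q) → ≈ℝ-sym p ≈, ≈ℝ-sym q
    ; trans = λ (p ≈, q) (p′ ≈, q′) → ≈ℝ-trans p p′ ≈, ≈ℝ-trans q q′
    }
  }

------------------------------------------------------------------------
-- Matrices with entries in ℤ_q

record RootOfUnity (q : ℕ) : Set where
  constructor mkRoot
  field
    value  : ℂ
    isRoot : value ^ℂ q ≈ 1ℂ

open RootOfUnity public

rootSetoid : ℕ → Setoid 0ℓ 0ℓ
rootSetoid q = On.setoid {B = RootOfUnity q} ℂ-setoid value

-- Roots of exact order n.  For n > 0 one of them is e^{2πi/n}, whose only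
-- role is to parametrise the n-th roots of unity by its powers; any other
-- choice serves equally well.
IsPrimitiveRoot : ℕ → ℂ → Set
IsPrimitiveRoot n ζ =
  ζ ^ℂ n ≈ 1ℂ × (∀ d → 0 ℕ.< d → d ℕ.< n → ¬ ζ ^ℂ d ≈ 1ℂ)

Matrix : ℕ → ℕ → ℕ → Set
Matrix M N q = Vector (Vector (RootOfUnity q) N) M

matrixSetoid : ℕ → ℕ → ℕ → Setoid 0ℓ 0ℓ
matrixSetoid M N q =
  VecEquality.≋-setoid (VecEquality.≋-setoid (rootSetoid q) N) M

module _ {M N q : ℕ} where

  entry : Matrix M N q → Fin M → Fin N → ℂ
  entry H a n = value (H a n)

  ⟪_,_⟫ : Vector ℂ N → Vector ℂ N → ℂ
  ⟪ u , v ⟫ = sumℂ (λ n → u n *ℂ conj (v n))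

  PartialButson : Matrix M N q → Set
  PartialButson H = ∀ a b → a ≢ b → ⟪ entry H a , entry H b ⟫ ≈ 0ℂ

Dephased : ∀ {M N q} → Matrix (suc M) N q → Set
Dephased H = ∀ n → entry H zero n ≈ 1ℂ

------------------------------------------------------------------------
-- Multiplicity matrices

-- The number of n : Fin N satisfying P is m.
Count : ∀ {N} → (Fin N → Set) → ℕ → Set
Count {N} P m = ∃ λ (S : Subset N) → (∀ n → n ∈ S ⇔ P n) × ∣ S ∣ ≡ m

-- The pair (i , j) indexes the row and (x , y) the column.
Multiplicities : (p₁ k₁ p₂ k₂ : ℕ) → Set
Multiplicities p₁ k₁ p₂ k₂ =
  Fin p₁ → Fin (p₁ ℕ.^ (k₁ ∸ 1)) → Fin p₂ → Fin (p₂ ℕ.^ (k₂ ∸ 1)) → ℕ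

-- With ζ = e^{2πi/p^k} this is e^{2πi(j + p^{k-1} i)/p^k}.
rootAt : ℂ → (p k : ℕ) → Fin p → Fin (p ℕ.^ (k ∸ 1)) → ℂ
rootAt ζ p k i j = ζ ^ℂ (toℕ j ℕ.+ p ℕ.^ (k ∸ 1) ℕ.* toℕ i)

module _ (p₁ k₁ p₂ k₂ : ℕ) where

  IsMultiplicityMatrix : ∀ {N q} → ℂ → ℂ → Matrix 2 N q →
                         Multiplicities p₁ k₁ p₂ k₂ → Set
  IsMultiplicityMatrix ζ₁ ζ₂ H A = ∀ i j x y →
    Count (λ n → entry H (suc zero) n ≈
                 rootAt ζ₁ p₁ k₁ i j *ℂ rootAt ζ₂ p₂ k₂ x y)
          (A i j x y)

  IsSumForm : Multiplicities p₁ k₁ p₂ k₂ → Set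
  IsSumForm A =
    ∃ λ (B : Fin p₁ → Fin (p₁ ℕ.^ (k₁ ∸ 1)) → Fin (p₂ ℕ.^ (k₂ ∸ 1)) → ℕ) →
    ∃ λ (C : Fin (p₁ ℕ.^ (k₁ ∸ 1)) → Fin p₂ → Fin (p₂ ℕ.^ (k₂ ∸ 1)) → ℕ) →
    ∀ i j x y → A i j x y ≡ B i j y ℕ.+ C j x y

  open RawMonoidDefinitions ℕ.+-0-rawMonoid using (sum)

  total : Multiplicities p₁ k₁ p₂ k₂ → ℕ
  total A = sum λ i → sum λ j → sum λ x → sum λ y → A i j x y

-- Dephased partial Butson matrices, two of them being identified when
-- they differ by a permutation of the columns.
dephasedPartialButsonSetoid : (M N q : ℕ) → Setoid 0ℓ 0ℓ
dephasedPartialButsonSetoid M N q = record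
  { Carrier = Σ (Matrix (suc M) N q) λ H → Dephased H × PartialButson H
  ; _≈_     = λ (H , _) (H′ , _) → ∃ λ (σ : Permutation′ N) →
                ∀ a n → entry H a (σ ⟨$⟩ʳ n) ≈ entry H′ a n
  ; isEquivalence = record
    { refl  = Perm.id , λ a n → S.refl
    ; sym   = λ {(H , _)} {(H′ , _)} (σ , h) → flip σ , λ a n →
        subst (λ k → entry H′ a (σ ⟨$⟩ˡ n) ≈ entry H a k) (inverseʳ σ)
          (S.sym (h a (σ ⟨$⟩ˡ n)))
    ; trans = λ (σ , h) (τ , k) →
        (τ ∘ₚ σ) , λ a n → S.trans (h a (τ ⟨$⟩ʳ n)) (k a n)
    }
  }
  where module S = Setoid ℂ-setoid

sumFormSetoid : (p₁ k₁ p₂ k₂ N : ℕ) → Setoid 0ℓ 0ℓ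
sumFormSetoid p₁ k₁ p₂ k₂ N = record
  { Carrier = Σ (Multiplicities p₁ k₁ p₂ k₂) λ A →
                IsSumForm p₁ k₁ p₂ k₂ A × total p₁ k₁ p₂ k₂ A ≡ N
  ; _≈_     = λ (A , _) (A′ , _) → ∀ i j x y → A i j x y ≡ A′ i j x y
  ; isEquivalence = record
    { refl  = λ _ _ _ _ → refl
    ; sym   = λ e i j x y → sym (e i j x y)
    ; trans = λ e f i j x y → trans (e i j x y) (f i j x y)
    }
  }

------------------------------------------------------------------------
-- Uniform probability on a finite set

HasCardinality : Setoid 0ℓ 0ℓ → ℕ → Set
HasCardinality Ω n = Inverse Ω (setoid (Fin n))

-- Under the uniform distribution on Ω the event E has probability r.
HasProbability : (Ω : Setoid 0ℓ 0ℓ) → (Setoid.Carrier Ω → Set) → ℚ → Set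
HasProbability Ω E r = ∃₂ λ m n →
  HasCardinality Ω (suc n) ×
  HasCardinality (On.setoid {B = Σ (Setoid.Carrier Ω) E} Ω proj₁) m ×
  r ≡ + m ℚ./ suc n

------------------------------------------------------------------------
-- Simple random walk on ℤ^p

-- (i , s) is the move s e_i.
Move : ℕ → Set
Move p = Fin p × Sign

displacement : ∀ {p} → Move p → Vector ℤ p
displacement (i , s) c = if ⌊ i Fin.≟ c ⌋ then s ℤ.◃ 1 else 0ℤ

endpoint : ∀ {p N} → Vec (Move p) N → Vector ℤ p
endpoint =
  foldr′ (λ v position c → displacement v c ℤ.+ position c) (λ _ → 0ℤ)

OnDiagonal : ∀ {p} → Vector ℤ p → Set
OnDiagonal v = ∃ λ (t : ℤ) → ∀ c → v c ≡ t

-- N independent uniform moves amount to a uniform element of (Move p)^N.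
walkSetoid : (p N : ℕ) → Setoid 0ℓ 0ℓ
walkSetoid p N = setoid (Vec (Move p) N)

{-# OPTIONS --safe #-}

-- Since ζ₁ has order p₁^k₁, the number π = ζ₁ - 1 satisfies π^φ(p₁^k₁) ∣ p₁, while
-- the Frobenius endomorphism shows π^(p₁^k₁) ∈ (p₁).  Let S be a ring generated
-- by roots of unity of order prime to p₁: it is reduced modulo p₁, so by
-- Nakayama's lemma an element of S divisible by π is divisible by p₁.  Expanding
-- a relation over S between the powers of ζ₁ in powers of π, all coefficients
-- are divisible by p₁, hence by every power of p₁, hence vanish.  So the only
-- relations between the powers of ζ₁ come from the sum of the p₁-th roots of
-- unity.  Using this over S = ℤ[ζ₂] and then over ℤ, the multiplicities satisfy
-- A_{ij,xy} + A_{0j,0y} = A_{ij,0y} + A_{0j,xy}, from which B and C are read off.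
--
-- For q = 2p the roots of unity are ±ω^i; let them stand for the moves ±e_i.  A
-- walk ending at e has the sum Σ e_c ω^c, which is zero exactly when e is
-- diagonal, and the columns (u, v) of a 2 × N matrix correspond to (u, u v̄).

module Submission where

open import Algebra.Bundles using (CommutativeMonoid; CommutativeRing; Semiring)
open import Algebra.Bundles.Raw using (RawMonoid)
import Algebra.Definitions.RawMonoid
import Algebra.Definitions.RawSemiring
import Algebra.Properties.CommutativeMonoid.Sum
import Algebra.Properties.CommutativeSemiring.Binomial
import Algebra.Properties.CommutativeSemiring.Exp
import Algebra.Properties.Group
import Algebra.Properties.Monoid.Mult
import Algebra.Properties.Ring
import Algebra.Properties.Semiring.Exp
import Algebra.Properties.Semiring.Mult
import Algebra.Properties.Semiring.Mult.TCOptimised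
import Algebra.Properties.Semiring.Sum
import Algebra.Solver.Ring
open import Algebra.Solver.Ring.AlmostCommutativeRing using (_-Raw-AlmostCommutative⟶_; fromCommutativeRing)
open import Algebra.Structures using (IsCommutativeRing)
open import Data.Bool.Base using (true; false; if_then_else_)
open import Data.Empty using (⊥; ⊥-elim)
open import Data.Fin.Base using (Fin; zero; suc; toℕ; inject₁; fromℕ; fromℕ<; combine; remQuot; punchIn; _↑ˡ_; _↑ʳ_; splitAt)
open import Data.Fin.Permutation using (Permutation′; _⟨$⟩ʳ_)
import Data.Fin.Permutation as Perm
import Data.Fin.Properties as Fin
open import Data.Fin.Subset using (_∈_; ∣_∣)
import Data.Fin.Subset.Properties as Subset
open import Data.Integer.Base using (ℤ; +_; -[1+_]; _⊖_; _◃_; 0ℤ; 1ℤ)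
import Data.Integer.Base as ℤ
import Data.Integer.Properties as ℤ
open import Data.Maybe.Base using (Maybe; just; nothing)
open import Data.Nat.Base using (ℕ; zero; suc; _∸_; s≤s; z≤n)
import Data.Nat.Base as ℕ
open import Data.Nat.Combinatorics using (_C_; nCk≡n!/k![n-k]!; k![n∸k]!∣n!; nCn≡1)
open import Data.Nat.Coprimality using (Coprime; coprime-divisor; coprime-Bézout)
open import Data.Nat.Divisibility using (_∣_; divides; ∣⇒≤; m∣m*n; ∣-trans; ∣1⇒≡1)
import Data.Nat.DivMod as ℕ
open import Data.Nat.GCD using (module Bézout)
open import Data.Nat.Primality using (Prime; euclidsLemma; prime⇒nonTrivial; prime⇒irreducible; prime[2])
import Data.Nat.Properties as ℕ
import Data.Nat.Solver
open import Data.Product.Base using (∃; ∃₂; Σ; _×_; _,_; proj₁; proj₂; uncurry)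
open import Data.Product.Function.NonDependent.Propositional using (_×-↔_)
open import Data.Rational.Base using (ℚ; 0ℚ; 1ℚ; ½)
import Data.Rational.Base as ℚ
import Data.Rational.Properties as ℚ
open import Data.Rational.Solver using (module +-*-Solver)
open import Data.Rational.Unnormalised.Base using (mkℚᵘ; *≡*)
open import Data.Sign.Base using (Sign)
import Data.Sign.Base as Sign
open import Data.Sum.Base using (_⊎_; inj₁; inj₂; [_,_]′)
open import Data.Vec.Base using (Vec; []; _∷_; _++_; concat; tabulate; replicate; lookup)
import Data.Vec.Properties as Vec
open import Data.Vec.Relation.Unary.All using (All; []; _∷_)
import Data.Vec.Relation.Unary.All as All
import Data.Vec.Relation.Unary.All.Properties as All
open import Defs using (Count; HasCardinality)
open import Function.Base using (_∘_)
open import Function.Bundles using (Bijection; Equivalence; Inverse; _⇔_; _↔_; mk⇔; mk↔ₛ′)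
open import Function.Properties.Inverse using (↔-trans; ↔-sym; ↔-refl)
open import Level using (0ℓ)
open import Relation.Binary.Bundles using (Setoid)
import Relation.Binary.Construct.On as On
open import Relation.Binary.Core using (Rel)
open import Relation.Binary.Definitions using (tri<; tri≈; tri>)
import Relation.Binary.PropositionalEquality as ≡
open ≡ using (_≡_; _≢_)
import Relation.Binary.Reasoning.Setoid
open import Relation.Nullary using (¬_; Dec; yes; no; does)
open import Relation.Nullary.Decidable using (dec-true)
import Relation.Nullary.Decidable as Dec

-- Equality of Cauchy complex numbers cannot be decided, so the argument avoids minimal polynomials,
-- field degrees and Galois conjugates. Everything is phrased as divisibility in subrings of a
-- domain whose cancellation law takes a negated hypothesis. Independence of the powers of ζ₁ over S
-- is what has to be proved, so beforehand S[ζ₁] is known only to be finitely generated over S, and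
-- Nakayama's lemma asks for no more than that. The annihilator it produces is congruent modulo p₁
-- to a power of the element under study, and since S is reduced modulo p₁ one passes from the power
-- to the element. Coprimality of the orders enters this argument through Frobenius, which permutes
-- the powers of ζ₂ so that some iterate fixes S modulo p₁. The final step, from divisibility by all
-- powers of p₁ to zero, is a size estimate in ℤ, and the relations already known over ℤ carry it to
-- ℤ[ζ₂]. The one equality of complex numbers that must be decided is which of finitely many roots
-- of unity an entry is; this is possible because a root of unity of given order close enough to 1
-- equals 1.

module IntegerCoefficients (R : CommutativeRing 0ℓ 0ℓ) where

  open CommutativeRing R hiding (zero)
  open Algebra.Properties.Semiring.Mult.TCOptimised semiring renaming (_×_ to _·_)
  open Algebra.Properties.Ring ring
  open Relation.Binary.Reasoning.Setoid setoid

  -- With the optimised multiple, `1 · 1#` reduces to `1#`, so that the solver constant `con 1ℤ`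
  -- stands for `1#` definitionally.
  fromℤ : ℤ → Carrier
  fromℤ (+ n)    = n · 1#
  fromℤ -[1+ n ] = - (suc n · 1#)

  fromℤ-⊖ : ∀ m n → fromℤ (m ⊖ n) ≈ m · 1# - n · 1#
  fromℤ-⊖ m zero = sym (trans (+-congˡ -0#≈0#) (+-identityʳ _))
  fromℤ-⊖ zero (suc n) = sym (+-identityˡ _)
  fromℤ-⊖ (suc m) (suc n) = begin
    fromℤ (suc m ⊖ suc n)  ≡⟨ ≡.cong fromℤ (ℤ.[1+m]⊖[1+n]≡m⊖n m n) ⟩
    fromℤ (m ⊖ n)  ≈⟨ fromℤ-⊖ m n ⟩
    m · 1# - n · 1#  ≈⟨ +-congʳ (xyx⁻¹≈y 1# (m · 1#)) ⟨
    1# + m · 1# - 1# - n · 1#  ≈⟨ +-assoc _ _ _ ⟩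
    1# + m · 1# + (- 1# - n · 1#)  ≈⟨ +-congˡ (-‿+-comm 1# (n · 1#)) ⟩
    1# + m · 1# - (1# + n · 1#)  ≈⟨ +-cong (1+× m 1#) (-‿cong (1+× n 1#)) ⟨
    suc m · 1# - suc n · 1#  ∎

  fromℤ-neg : ∀ i → fromℤ (ℤ.- i) ≈ - fromℤ i
  fromℤ-neg (+ zero)  = sym -0#≈0#
  fromℤ-neg (+ suc n) = refl
  fromℤ-neg -[1+ n ]  = sym (-‿involutive _)

  fromℤ-+ : ∀ i j → fromℤ (i ℤ.+ j) ≈ fromℤ i + fromℤ j
  fromℤ-+ (+ m) (+ n)       = ×-homo-+ 1# m n
  fromℤ-+ (+ m) -[1+ n ]    = fromℤ-⊖ m (suc n)
  fromℤ-+ -[1+ m ] (+ n)    = trans (fromℤ-⊖ n (suc m)) (+-comm _ _)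
  fromℤ-+ -[1+ m ] -[1+ n ] = begin
    - (suc (suc (m ℕ.+ n)) · 1#)  ≡⟨ ≡.cong (λ k → - (suc k · 1#)) (≡.sym (ℕ+-suc m n)) ⟩
    - ((suc m ℕ.+ suc n) · 1#)  ≈⟨ -‿cong (×-homo-+ 1# (suc m) (suc n)) ⟩
    - (suc m · 1# + suc n · 1#)  ≈⟨ -‿+-comm _ _ ⟨
    - (suc m · 1#) - suc n · 1#  ∎
    where open import Data.Nat.Properties using () renaming (+-suc to ℕ+-suc)

  signed : Sign → Carrier → Carrier
  signed Sign.+ x = x
  signed Sign.- x = - x

  fromℤ-◃ : ∀ s n → fromℤ (s ◃ n) ≈ signed s (n · 1#)
  fromℤ-◃ Sign.+ n = reflexive (≡.cong fromℤ (ℤ.+◃n≡+n n))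
  fromℤ-◃ Sign.- n = trans (reflexive (≡.cong fromℤ (ℤ.-◃n≡-n n))) (fromℤ-neg (+ n))

  fromℤ-* : ∀ i j → fromℤ (i ℤ.* j) ≈ fromℤ i * fromℤ j
  fromℤ-* i j = begin
    fromℤ (ℤ.sign i Sign.* ℤ.sign j ◃ ℤ.∣ i ∣ ℕ.* ℤ.∣ j ∣)
      ≈⟨ fromℤ-◃ (ℤ.sign i Sign.* ℤ.sign j) (ℤ.∣ i ∣ ℕ.* ℤ.∣ j ∣) ⟩
    signed (ℤ.sign i Sign.* ℤ.sign j) ((ℤ.∣ i ∣ ℕ.* ℤ.∣ j ∣) · 1#)
      ≈⟨ go i j ⟩
    fromℤ i * fromℤ j ∎
    where
    go : ∀ i j → signed (ℤ.sign i Sign.* ℤ.sign j) ((ℤ.∣ i ∣ ℕ.* ℤ.∣ j ∣) · 1#)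
                 ≈ fromℤ i * fromℤ j
    go (+ m)    (+ n)    = ×1-homo-* m n
    go (+ m)    -[1+ n ] = trans (-‿cong (×1-homo-* m (suc n))) (-‿distribʳ-* _ _)
    go -[1+ m ] (+ n)    = trans (-‿cong (×1-homo-* (suc m) n)) (-‿distribˡ-* _ _)
    go -[1+ m ] -[1+ n ] = begin
      (suc m ℕ.* suc n) · 1#  ≈⟨ ×1-homo-* (suc m) (suc n) ⟩
      suc m · 1# * suc n · 1#  ≈⟨ -‿involutive _ ⟨
      - (- (suc m · 1# * suc n · 1#))  ≈⟨ -‿cong (-‿distribˡ-* _ _) ⟩
      - (- (suc m · 1#) * suc n · 1#)  ≈⟨ -‿distribʳ-* _ _ ⟩
      - (suc m · 1#) * - (suc n · 1#)  ∎

  morphism : ℤ.+-*-rawRing -Raw-AlmostCommutative⟶ fromCommutativeRing R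
  morphism = record
    { ⟦_⟧    = fromℤ
    ; +-homo = fromℤ-+
    ; *-homo = fromℤ-*
    ; -‿homo = fromℤ-neg
    ; 0-homo = refl
    ; 1-homo = refl
    }

  private
    fromℤ≟ : ∀ i j → Maybe (fromℤ i ≈ fromℤ j)
    fromℤ≟ i j with i ℤ.≟ j
    ... | yes i≡j = just (reflexive (≡.cong fromℤ i≡j))
    ... | no _    = nothing

  module Solver = Algebra.Solver.Ring ℤ.+-*-rawRing (fromCommutativeRing R) morphism fromℤ≟


-- The identities behind complex multiplication, over an arbitrary ring so
-- that the solver never unfolds rational arithmetic.
module GaussianIdentities (R : CommutativeRing 0ℓ 0ℓ) where

  open CommutativeRing R
  open IntegerCoefficients.Solver R

  assoc-re : ∀ a b c d e f → (a * c + - (b * d)) * e + - ((a * d + b * c) * f) ≈ a * (c * e + - (d * f)) + - (b * (c * f + d * e))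
  assoc-re = solve 6 (λ a b c d e f → (a :* c :+ :- (b :* d)) :* e :+ :- ((a :* d :+ b :* c) :* f) := a :* (c :* e :+ :- (d :* f)) :+ :- (b :* (c :* f :+ d :* e))) refl

  assoc-im : ∀ a b c d e f → (a * c + - (b * d)) * f + (a * d + b * c) * e ≈ a * (c * f + d * e) + b * (c * e + - (d * f))
  assoc-im = solve 6 (λ a b c d e f → (a :* c :+ :- (b :* d)) :* f :+ (a :* d :+ b :* c) :* e := a :* (c :* f :+ d :* e) :+ b :* (c :* e :+ :- (d :* f))) refl

  identity-re : ∀ a b → 1# * a + - (0# * b) ≈ a
  identity-re = solve 2 (λ a b → con 1ℤ :* a :+ :- (con 0ℤ :* b) := a) refl

  identity-im : ∀ a b → 1# * b + 0# * a ≈ b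
  identity-im = solve 2 (λ a b → con 1ℤ :* b :+ con 0ℤ :* a := b) refl

  identityʳ-re : ∀ a b → a * 1# + - (b * 0#) ≈ a
  identityʳ-re = solve 2 (λ a b → a :* con 1ℤ :+ :- (b :* con 0ℤ) := a) refl

  identityʳ-im : ∀ a b → a * 0# + b * 1# ≈ b
  identityʳ-im = solve 2 (λ a b → a :* con 0ℤ :+ b :* con 1ℤ := b) refl

  distrib-re : ∀ a b c d e f → a * (c + e) + - (b * (d + f)) ≈ (a * c + - (b * d)) + (a * e + - (b * f))
  distrib-re = solve 6 (λ a b c d e f → a :* (c :+ e) :+ :- (b :* (d :+ f)) := (a :* c :+ :- (b :* d)) :+ (a :* e :+ :- (b :* f))) refl

  distrib-im : ∀ a b c d e f → a * (d + f) + b * (c + e) ≈ (a * d + b * c) + (a * f + b * e)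
  distrib-im = solve 6 (λ a b c d e f → a :* (d :+ f) :+ b :* (c :+ e) := (a :* d :+ b :* c) :+ (a :* f :+ b :* e)) refl

  distribʳ-re : ∀ a b c d e f → (c + e) * a + - ((d + f) * b) ≈ (c * a + - (d * b)) + (e * a + - (f * b))
  distribʳ-re = solve 6 (λ a b c d e f → (c :+ e) :* a :+ :- ((d :+ f) :* b) := (c :* a :+ :- (d :* b)) :+ (e :* a :+ :- (f :* b))) refl

  distribʳ-im : ∀ a b c d e f → (c + e) * b + (d + f) * a ≈ (c * b + d * a) + (e * b + f * a)
  distribʳ-im = solve 6 (λ a b c d e f → (c :+ e) :* b :+ (d :+ f) :* a := (c :* b :+ d :* a) :+ (e :* b :+ f :* a)) refl

  comm-re : ∀ a b c d → a * c + - (b * d) ≈ c * a + - (d * b)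
  comm-re = solve 4 (λ a b c d → a :* c :+ :- (b :* d) := c :* a :+ :- (d :* b)) refl

  comm-im : ∀ a b c d → a * d + b * c ≈ c * b + d * a
  comm-im = solve 4 (λ a b c d → a :* d :+ b :* c := c :* b :+ d :* a) refl

  conj-re : ∀ a b c d → a * c + - (b * d) ≈ a * c + - (- b * - d)
  conj-re = solve 4 (λ a b c d → a :* c :+ :- (b :* d) := a :* c :+ :- ((:- b) :* (:- d))) refl

  conj-im : ∀ a b c d → - (a * d + b * c) ≈ a * - d + - b * c
  conj-im = solve 4 (λ a b c d → :- (a :* d :+ b :* c) := a :* (:- d) :+ (:- b) :* c) refl

  norm-re : ∀ a b c d → (a * a + b * b) * c ≈ a * (a * c + - (b * d)) + b * (a * d + b * c)
  norm-re = solve 4 (λ a b c d → (a :* a :+ b :* b) :* c := a :* (a :* c :+ :- (b :* d)) :+ b :* (a :* d :+ b :* c)) refl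

  norm-im : ∀ a b c d → (a * a + b * b) * d ≈ a * (a * d + b * c) + - b * (a * c + - (b * d))
  norm-im = solve 4 (λ a b c d → (a :* a :+ b :* b) :* d := a :* (a :* d :+ b :* c) :+ (:- b) :* (a :* c :+ :- (b :* d))) refl

-- Integral domains of characteristic zero.

record CharZeroDomain : Set₁ where
  field
    commutativeRing : CommutativeRing 0ℓ 0ℓ
  open CommutativeRing commutativeRing hiding (zero) public
  open IntegerCoefficients commutativeRing public
  private module Mult = Algebra.Properties.Semiring.Mult semiring
  field
    -- This form, rather than a disjunction saying which factor vanishes, is the one that can be
    -- established for Cauchy complex numbers.
    noZeroDivisors : ∀ x y → x * y ≈ 0# → ¬ x ≈ 0# → y ≈ 0#
    ×-charZero     : ∀ n → n Mult.× 1# ≈ 0# → n ≡ 0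

  zeroˡ-cancel : ∀ {x y} → x * y ≈ 0# → ¬ x ≈ 0# → y ≈ 0#
  zeroˡ-cancel {x} {y} = noZeroDivisors x y

  charZero : ∀ n → fromℤ (+ n) ≈ 0# → n ≡ 0
  charZero n eq = ×-charZero n (trans (×ᵤ≈× n 1#) eq)
    where open Algebra.Properties.Semiring.Mult.TCOptimised semiring using (×ᵤ≈×)

  *-cancelˡ-nonZero : ∀ {x y z} → ¬ x ≈ 0# → x * y ≈ x * z → y ≈ z
  *-cancelˡ-nonZero {x} {y} {z} x≉0 xy≈xz =
    x∙y⁻¹≈ε⇒x≈y y z (zeroˡ-cancel (trans (x[y-z]≈xy-xz x y z) (x≈y⇒x∙y⁻¹≈ε xy≈xz)) x≉0)
    where open Algebra.Properties.Ring ring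

-- Prime divisors of factorials and binomial coefficients.

prime⇒∤! : ∀ {p} → Prime p → ∀ k → k ℕ.< p → ¬ p ∣ k ℕ.!
prime⇒∤! {p} p-prime zero    _   p∣1 =
  ℕ.<⇒≱ (ℕ.nonTrivial⇒n>1 p {{prime⇒nonTrivial p-prime}}) (∣⇒≤ p∣1)
prime⇒∤! {p} p-prime (suc k) k<p p∣[1+k]! with euclidsLemma (suc k) (k ℕ.!) p-prime p∣[1+k]!
... | inj₁ p∣1+k = ℕ.<⇒≱ k<p (∣⇒≤ p∣1+k)
... | inj₂ p∣k!  = prime⇒∤! p-prime k (ℕ.<-trans (ℕ.n<1+n k) k<p) p∣k!

-- In p! = C(p,k) k! (p-k)! the prime divides the left side but neither factorial on the right.
prime∣C : ∀ {p} → Prime p → ∀ k → 0 ℕ.< k → k ℕ.< p → p ∣ p C k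
prime∣C {suc n} p-prime k 0<k k<p
  with euclidsLemma (suc n C k) (k ℕ.! ℕ.* (suc n ∸ k) ℕ.!) p-prime
         (≡.subst (suc n ∣_) (≡.sym C*) (m∣m*n (n ℕ.!)))
  where
  instance
    _ = k ℕ.!* (suc n ∸ k) !≢0
  C* : (suc n C k) ℕ.* (k ℕ.! ℕ.* (suc n ∸ k) ℕ.!) ≡ suc n ℕ.!
  C* = ≡.trans (≡.cong (ℕ._* (k ℕ.! ℕ.* (suc n ∸ k) ℕ.!)) (nCk≡n!/k![n-k]! (ℕ.<⇒≤ k<p)))
               (ℕ.m/n*n≡m (k![n∸k]!∣n! (ℕ.<⇒≤ k<p)))
... | inj₁ p∣C = p∣C
... | inj₂ p∣! with euclidsLemma (k ℕ.!) ((suc n ∸ k) ℕ.!) p-prime p∣!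
...   | inj₁ p∣k! = ⊥-elim (prime⇒∤! p-prime k k<p p∣k!)
...   | inj₂ p∣[p-k]! = ⊥-elim (prime⇒∤! p-prime (suc n ∸ k) (ℕ.∸-monoʳ-< 0<k (ℕ.<⇒≤ k<p)) p∣[p-k]!)

-- Generated subrings, congruence modulo p and the Frobenius map.

module Subrings (D : CharZeroDomain) where

  open CharZeroDomain D
  open Solver using (solve; _:=_; _:+_; _:*_; _:-_; :-_; con)
  open Algebra.Properties.Ring ring
  open Algebra.Properties.Semiring.Exp semiring public
  open Algebra.Properties.CommutativeSemiring.Exp commutativeSemiring public using (^-distrib-*)
  open Algebra.Properties.Semiring.Sum semiring public
  module Mult = Algebra.Properties.Semiring.Mult semiring
  open Algebra.Properties.Semiring.Mult.TCOptimised semiring using (×ᵤ≈×)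
  module Binomial = Algebra.Properties.CommutativeSemiring.Binomial commutativeSemiring
  open Relation.Binary.Reasoning.Setoid setoid

  1^ : ∀ n → 1# ^ n ≈ 1#
  1^ zero    = refl
  1^ (suc n) = trans (*-identityˡ _) (1^ n)

  -- Membership is a derivation from the generators, so that Frobenius invariance and expansion in
  -- powers of a generator can be proved by recursion on how an element was built. `resp` closes the
  -- predicate under setoid equality.
  data ⟨_⟩ (G : Carrier → Set) : Carrier → Set where
    gen  : ∀ {x} → G x → ⟨ G ⟩ x
    one  : ⟨ G ⟩ 1#
    add  : ∀ {x y} → ⟨ G ⟩ x → ⟨ G ⟩ y → ⟨ G ⟩ (x + y)
    neg  : ∀ {x} → ⟨ G ⟩ x → ⟨ G ⟩ (- x)
    mul  : ∀ {x y} → ⟨ G ⟩ x → ⟨ G ⟩ y → ⟨ G ⟩ (x * y)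
    resp : ∀ {x y} → x ≈ y → ⟨ G ⟩ x → ⟨ G ⟩ y

  ⟨⟩-map : ∀ {G G′ : Carrier → Set} → (∀ {x} → G x → G′ x) → ∀ {x} → ⟨ G ⟩ x → ⟨ G′ ⟩ x
  ⟨⟩-map f (gen g)     = gen (f g)
  ⟨⟩-map f one         = one
  ⟨⟩-map f (add s t)   = add (⟨⟩-map f s) (⟨⟩-map f t)
  ⟨⟩-map f (neg s)     = neg (⟨⟩-map f s)
  ⟨⟩-map f (mul s t)   = mul (⟨⟩-map f s) (⟨⟩-map f t)
  ⟨⟩-map f (resp eq s) = resp eq (⟨⟩-map f s)

  module _ {G : Carrier → Set} where

    sub : ∀ {x y} → ⟨ G ⟩ x → ⟨ G ⟩ y → ⟨ G ⟩ (x - y)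
    sub s t = add s (neg t)

    nil : ⟨ G ⟩ 0#
    nil = resp (-‿inverseʳ 1#) (sub one one)

    pow : ∀ {x} n → ⟨ G ⟩ x → ⟨ G ⟩ (x ^ n)
    pow zero    s = one
    pow (suc n) s = mul s (pow n s)

    ∑-closed : ∀ {n} {f : Fin n → Carrier} → (∀ i → ⟨ G ⟩ (f i)) → ⟨ G ⟩ (sum f)
    ∑-closed {zero}  s = nil
    ∑-closed {suc n} s = add (s zero) (∑-closed (λ i → s (suc i)))

    ×-closed : ∀ {x} n → ⟨ G ⟩ x → ⟨ G ⟩ (n Mult.× x)
    ×-closed zero    s = nil
    ×-closed (suc n) s = add s (×-closed n s)

    fromℤ-closed : ∀ i → ⟨ G ⟩ (fromℤ i)
    fromℤ-closed (+ n)    = resp (×ᵤ≈× n 1#) (×-closed n one)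
    fromℤ-closed -[1+ n ] = neg (resp (×ᵤ≈× (suc n) 1#) (×-closed (suc n) one))

  Multiple : Carrier → (Carrier → Set) → Carrier → Set
  Multiple a S x = ∃ λ c → S c × x ≈ a * c

  module Congruence (G : Carrier → Set) (p : ℕ) where

    ϖ : Carrier
    ϖ = fromℤ (+ p)

    infix 4 _≋_
    _≋_ : Carrier → Carrier → Set
    x ≋ y = Multiple ϖ ⟨ G ⟩ (x - y)

    ≈⇒≋ : ∀ {x y} → x ≈ y → x ≋ y
    ≈⇒≋ x≈y = 0# , nil , trans (x≈y⇒x∙y⁻¹≈ε x≈y) (sym (zeroʳ ϖ))

    ≋-sym : ∀ {x y} → x ≋ y → y ≋ x
    ≋-sym {x} {y} (c , s , eq) = - c , neg s , (begin
      y - x  ≈⟨ solve 2 (λ x y → y :- x := :- (x :- y)) refl x y ⟩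
      - (x - y)  ≈⟨ -‿cong eq ⟩
      - (ϖ * c)  ≈⟨ -‿distribʳ-* ϖ c ⟩
      ϖ * - c  ∎)

    ≋-trans : ∀ {x y z} → x ≋ y → y ≋ z → x ≋ z
    ≋-trans {x} {y} {z} (c , s , eq) (d , t , eq′) = c + d , add s t , (begin
      x - z  ≈⟨ solve 3 (λ x y z → x :- z := (x :- y) :+ (y :- z)) refl x y z ⟩
      (x - y) + (y - z)  ≈⟨ +-cong eq eq′ ⟩
      ϖ * c + ϖ * d  ≈⟨ distribˡ ϖ c d ⟨
      ϖ * (c + d)  ∎)

    ≋-+ : ∀ {x y x′ y′} → x ≋ x′ → y ≋ y′ → x + y ≋ x′ + y′
    ≋-+ {x} {y} {x′} {y′} (c , s , eq) (d , t , eq′) = c + d , add s t , (begin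
      x + y - (x′ + y′)  ≈⟨ solve 4 (λ x y x′ y′ → x :+ y :- (x′ :+ y′) := (x :- x′) :+ (y :- y′)) refl x y x′ y′ ⟩
      (x - x′) + (y - y′)  ≈⟨ +-cong eq eq′ ⟩
      ϖ * c + ϖ * d  ≈⟨ distribˡ ϖ c d ⟨
      ϖ * (c + d)  ∎)

    ≋-* : ∀ {x y x′ y′} → ⟨ G ⟩ y → ⟨ G ⟩ x′ → x ≋ x′ → y ≋ y′ → x * y ≋ x′ * y′
    ≋-* {x} {y} {x′} {y′} ys x′s (c , s , eq) (d , t , eq′) =
      c * y + x′ * d , add (mul s ys) (mul x′s t) , (begin
      x * y - x′ * y′  ≈⟨ solve 4 (λ x y x′ y′ → x :* y :- x′ :* y′ := (x :- x′) :* y :+ x′ :* (y :- y′)) refl x y x′ y′ ⟩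
      (x - x′) * y + x′ * (y - y′)  ≈⟨ +-cong (*-congʳ eq) (*-congˡ eq′) ⟩
      (ϖ * c) * y + x′ * (ϖ * d)  ≈⟨ solve 5 (λ p c y x′ d → (p :* c) :* y :+ x′ :* (p :* d) := p :* (c :* y :+ x′ :* d)) refl ϖ c y x′ d ⟩
      ϖ * (c * y + x′ * d)  ∎)

    ≋-^ : ∀ {x y} n → ⟨ G ⟩ x → ⟨ G ⟩ y → x ≋ y → x ^ n ≋ y ^ n
    ≋-^ zero    s t eq = ≈⇒≋ refl
    ≋-^ (suc n) s t eq = ≋-* (pow n s) t eq (≋-^ n s t eq)

    ≋0⇒Multiple : ∀ {x} → x ≋ 0# → Multiple ϖ ⟨ G ⟩ x
    ≋0⇒Multiple {x} (c , s , eq) = c , s , trans (solve 1 (λ x → x := x :- con 0ℤ) refl x) eq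

    Multiple⇒≋0 : ∀ {x} → Multiple ϖ ⟨ G ⟩ x → x ≋ 0#
    Multiple⇒≋0 {x} (c , s , eq) = c , s , trans (solve 1 (λ x → x :- con 0ℤ := x) refl x) eq

    Multiple-+ : ∀ {x y} → Multiple ϖ ⟨ G ⟩ x → Multiple ϖ ⟨ G ⟩ y → Multiple ϖ ⟨ G ⟩ (x + y)
    Multiple-+ (c , s , eq) (d , t , eq′) = c + d , add s t , trans (+-cong eq eq′) (sym (distribˡ ϖ c d))

    Multiple-*ʳ : ∀ {x y} → Multiple ϖ ⟨ G ⟩ x → ⟨ G ⟩ y → Multiple ϖ ⟨ G ⟩ (x * y)
    Multiple-*ʳ (c , s , eq) t = c * _ , mul s t , trans (*-congʳ eq) (*-assoc ϖ c _)

    Multiple-∑ : ∀ {n} {f : Fin n → Carrier} → (∀ i → Multiple ϖ ⟨ G ⟩ (f i)) → Multiple ϖ ⟨ G ⟩ (sum f)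
    Multiple-∑ {zero}  m = 0# , nil , sym (zeroʳ ϖ)
    Multiple-∑ {suc n} m = Multiple-+ (m zero) (Multiple-∑ (λ i → m (suc i)))

    ∣⇒Multiple : ∀ {n x} → p ∣ n → ⟨ G ⟩ x → Multiple ϖ ⟨ G ⟩ (n Mult.× x)
    ∣⇒Multiple {n} {x} (divides q n≡qp) s = q Mult.× x , ×-closed q s , (begin
      n Mult.× x  ≡⟨ ≡.cong (Mult._× x) (≡.trans n≡qp (ℕ.*-comm q p)) ⟩
      (p ℕ.* q) Mult.× x  ≈⟨ Mult.×-assocˡ x p q ⟨
      p Mult.× (q Mult.× x)  ≈⟨ Mult.×-congʳ p (*-identityˡ _) ⟨
      p Mult.× (1# * (q Mult.× x))  ≈⟨ Mult.×-assoc-* p 1# _ ⟨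
      (p Mult.× 1#) * (q Mult.× x)  ≈⟨ *-congʳ (×ᵤ≈× p 1#) ⟩
      ϖ * (q Mult.× x)  ∎)

  module Frobenius (G : Carrier → Set) {p : ℕ} (p-prime : Prime p) where

    open Congruence G p public

    freshman : ∀ {x y} → ⟨ G ⟩ x → ⟨ G ⟩ y → (x + y) ^ p ≋ x ^ p + y ^ p
    freshman {x} {y} s t = go p p-prime ≡.refl
      where
      go : ∀ q → Prime q → q ≡ p → (x + y) ^ p ≋ x ^ p + y ^ p
      go (suc n) q-prime ≡.refl =
        proj₁ middle , proj₁ (proj₂ middle) , (begin
          (x + y) ^ suc n - (x ^ suc n + y ^ suc n)
            ≈⟨ +-congʳ (Binomial.theorem (suc n) x y) ⟩
          term zero + sum (λ k → term (suc k)) - (x ^ suc n + y ^ suc n)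
            ≈⟨ +-congʳ (+-cong first (trans (sum-init-last (λ k → term (suc k))) (+-congˡ final))) ⟩
          y ^ suc n + (sum mid + x ^ suc n) - (x ^ suc n + y ^ suc n)
            ≈⟨ solve 3 (λ a m b → b :+ (m :+ a) :- (a :+ b) := m) refl (x ^ suc n) (sum mid) (y ^ suc n) ⟩
          sum mid
            ≈⟨ proj₂ (proj₂ middle) ⟩
          ϖ * proj₁ middle ∎)
        where
        term : Fin (suc (suc n)) → Carrier
        term = Binomial.binomialTerm x y (suc n)
        mid : Fin n → Carrier
        mid k = term (suc (inject₁ k))
        first : term zero ≈ y ^ suc n
        first = trans (+-identityʳ _) (*-identityˡ _)
        final : term (suc (fromℕ n)) ≈ x ^ suc n
        final = begin
          (suc n C suc (toℕ (fromℕ n))) Mult.× (x ^ suc (toℕ (fromℕ n)) * y ^ (n ∸ toℕ (fromℕ n)))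
            ≡⟨ ≡.cong (λ k → (suc n C suc k) Mult.× (x ^ suc k * y ^ (n ∸ k))) (Fin.toℕ-fromℕ n) ⟩
          (suc n C suc n) Mult.× (x ^ suc n * y ^ (n ∸ n))
            ≡⟨ ≡.cong₂ (λ c k → c Mult.× (x ^ suc n * y ^ k)) (nCn≡1 (suc n)) (ℕ.n∸n≡0 n) ⟩
          1 Mult.× (x ^ suc n * 1#)
            ≈⟨ trans (+-identityʳ _) (*-identityʳ _) ⟩
          x ^ suc n ∎
        middle : Multiple ϖ ⟨ G ⟩ (sum mid)
        middle = Multiple-∑ λ k → ∣⇒Multiple
          (prime∣C q-prime (suc (toℕ (inject₁ k))) (s≤s z≤n)
            (s≤s (≡.subst (ℕ._< n) (≡.sym (Fin.toℕ-inject₁ k)) (Fin.toℕ<n k))))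
          (mul (pow (suc (toℕ (inject₁ k))) s) (pow (suc n ∸ suc (toℕ (inject₁ k))) t))

    freshman^ : ∀ m {x y} → ⟨ G ⟩ x → ⟨ G ⟩ y →
                (x + y) ^ (p ℕ.^ m) ≋ x ^ (p ℕ.^ m) + y ^ (p ℕ.^ m)
    freshman^ zero {x} {y} s t = ≈⇒≋ (distribʳ 1# x y)
    freshman^ (suc m) {x} {y} s t =
      ≋-trans (≈⇒≋ (sym (^-assocʳ (x + y) p (p ℕ.^ m))))
      (≋-trans (≋-^ (p ℕ.^ m) (pow p (add s t)) (add (pow p s) (pow p t)) (freshman s t))
      (≋-trans (freshman^ m (pow p s) (pow p t))
      (≈⇒≋ (+-cong (^-assocʳ x p (p ℕ.^ m)) (^-assocʳ y p (p ℕ.^ m))))))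

    -- Modulo p the map x ↦ x^(p^m) respects sums and products, so the elements it fixes form a
    -- subring, and it is enough to check the generators.
    frobenius-fixes : ∀ m → (∀ {g} → G g → g ^ (p ℕ.^ m) ≈ g) →
                      ∀ {x} → ⟨ G ⟩ x → x ^ (p ℕ.^ m) ≋ x
    frobenius-fixes m fix (gen g)   = ≈⇒≋ (fix g)
    frobenius-fixes m fix one       = ≈⇒≋ (1^ (p ℕ.^ m))
    frobenius-fixes m fix (add s t) =
      ≋-trans (freshman^ m s t) (≋-+ (frobenius-fixes m fix s) (frobenius-fixes m fix t))
    -- From x^q + (-x)^q ≋ (x - x)^q = 0, which avoids distinguishing odd p from p = 2.
    frobenius-fixes m fix (neg {x} s) =
      ≋-trans (≈⇒≋ (solve 2 (λ a b → b := con 0ℤ :- a :+ (a :+ b)) refl (x ^ q) ((- x) ^ q)))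
      (≋-trans (≋-+ {y′ = 0#} (≋-neg (frobenius-fixes m fix s)) (≋-trans (≋-sym (freshman^ m s (neg s))) (≈⇒≋ 0^q)))
      (≈⇒≋ (solve 1 (λ x → con 0ℤ :- x :+ con 0ℤ := :- x) refl x)))
      where
      q = p ℕ.^ m
      ≋-neg : ∀ {a b} → a ≋ b → 0# - a ≋ 0# - b
      ≋-neg {a} {b} (c , s , eq) = - c , neg s , (begin
        0# - a - (0# - b)  ≈⟨ solve 2 (λ a b → con 0ℤ :- a :- (con 0ℤ :- b) := :- (a :- b)) refl a b ⟩
        - (a - b)  ≈⟨ -‿cong eq ⟩
        - (ϖ * c)  ≈⟨ -‿distribʳ-* ϖ c ⟩
        ϖ * - c  ∎)
      0^q : (x + - x) ^ q ≈ 0#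
      0^q with q | ℕ.m^n>0 p {{ℕ.nonTrivial⇒nonZero p {{prime⇒nonTrivial p-prime}}}} m
      ... | suc k | _ = trans (*-congʳ (-‿inverseʳ x)) (zeroˡ _)
    frobenius-fixes m fix (mul {x} {y} s t) =
      ≋-trans (≈⇒≋ (^-distrib-* x y (p ℕ.^ m)))
        (≋-* (pow (p ℕ.^ m) t) s (frobenius-fixes m fix s) (frobenius-fixes m fix t))
    frobenius-fixes m fix (resp eq s) =
      ≋-trans (≈⇒≋ (^-congˡ (p ℕ.^ m) (sym eq))) (≋-trans (frobenius-fixes m fix s) (≈⇒≋ eq))

    -- x ≋ x ^ q lets every exponent k ≥ 2 be raised, so that divisibility of
    -- x ^ k by p passes down to x ^ (k ∸ 1).
    reduced : ∀ {q x} → 2 ℕ.≤ q → ⟨ G ⟩ x → x ^ q ≋ x →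
              ∀ k → Multiple ϖ ⟨ G ⟩ (x ^ k) → Multiple ϖ ⟨ G ⟩ x
    reduced {q} {x} 2≤q s fix zero m = let c , t , eq = Multiple-*ʳ m s in c , t , trans (sym (*-identityˡ x)) eq
    reduced {q} {x} 2≤q s fix (suc zero) (c , t , eq) = c , t , trans (sym (*-identityʳ x)) eq
    reduced {suc (suc q)} {x} 2≤q s fix (suc (suc k)) m =
      reduced 2≤q s fix (suc k) (≋0⇒Multiple
        (≋-trans (≋-* (pow k s) (pow (suc (suc q)) s) (≋-sym fix) (≈⇒≋ refl))
        (≋-trans (≈⇒≋ (solve 3 (λ x y z → (x :* (x :* y)) :* z := (x :* (x :* z)) :* y) refl x (x ^ q) (x ^ k)))
        (Multiple⇒≋0 (Multiple-*ʳ m (pow q s))))))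
    reduced {suc zero} (s≤s ())

-- Nakayama's lemma and the adjunction of a root of unity.

module Integrality (D : CharZeroDomain) where

  open CharZeroDomain D
  open Subrings D
  open Solver using (solve; _:=_; _:+_; _:*_; _:-_; :-_; con)
  open Algebra.Properties.Ring ring
  open Relation.Binary.Reasoning.Setoid setoid

  -- Nakayama's lemma by Gaussian elimination; U plays the role of the
  -- multiplicative set of denominators congruent to a power of one element.
  module _ {S U : Carrier → Set} (ϖ : Carrier)
    (S-add : ∀ {x y} → S x → S y → S (x + y))
    (S-mul : ∀ {x y} → S x → S y → S (x * y))
    (ϖ∈S : S ϖ) (U⊆S : ∀ {u} → U u → S u)
    (U-1 : U 1#) (U-mul : ∀ {u v} → U u → U v → U (u * v))
    (U-sub : ∀ {u s} → U u → S s → U (u - ϖ * s)) where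

    nakayama : ∀ n (v u : Fin n → Carrier) (b : Fin n → Fin n → Carrier) →
               (∀ i → U (u i)) → (∀ i j → S (b i j)) →
               (∀ i → u i * v i ≈ ϖ * sum (λ j → b i j * v j)) →
               ∃ λ d → U d × ∀ i → d * v i ≈ 0#
    nakayama zero    v u b u∈U b∈S eq = 1# , U-1 , λ ()
    nakayama (suc n) v u b u∈U b∈S eq = d * w , U-mul d∈U w∈U , kills
      where
      v₀ = v zero
      -- The pivot. The other rows are multiplied by it and nothing is ever divided by it, so it
      -- need not be invertible or even nonzero.
      w = u zero - ϖ * b zero zero
      w∈U : U w
      w∈U = U-sub (u∈U zero) (b∈S zero zero)
      row : Fin (suc n) → Carrier
      row i = sum (λ j → b i (suc j) * v (suc j))
      wv₀ : w * v₀ ≈ ϖ * row zero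
      wv₀ = begin
        (u zero - ϖ * b zero zero) * v₀
          ≈⟨ solve 4 (λ u p b v → (u :- p :* b) :* v := u :* v :- p :* (b :* v)) refl (u zero) ϖ (b zero zero) v₀ ⟩
        u zero * v₀ - ϖ * (b zero zero * v₀)
          ≈⟨ +-congʳ (eq zero) ⟩
        ϖ * (b zero zero * v₀ + row zero) - ϖ * (b zero zero * v₀)
          ≈⟨ solve 3 (λ p x r → p :* (x :+ r) :- p :* x := p :* r) refl ϖ (b zero zero * v₀) (row zero) ⟩
        ϖ * row zero ∎
      b′ : Fin n → Fin n → Carrier
      b′ i j = w * b (suc i) (suc j) + ϖ * b (suc i) zero * b zero (suc j)
      eq′ : ∀ i → (w * u (suc i)) * v (suc i) ≈ ϖ * sum (λ j → b′ i j * v (suc j))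
      eq′ i = begin
        (w * u (suc i)) * v (suc i)
          ≈⟨ *-assoc _ _ _ ⟩
        w * (u (suc i) * v (suc i))
          ≈⟨ *-congˡ (eq (suc i)) ⟩
        w * (ϖ * (b₀ * v₀ + row (suc i)))
          ≈⟨ solve 5 (λ w p b v r → w :* (p :* (b :* v :+ r)) := p :* (w :* r) :+ p :* b :* (w :* v)) refl w ϖ b₀ v₀ (row (suc i)) ⟩
        ϖ * (w * row (suc i)) + ϖ * b₀ * (w * v₀)
          ≈⟨ +-congˡ (*-congˡ wv₀) ⟩
        ϖ * (w * row (suc i)) + ϖ * b₀ * (ϖ * row zero)
          ≈⟨ solve 4 (λ p x b r → p :* x :+ p :* b :* (p :* r) := p :* (x :+ p :* b :* r)) refl ϖ (w * row (suc i)) b₀ (row zero) ⟩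
        ϖ * (w * row (suc i) + ϖ * b₀ * row zero)
          ≈⟨ *-congˡ (+-cong (*-distribˡ-sum w (λ j → b (suc i) (suc j) * v (suc j)))
                             (*-distribˡ-sum (ϖ * b₀) (λ j → b zero (suc j) * v (suc j)))) ⟩
        ϖ * (sum (λ j → w * (b (suc i) (suc j) * v (suc j))) + sum (λ j → ϖ * b₀ * (b zero (suc j) * v (suc j))))
          ≈⟨ *-congˡ (sym (∑-distrib-+ (λ j → w * (b (suc i) (suc j) * v (suc j))) (λ j → ϖ * b₀ * (b zero (suc j) * v (suc j))))) ⟩
        ϖ * sum (λ j → w * (b (suc i) (suc j) * v (suc j)) + ϖ * b₀ * (b zero (suc j) * v (suc j)))
          ≈⟨ *-congˡ (sum-cong-≋ (λ j → solve 5 (λ w x v q y → w :* (x :* v) :+ q :* (y :* v) := (w :* x :+ q :* y) :* v) refl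
                       w (b (suc i) (suc j)) (v (suc j)) (ϖ * b₀) (b zero (suc j)))) ⟩
        ϖ * sum (λ j → b′ i j * v (suc j)) ∎
        where b₀ = b (suc i) zero
      rest : ∃ λ d → U d × ∀ i → d * v (suc i) ≈ 0#
      rest = nakayama n (v ∘ suc) (λ i → w * u (suc i)) b′
        (λ i → U-mul w∈U (u∈U (suc i)))
        (λ i j → S-add (S-mul (U⊆S w∈U) (b∈S (suc i) (suc j)))
                       (S-mul (S-mul ϖ∈S (b∈S (suc i) zero)) (b∈S zero (suc j))))
        eq′
      d = proj₁ rest
      d∈U = proj₁ (proj₂ rest)
      kills : ∀ i → (d * w) * v i ≈ 0#
      kills zero = begin
        (d * w) * v₀  ≈⟨ *-assoc d w v₀ ⟩
        d * (w * v₀)  ≈⟨ *-congˡ wv₀ ⟩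
        d * (ϖ * row zero)  ≈⟨ solve 3 (λ d p r → d :* (p :* r) := p :* (d :* r)) refl d ϖ (row zero) ⟩
        ϖ * (d * row zero)  ≈⟨ *-congˡ (*-distribˡ-sum d (λ j → b zero (suc j) * v (suc j))) ⟩
        ϖ * sum (λ j → d * (b zero (suc j) * v (suc j)))
          ≈⟨ *-congˡ (sum-cong-≋ (λ j → trans
               (solve 3 (λ d b v → d :* (b :* v) := b :* (d :* v)) refl d (b zero (suc j)) (v (suc j)))
               (trans (*-congˡ (proj₂ (proj₂ rest) j)) (zeroʳ _)))) ⟩
        ϖ * sum {n} (λ j → 0#)  ≈⟨ *-congˡ (sum-replicate-zero n) ⟩
        ϖ * 0#  ≈⟨ zeroʳ ϖ ⟩
        0#  ∎
      kills (suc i) = begin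
        (d * w) * v (suc i)  ≈⟨ solve 3 (λ d w v → (d :* w) :* v := w :* (d :* v)) refl d w (v (suc i)) ⟩
        w * (d * v (suc i))  ≈⟨ *-congˡ (proj₂ (proj₂ rest) i) ⟩
        w * 0#  ≈⟨ zeroʳ w ⟩
        0#  ∎

  Adjoin : (Carrier → Set) → Carrier → Carrier → Set
  Adjoin G ζ x = G x ⊎ x ≈ ζ

  module PowerBasis (G : Carrier → Set) (ζ : Carrier) (n : ℕ) (ζⁿ≈1 : ζ ^ suc n ≈ 1#) where

    Spanned : Carrier → Set
    Spanned z = ∃ λ (c : Fin (suc n) → Carrier) →
      (∀ i → ⟨ G ⟩ (c i)) × z ≈ sum (λ i → c i * ζ ^ toℕ i)

    private
      S-resp : ∀ {x y} → x ≈ y → Spanned x → Spanned y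
      S-resp eq (c , s , eq′) = c , s , trans (sym eq) eq′

      S-add : ∀ {x y} → Spanned x → Spanned y → Spanned (x + y)
      S-add (c , s , eq) (d , t , eq′) = (λ i → c i + d i) , (λ i → add (s i) (t i)) ,
        trans (+-cong eq eq′) (trans (sym (∑-distrib-+ (λ i → c i * ζ ^ toℕ i) (λ i → d i * ζ ^ toℕ i)))
          (sum-cong-≋ (λ i → sym (distribʳ (ζ ^ toℕ i) (c i) (d i)))))

      S-scale : ∀ {a x} → ⟨ G ⟩ a → Spanned x → Spanned (a * x)
      S-scale {a} r (c , s , eq) = (λ i → a * c i) , (λ i → mul r (s i)) ,
        trans (*-congˡ eq) (trans (*-distribˡ-sum a (λ i → c i * ζ ^ toℕ i))
          (sum-cong-≋ (λ i → sym (*-assoc a (c i) (ζ ^ toℕ i)))))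

      -- Multiplication by ζ rotates the coefficients, because the top power wraps around to 1.
      S-shift : ∀ {x} → Spanned x → Spanned (ζ * x)
      S-shift {x} (c , s , eq) = c′ , (λ { zero → s (fromℕ n) ; (suc i) → s (inject₁ i) }) , (begin
        ζ * x
          ≈⟨ *-congˡ eq ⟩
        ζ * sum (λ i → c i * ζ ^ toℕ i)
          ≈⟨ *-congˡ (sum-init-last (λ i → c i * ζ ^ toℕ i)) ⟩
        ζ * (sum (λ i → c (inject₁ i) * ζ ^ toℕ (inject₁ i)) + c (fromℕ n) * ζ ^ toℕ (fromℕ n))
          ≈⟨ distribˡ ζ _ _ ⟩
        ζ * sum (λ i → c (inject₁ i) * ζ ^ toℕ (inject₁ i)) + ζ * (c (fromℕ n) * ζ ^ toℕ (fromℕ n))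
          ≈⟨ +-cong
              (trans (*-distribˡ-sum ζ (λ i → c (inject₁ i) * ζ ^ toℕ (inject₁ i)))
                (sum-cong-≋ (λ i → trans (swap (c (inject₁ i)) (ζ ^ toℕ (inject₁ i)))
                   (*-congˡ (*-congˡ (^-congʳ ζ (Fin.toℕ-inject₁ i)))))))
              (trans (swap (c (fromℕ n)) (ζ ^ toℕ (fromℕ n)))
                (*-congˡ (trans (^-congʳ ζ (≡.cong suc (Fin.toℕ-fromℕ n))) ζⁿ≈1))) ⟩
        sum (λ i → c (inject₁ i) * ζ ^ suc (toℕ i)) + c (fromℕ n) * 1#
          ≈⟨ +-comm _ _ ⟩
        sum (λ i → c′ i * ζ ^ toℕ i) ∎)
        where
        c′ : Fin (suc n) → Carrier
        c′ zero    = c (fromℕ n)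
        c′ (suc i) = c (inject₁ i)
        swap : ∀ a b → ζ * (a * b) ≈ a * (ζ * b)
        swap = solve 3 (λ z a b → z :* (a :* b) := a :* (z :* b)) refl ζ

      S-one : Spanned 1#
      S-one = c , (λ { zero → one ; (suc i) → nil }) , (begin
        1#  ≈⟨ trans (sym (+-identityʳ 1#)) (+-congʳ (sym (*-identityʳ 1#))) ⟩
        1# * 1# + 0#  ≈⟨ +-congˡ (sym (sum-replicate-zero n)) ⟩
        1# * 1# + sum {n} (λ i → 0#)  ≈⟨ +-congˡ (sum-cong-≋ {n} (λ i → sym (zeroˡ (ζ ^ suc (toℕ i))))) ⟩
        sum (λ i → c i * ζ ^ toℕ i)  ∎)
        where
        c : Fin (suc n) → Carrier
        c zero    = 1#
        c (suc i) = 0#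

      -- The span is treated as a module stable under each way of building x, so two expansions
      -- never have to be multiplied together.
      S-mul : ∀ {x} → ⟨ Adjoin G ζ ⟩ x → ∀ {y} → Spanned y → Spanned (x * y)
      S-mul (gen (inj₁ g))    m = S-scale (gen g) m
      S-mul (gen (inj₂ x≈ζ))  m = S-resp (*-congʳ (sym x≈ζ)) (S-shift m)
      S-mul one               m = S-resp (sym (*-identityˡ _)) m
      S-mul (add s t)         m = S-resp (sym (distribʳ _ _ _)) (S-add (S-mul s m) (S-mul t m))
      S-mul (neg {x} s) {y}   m = S-resp (solve 2 (λ x y → (:- con 1ℤ) :* (x :* y) := (:- x) :* y) refl x y)
                                    (S-scale (neg one) (S-mul s m))
      S-mul (mul s t)         m = S-resp (sym (*-assoc _ _ _)) (S-mul s (S-mul t m))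
      S-mul (resp eq s)       m = S-resp (*-congʳ eq) (S-mul s m)

    spanned : ∀ {x} → ⟨ Adjoin G ζ ⟩ x → Spanned x
    spanned s = S-resp (*-identityʳ _) (S-mul s S-one)

    ζ∈ : ∀ k → ⟨ Adjoin G ζ ⟩ (ζ ^ k)
    ζ∈ k = pow k (gen (inj₂ refl))

    module _ {p : ℕ} (p-prime : Prime p) where

      private module F = Frobenius G p-prime
      open F using (ϖ; _≋_)

      -- On the generators ζ^i multiplication by x^k is ϖ times a matrix over `⟨ G ⟩`. Nakayama
      -- yields some d in `⟨ G ⟩`, congruent to a power x^l, that kills all generators. One of them
      -- is ζ^0 = 1, hence d = 0 and x^l is divisible by p already in `⟨ G ⟩`; `reduced` then
      -- descends to x.
      integrality : ∀ {q} → 2 ℕ.≤ q → ∀ {x} → ⟨ G ⟩ x → x ^ q ≋ x →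
                    ∀ k → Multiple ϖ ⟨ Adjoin G ζ ⟩ (x ^ k) → Multiple ϖ ⟨ G ⟩ x
      integrality 2≤q {x} s fix k (β , β∈T , xᵏ≈ϖβ) =
        finish (nakayama {⟨ G ⟩} {U} ϖ add mul (fromℤ-closed (+ p)) proj₁ U-one U-mul U-sub
          (suc n) (λ i → ζ ^ toℕ i) (λ i → x ^ k) (λ i → proj₁ (rows i))
          (λ i → pow k s , k , F.≈⇒≋ refl)
          (λ i → proj₁ (proj₂ (rows i)))
          relation)
        where
        U : Carrier → Set
        U u = ⟨ G ⟩ u × ∃ λ k → u ≋ x ^ k
        U-one : U 1#
        U-one = one , 0 , F.≈⇒≋ refl
        U-mul : ∀ {u v} → U u → U v → U (u * v)
        U-mul (us , k , u≋) (vs , l , v≋) = mul us vs , k ℕ.+ l ,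
          F.≋-trans (F.≋-* vs (pow k s) u≋ v≋) (F.≈⇒≋ (sym (^-homo-* x k l)))
        U-sub : ∀ {u t} → U u → ⟨ G ⟩ t → U (u - ϖ * t)
        U-sub {u} {t} (us , k , u≋) ts = sub us (mul (fromℤ-closed (+ p)) ts) , k ,
          F.≋-trans (- t , neg ts , solve 3 (λ u p t → u :- p :* t :- u := p :* (:- t)) refl u ϖ t) u≋
        rows : ∀ (i : Fin (suc n)) → Spanned (β * ζ ^ toℕ i)
        rows i = spanned (mul β∈T (ζ∈ (toℕ i)))
        relation : ∀ i → x ^ k * ζ ^ toℕ i ≈ ϖ * sum (λ j → proj₁ (rows i) j * ζ ^ toℕ j)
        relation i = begin
          x ^ k * ζ ^ toℕ i  ≈⟨ *-congʳ xᵏ≈ϖβ ⟩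
          (ϖ * β) * ζ ^ toℕ i  ≈⟨ *-assoc _ _ _ ⟩
          ϖ * (β * ζ ^ toℕ i)  ≈⟨ *-congˡ (proj₂ (proj₂ (rows i))) ⟩
          ϖ * sum (λ j → proj₁ (rows i) j * ζ ^ toℕ j) ∎
        finish : (∃ λ d → U d × ∀ (i : Fin (suc n)) → d * ζ ^ toℕ i ≈ 0#) → Multiple ϖ ⟨ G ⟩ x
        finish (d , (d∈S , l , d≋xˡ) , kills) = F.reduced 2≤q s fix l
          (F.≋0⇒Multiple (F.≋-trans (F.≋-sym d≋xˡ) (F.≈⇒≋ (trans (sym (*-identityʳ d)) (kills zero)))))

-- Polynomials with prescribed roots, primitive roots of unity and the element ζ - 1.

module Polynomials (D : CharZeroDomain) where

  open CharZeroDomain D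
  open Subrings D
  open Solver using (solve; _:=_; _:+_; _:*_; _:-_; :-_; con)
  open Algebra.Properties.Ring ring
  open Algebra.Definitions.RawSemiring (Semiring.rawSemiring semiring) public using (product)
  open Algebra.Properties.Semiring.Mult.TCOptimised semiring using (×ᵤ≈×)
  open Relation.Binary.Reasoning.Setoid setoid

  private
    variable
      n : ℕ

  -- Coefficients are listed from the constant term upwards.
  eval : Vec Carrier n → Carrier → Carrier
  eval []       x = 0#
  eval (c ∷ cs) x = c + x * eval cs x

  leading : Vec Carrier (suc n) → Carrier
  leading (c ∷ [])     = c
  leading (c ∷ d ∷ cs) = leading (d ∷ cs)

  remainder : Carrier → Vec Carrier (suc n) → Carrier
  remainder r (c ∷ [])     = c
  remainder r (c ∷ d ∷ cs) = c + r * remainder r (d ∷ cs)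

  quotient : Carrier → Vec Carrier (suc n) → Vec Carrier n
  quotient r (c ∷ [])     = []
  quotient r (c ∷ d ∷ cs) = remainder r (d ∷ cs) ∷ quotient r (d ∷ cs)

  -- Horner's scheme: the successive values of the scheme are the coefficients of the quotient, and
  -- the last one is the remainder.
  division : ∀ r (f : Vec Carrier (suc n)) x →
             eval f x ≈ remainder r f + (x - r) * eval (quotient r f) x
  division r (c ∷ []) x = solve 3 (λ r c x → c :+ x :* con 0ℤ := c :+ (x :- r) :* con 0ℤ) refl r c x
  division r (c ∷ d ∷ cs) x = begin
    c + x * eval (d ∷ cs) x
      ≈⟨ +-congˡ (*-congˡ (division r (d ∷ cs) x)) ⟩
    c + x * (e + (x - r) * g)
      ≈⟨ solve 5 (λ r c x e g → c :+ x :* (e :+ (x :- r) :* g) := c :+ r :* e :+ (x :- r) :* (e :+ x :* g)) refl r c x e g ⟩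
    c + r * e + (x - r) * (e + x * g) ∎
    where
    e = remainder r (d ∷ cs)
    g = eval (quotient r (d ∷ cs)) x

  remainder-root : ∀ r (f : Vec Carrier (suc n)) → eval f r ≈ 0# → remainder r f ≈ 0#
  remainder-root r f root = begin
    remainder r f
      ≈⟨ solve 3 (λ e r g → e := e :+ (r :- r) :* g) refl (remainder r f) r (eval (quotient r f) r) ⟩
    remainder r f + (r - r) * eval (quotient r f) r
      ≈⟨ division r f r ⟨
    eval f r
      ≈⟨ root ⟩
    0# ∎

  leading-quotient : ∀ r c (f : Vec Carrier (suc n)) → leading (quotient r (c ∷ f)) ≡ leading f
  leading-quotient r c (d ∷ [])     = ≡.refl
  leading-quotient r c (d ∷ e ∷ cs) = leading-quotient r d (e ∷ cs)

  -- Dividing by `x - r zero` keeps the leading coefficient and the other roots, since the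
  -- differences `r (suc i) - r zero` are nonzero and can be cancelled.
  factorization : (f : Vec Carrier (suc n)) (r : Fin n → Carrier) →
                  (∀ {i j} → r i ≈ r j → i ≡ j) → (∀ i → eval f (r i) ≈ 0#) →
                  ∀ x → eval f x ≈ leading f * product (λ i → x - r i)
  factorization {zero} (c ∷ []) r inj root x = solve 2 (λ c x → c :+ x :* con 0ℤ := c :* con 1ℤ) refl c x
  factorization {suc n} f@(c ∷ f′) r inj root x = begin
    eval f x
      ≈⟨ division r₀ f x ⟩
    remainder r₀ f + (x - r₀) * eval g x
      ≈⟨ +-cong (remainder-root r₀ f (root zero)) (*-congˡ (factorization g (r ∘ suc) (Fin.suc-injective ∘ inj) root′ x)) ⟩
    0# + (x - r₀) * (leading g * product (λ i → x - r (suc i)))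
      ≈⟨ solve 3 (λ a l p → con 0ℤ :+ a :* (l :* p) := l :* (a :* p)) refl (x - r₀) (leading g) (product (λ i → x - r (suc i))) ⟩
    leading g * product (λ i → x - r i)
      ≡⟨ ≡.cong (_* product (λ i → x - r i)) (≡.trans (leading-quotient r₀ c f′) (leading-∷ c f′)) ⟩
    leading f * product (λ i → x - r i) ∎
    where
    r₀ = r zero
    g = quotient r₀ f
    leading-∷ : ∀ {m} c (f : Vec Carrier (suc m)) → leading f ≡ leading (c ∷ f)
    leading-∷ c (d ∷ f) = ≡.refl
    root′ : ∀ i → eval g (r (suc i)) ≈ 0#
    root′ i = zeroˡ-cancel
      (begin
        (r (suc i) - r₀) * eval g (r (suc i))
          ≈⟨ +-identityˡ _ ⟨
        0# + (r (suc i) - r₀) * eval g (r (suc i))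
          ≈⟨ +-congʳ (remainder-root r₀ f (root zero)) ⟨
        remainder r₀ f + (r (suc i) - r₀) * eval g (r (suc i))
          ≈⟨ division r₀ f (r (suc i)) ⟨
        eval f (r (suc i))
          ≈⟨ root (suc i) ⟩
        0# ∎)
      λ eq → Fin.0≢1+n (≡.sym (inj (x∙y⁻¹≈ε⇒x≈y _ _ eq)))

  monomial : ∀ n → Vec Carrier (suc n)
  monomial zero    = 1# ∷ []
  monomial (suc n) = 0# ∷ monomial n

  eval-monomial : ∀ n x → eval (monomial n) x ≈ x ^ n
  eval-monomial zero    x = solve 1 (λ x → con 1ℤ :+ x :* con 0ℤ := con 1ℤ) refl x
  eval-monomial (suc n) x = trans (+-identityˡ _) (*-congˡ (eval-monomial n x))

  leading-monomial : ∀ c n → leading (c ∷ monomial n) ≡ 1#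
  leading-monomial c zero    = ≡.refl
  leading-monomial c (suc n) = leading-monomial 0# n

  eval-ones : ∀ n x → (x - 1#) * eval (replicate n 1#) x ≈ x ^ n - 1#
  eval-ones zero    x = solve 1 (λ x → (x :- con 1ℤ) :* con 0ℤ := con 1ℤ :- con 1ℤ) refl x
  eval-ones (suc n) x = begin
    (x - 1#) * (1# + x * eval (replicate n 1#) x)
      ≈⟨ solve 2 (λ x e → (x :- con 1ℤ) :* (con 1ℤ :+ x :* e) := x :- con 1ℤ :+ x :* ((x :- con 1ℤ) :* e)) refl x (eval (replicate n 1#) x) ⟩
    x - 1# + x * ((x - 1#) * eval (replicate n 1#) x)
      ≈⟨ +-congˡ (*-congˡ (eval-ones n x)) ⟩
    x - 1# + x * (x ^ n - 1#)
      ≈⟨ solve 2 (λ x e → x :- con 1ℤ :+ x :* (e :- con 1ℤ) := x :* e :- con 1ℤ) refl x (x ^ n) ⟩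
    x * x ^ n - 1# ∎

  eval-ones-1 : ∀ n → eval (replicate n 1#) 1# ≈ fromℤ (+ n)
  eval-ones-1 n = trans (go n) (×ᵤ≈× n 1#)
    where
    go : ∀ n → eval (replicate n 1#) 1# ≈ n Mult.× 1#
    go zero    = refl
    go (suc n) = +-congˡ (trans (*-identityˡ _) (go n))

  leading-ones : ∀ n → leading (replicate (suc n) 1#) ≡ 1#
  leading-ones zero    = ≡.refl
  leading-ones (suc n) = leading-ones n

  -- Needed for two constants: a = y^p, with roots yω^i, in the study of ζ - 1, and a = 1 to see
  -- that a list of roots of unity is complete.
  xⁿ-a-factorization : ∀ n (r : Fin (suc n) → Carrier) a →
    (∀ {i j} → r i ≈ r j → i ≡ j) → (∀ i → r i ^ suc n ≈ a) →
    ∀ x → x ^ suc n - a ≈ product (λ i → x - r i)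
  xⁿ-a-factorization n r a inj root x = begin
    x ^ suc n - a
      ≈⟨ evaluate x ⟨
    eval (- a ∷ monomial n) x
      ≈⟨ factorization (- a ∷ monomial n) r inj (λ i → trans (evaluate (r i)) (x≈y⇒x∙y⁻¹≈ε (root i))) x ⟩
    leading (- a ∷ monomial n) * product (λ i → x - r i)
      ≡⟨ ≡.cong (_* product (λ i → x - r i)) (leading-monomial (- a) n) ⟩
    1# * product (λ i → x - r i)
      ≈⟨ *-identityˡ _ ⟩
    product (λ i → x - r i) ∎
    where
    evaluate : ∀ x → eval (- a ∷ monomial n) x ≈ x ^ suc n - a
    evaluate x = trans (+-comm _ _) (+-congʳ (*-congˡ (eval-monomial n x)))

  module _ {G : Carrier → Set} where

    Multiple-refl : ∀ {a} → Multiple a ⟨ G ⟩ a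
    Multiple-refl = 1# , one , sym (*-identityʳ _)

    Multiple-resp : ∀ {a x y} → x ≈ y → Multiple a ⟨ G ⟩ x → Multiple a ⟨ G ⟩ y
    Multiple-resp eq (c , s , eq′) = c , s , trans (sym eq) eq′

    Multiple-trans : ∀ {a b x} → Multiple a ⟨ G ⟩ b → Multiple b ⟨ G ⟩ x → Multiple a ⟨ G ⟩ x
    Multiple-trans (c , s , eq) (d , t , eq′) = c * d , mul s t ,
      trans eq′ (trans (*-congʳ eq) (*-assoc _ c d))

    Multiple-* : ∀ {a b x y} → Multiple a ⟨ G ⟩ x → Multiple b ⟨ G ⟩ y → Multiple (a * b) ⟨ G ⟩ (x * y)
    Multiple-* {a} {b} (c , s , eq) (d , t , eq′) = c * d , mul s t ,
      trans (*-cong eq eq′) (solve 4 (λ a b c d → (a :* c) :* (b :* d) := (a :* b) :* (c :* d)) refl a b c d)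

    Multiple-^ : ∀ {a x} n → Multiple a ⟨ G ⟩ x → Multiple (a ^ n) ⟨ G ⟩ (x ^ n)
    Multiple-^ zero    m = Multiple-refl
    Multiple-^ (suc n) m = Multiple-* m (Multiple-^ n m)

    Multiple-product : ∀ {a} {f : Fin n → Carrier} → (∀ i → Multiple a ⟨ G ⟩ (f i)) →
                       Multiple (a ^ n) ⟨ G ⟩ (product f)
    Multiple-product {zero}  m = Multiple-refl
    Multiple-product {suc n} m = Multiple-* (m zero) (Multiple-product (m ∘ suc))

    eval-closed : ∀ {f : Vec Carrier n} {x} → All ⟨ G ⟩ f → ⟨ G ⟩ x → ⟨ G ⟩ (eval f x)
    eval-closed []       t = nil
    eval-closed (s ∷ ss) t = add s (mul t (eval-closed ss t))

    remainder-closed : ∀ {r} {f : Vec Carrier (suc n)} → ⟨ G ⟩ r → All ⟨ G ⟩ f → ⟨ G ⟩ (remainder r f)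
    remainder-closed r∈ (s ∷ [])     = s
    remainder-closed r∈ (s ∷ t ∷ ss) = add s (mul r∈ (remainder-closed r∈ (t ∷ ss)))

    quotient-closed : ∀ {r} {f : Vec Carrier (suc n)} → ⟨ G ⟩ r → All ⟨ G ⟩ f → All ⟨ G ⟩ (quotient r f)
    quotient-closed r∈ (s ∷ [])     = []
    quotient-closed r∈ (s ∷ t ∷ ss) = remainder-closed r∈ (t ∷ ss) ∷ quotient-closed r∈ (t ∷ ss)

    ones-closed : ∀ n → All ⟨ G ⟩ (replicate n 1#)
    ones-closed zero    = []
    ones-closed (suc n) = one ∷ ones-closed n

    Multiple-1-xⁿ : ∀ {x} n → ⟨ G ⟩ x → Multiple (x - 1#) ⟨ G ⟩ (1# - x ^ n)
    Multiple-1-xⁿ {x} n s = - eval (replicate n 1#) x , neg (eval-closed (ones-closed n) s) , (begin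
      1# - x ^ n  ≈⟨ solve 1 (λ a → con 1ℤ :- a := :- (a :- con 1ℤ)) refl (x ^ n) ⟩
      - (x ^ n - 1#)  ≈⟨ -‿cong (eval-ones n x) ⟨
      - ((x - 1#) * eval (replicate n 1#) x)  ≈⟨ -‿distribʳ-* _ _ ⟩
      (x - 1#) * - eval (replicate n 1#) x  ∎)

  IsPrimitive : ℕ → Carrier → Set
  IsPrimitive n ζ = ζ ^ n ≈ 1# × (∀ d → 0 ℕ.< d → d ℕ.< n → ¬ ζ ^ d ≈ 1#)

  1≉0 : ¬ 1# ≈ 0#
  1≉0 eq with charZero 1 eq
  ... | ()

  product-≉0 : ∀ {n} (f : Fin n → Carrier) → (∀ i → ¬ f i ≈ 0#) → ¬ product f ≈ 0#
  product-≉0 {zero}  f nz eq = 1≉0 eq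
  product-≉0 {suc n} f nz eq = product-≉0 (f ∘ suc) (nz ∘ suc) (zeroˡ-cancel eq (nz zero))

  unit≉0 : ∀ {x} n → 0 ℕ.< n → x ^ n ≈ 1# → ¬ x ≈ 0#
  unit≉0 (suc n) _ xⁿ≈1 x≈0 = 1≉0 (trans (sym xⁿ≈1) (trans (*-congʳ x≈0) (zeroˡ _)))

  ^-≉0 : ∀ {x} n → ¬ x ≈ 0# → ¬ x ^ n ≈ 0#
  ^-≉0 zero    x≉0 = 1≉0
  ^-≉0 (suc n) x≉0 eq = ^-≉0 n x≉0 (zeroˡ-cancel eq x≉0)

  primitive-≉0 : ∀ {n ζ} → 0 ℕ.< n → IsPrimitive n ζ → ¬ ζ ≈ 0#
  primitive-≉0 {n} 0<n (ζⁿ≈1 , _) = unit≉0 n 0<n ζⁿ≈1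

  primitive-^ : ∀ m n {ζ} → 0 ℕ.< m → IsPrimitive (m ℕ.* n) ζ → IsPrimitive n (ζ ^ m)
  primitive-^ m n {ζ} 0<m (ζᵐⁿ≈1 , least) = trans (^-assocʳ ζ m n) ζᵐⁿ≈1 ,
    λ d 0<d d<n eq → least (m ℕ.* d) (ℕ.*-mono-< 0<m 0<d)
      (ℕ.*-monoʳ-< m {{ℕ.>-nonZero 0<m}} d<n) (trans (sym (^-assocʳ ζ m d)) eq)

  primitive-distinct : ∀ {n ζ} → IsPrimitive n ζ → ∀ {a b} → a ℕ.< b → b ℕ.< n → ¬ ζ ^ a ≈ ζ ^ b
  primitive-distinct {n} {ζ} prim {a} {b} a<b b<n eq =
    proj₂ prim (b ∸ a) (ℕ.m<n⇒0<n∸m a<b) (ℕ.≤-<-trans (ℕ.m∸n≤m b a) b<n)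
      (*-cancelˡ-nonZero (^-≉0 a (primitive-≉0 (ℕ.≤-<-trans z≤n b<n) prim))
        (begin
          ζ ^ a * ζ ^ (b ∸ a)  ≈⟨ ^-homo-* ζ a (b ∸ a) ⟨
          ζ ^ (a ℕ.+ (b ∸ a))  ≡⟨ ≡.cong (ζ ^_) (ℕ.m+[n∸m]≡n (ℕ.<⇒≤ a<b)) ⟩
          ζ ^ b  ≈⟨ eq ⟨
          ζ ^ a  ≈⟨ *-identityʳ _ ⟨
          ζ ^ a * 1#  ∎))

  primitive-injective : ∀ {n ζ} → IsPrimitive n ζ → ∀ {a b} → a ℕ.< n → b ℕ.< n → ζ ^ a ≈ ζ ^ b → a ≡ b
  primitive-injective prim {a} {b} a<n b<n eq with ℕ.<-cmp a b
  ... | tri≈ _ a≡b _ = a≡b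
  ... | tri< a<b _ _ = ⊥-elim (primitive-distinct prim a<b b<n eq)
  ... | tri> _ _ b<a = ⊥-elim (primitive-distinct prim b<a a<n (sym eq))

  geometric-sum : ∀ {n ζ} → 1 ℕ.< n → IsPrimitive n ζ → ∀ {k} → 0 ℕ.< k → k ℕ.< n →
                  eval (replicate n 1#) (ζ ^ k) ≈ 0#
  geometric-sum {n} {ζ} 1<n (ζⁿ≈1 , least) {k} 0<k k<n = zeroˡ-cancel
    (trans (eval-ones n (ζ ^ k)) (trans (+-congʳ ζᵏⁿ≈1) (-‿inverseʳ 1#)))
    (λ eq → least k 0<k k<n (x∙y⁻¹≈ε⇒x≈y _ _ eq))
    where
    ζᵏⁿ≈1 : (ζ ^ k) ^ n ≈ 1#
    ζᵏⁿ≈1 = begin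
      (ζ ^ k) ^ n  ≈⟨ ^-assocʳ ζ k n ⟩
      ζ ^ (k ℕ.* n)  ≡⟨ ≡.cong (ζ ^_) (ℕ.*-comm k n) ⟩
      ζ ^ (n ℕ.* k)  ≈⟨ ^-assocʳ ζ n k ⟨
      (ζ ^ n) ^ k  ≈⟨ ^-congˡ k ζⁿ≈1 ⟩
      1# ^ k  ≈⟨ 1^ k ⟩
      1#  ∎

  -- p = ∏ (1 - ωⁱ) and 1 - yᵖ = ∏ (1 - y ωⁱ) show that p is divisible by
  -- the power φ(p^(k+1)) of π = ζ - 1.
  module _ {p′ k : ℕ} (1<p : 1 ℕ.< suc p′) {ζ : Carrier}
           (prim : IsPrimitive (suc p′ ℕ.^ suc k) ζ) {G : Carrier → Set} (ζ∈ : ⟨ G ⟩ ζ) where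

    private
      p = suc p′
      π = ζ - 1#
      ω = ζ ^ (p ℕ.^ k)

      0<p^ : ∀ l → 0 ℕ.< p ℕ.^ l
      0<p^ l = ℕ.m^n>0 p l

      ω-primitive : IsPrimitive p ω
      ω-primitive = primitive-^ (p ℕ.^ k) p (0<p^ k)
        (≡.subst (λ n → IsPrimitive n ζ) (ℕ.*-comm p (p ℕ.^ k)) prim)

    π-divides-ζ^-1 : ∀ l → l ℕ.≤ k → Multiple (π ^ (p ℕ.^ l)) ⟨ G ⟩ (ζ ^ (p ℕ.^ l) - 1#)
    π-divides-ζ^-1 zero    _   = 1# , one ,
      solve 1 (λ z → z :* con 1ℤ :- con 1ℤ := ((z :- con 1ℤ) :* con 1ℤ) :* con 1ℤ) refl ζ
    π-divides-ζ^-1 (suc l) l<k =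
      Multiple-resp
        (begin
          - product (λ i → 1# - r i)  ≈⟨ -‿cong (xⁿ-a-factorization p′ r (y ^ p) r-injective r-root 1#) ⟨
          - (1# ^ p - y ^ p)  ≈⟨ -‿cong (+-congʳ (1^ p)) ⟩
          - (1# - y ^ p)  ≈⟨ solve 1 (λ a → :- (con 1ℤ :- a) := a :- con 1ℤ) refl (y ^ p) ⟩
          y ^ p - 1#  ≈⟨ +-congʳ (^-assocʳ ζ (p ℕ.^ l) p) ⟩
          ζ ^ (p ℕ.^ l ℕ.* p) - 1#  ≡⟨ ≡.cong (λ n → ζ ^ n - 1#) (ℕ.*-comm (p ℕ.^ l) p) ⟩
          ζ ^ (p ℕ.^ suc l) - 1#  ∎)
        (let c , s , eq = Multiple-product (λ i → Multiple-trans (π-divides-ζ^-1 l (ℕ.<⇒≤ l<k)) (step i))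
         in - c , neg s , (begin
              - product (λ i → 1# - r i)  ≈⟨ -‿cong eq ⟩
              - ((π ^ (p ℕ.^ l)) ^ p * c)  ≈⟨ -‿distribʳ-* _ c ⟩
              (π ^ (p ℕ.^ l)) ^ p * - c  ≈⟨ *-congʳ (trans (^-assocʳ π (p ℕ.^ l) p) (^-congʳ π (ℕ.*-comm (p ℕ.^ l) p))) ⟩
              π ^ (p ℕ.^ suc l) * - c  ∎))
      where
      y = ζ ^ (p ℕ.^ l)
      r : Fin p → Carrier
      r i = y * ω ^ toℕ i
      y≉0 : ¬ y ≈ 0#
      y≉0 = ^-≉0 (p ℕ.^ l) (primitive-≉0 (0<p^ (suc k)) prim)
      r-injective : ∀ {i j} → r i ≈ r j → i ≡ j
      r-injective {i} {j} eq = Fin.toℕ-injective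
        (primitive-injective ω-primitive (Fin.toℕ<n i) (Fin.toℕ<n j) (*-cancelˡ-nonZero y≉0 eq))
      r-root : ∀ i → r i ^ p ≈ y ^ p
      r-root i = begin
        (y * ω ^ toℕ i) ^ p  ≈⟨ ^-distrib-* y (ω ^ toℕ i) p ⟩
        y ^ p * (ω ^ toℕ i) ^ p  ≈⟨ *-congˡ (^-assocʳ ω (toℕ i) p) ⟩
        y ^ p * ω ^ (toℕ i ℕ.* p)  ≡⟨ ≡.cong (λ n → y ^ p * ω ^ n) (ℕ.*-comm (toℕ i) p) ⟩
        y ^ p * ω ^ (p ℕ.* toℕ i)  ≈⟨ *-congˡ (^-assocʳ ω p (toℕ i)) ⟨
        y ^ p * (ω ^ p) ^ toℕ i  ≈⟨ *-congˡ (trans (^-congˡ (toℕ i) (proj₁ ω-primitive)) (1^ (toℕ i))) ⟩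
        y ^ p * 1#  ≈⟨ *-identityʳ _ ⟩
        y ^ p  ∎
      -- Since l < k, ω is itself a power of y, namely y^(p^(k-l)). So `r i` is a power of y, and 1
      -- minus it is divisible by y - 1.
      step : ∀ i → Multiple (y - 1#) ⟨ G ⟩ (1# - r i)
      step i = Multiple-resp (+-congˡ (-‿cong (*-congˡ (begin
          y ^ (p ℕ.^ (k ∸ l) ℕ.* toℕ i)  ≈⟨ ^-assocʳ y (p ℕ.^ (k ∸ l)) (toℕ i) ⟨
          (y ^ (p ℕ.^ (k ∸ l))) ^ toℕ i  ≈⟨ ^-congˡ (toℕ i) (^-assocʳ ζ (p ℕ.^ l) (p ℕ.^ (k ∸ l))) ⟩
          (ζ ^ (p ℕ.^ l ℕ.* p ℕ.^ (k ∸ l))) ^ toℕ i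
            ≡⟨ ≡.cong (λ n → (ζ ^ n) ^ toℕ i) (≡.trans (≡.sym (ℕ.^-distribˡ-+-* p l (k ∸ l)))
                 (≡.cong (p ℕ.^_) (ℕ.m+[n∸m]≡n (ℕ.<⇒≤ l<k)))) ⟩
          ω ^ toℕ i  ∎))))
        (Multiple-1-xⁿ (suc (p ℕ.^ (k ∸ l) ℕ.* toℕ i)) (pow (p ℕ.^ l) ζ∈))

    π^φ-divides-p : Multiple (π ^ (p′ ℕ.* p ℕ.^ k)) ⟨ G ⟩ (fromℤ (+ p))
    π^φ-divides-p = Multiple-resp
      (begin
        product (λ i → 1# - r i)  ≈⟨ *-identityˡ _ ⟨
        1# * product (λ i → 1# - r i)  ≡⟨ ≡.cong (_* product (λ i → 1# - r i)) (leading-ones p′) ⟨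
        leading (replicate p 1#) * product (λ i → 1# - r i)
          ≈⟨ factorization (replicate p 1#) r r-injective (λ i → geometric-sum 1<p ω-primitive (s≤s z≤n) (s≤s (Fin.toℕ<n i))) 1# ⟨
        eval (replicate p 1#) 1#  ≈⟨ eval-ones-1 p ⟩
        fromℤ (+ p)  ∎)
      (let c , s , eq = Multiple-product {n = p′} (λ i → Multiple-trans (π-divides-ζ^-1 k ℕ.≤-refl)
                          (Multiple-1-xⁿ (suc (toℕ i)) (pow (p ℕ.^ k) ζ∈)))
       in c , s , trans eq (*-congʳ (trans (^-assocʳ π (p ℕ.^ k) p′) (^-congʳ π (ℕ.*-comm (p ℕ.^ k) p′)))))
      where
      -- The exponents start at 1: these are the roots of 1 + x + ... + x^(p-1), whose value at 1 is
      -- p.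
      r : Fin p′ → Carrier
      r i = ω ^ suc (toℕ i)
      r-injective : ∀ {i j} → r i ≈ r j → i ≡ j
      r-injective {i} {j} eq = Fin.toℕ-injective (ℕ.suc-injective
        (primitive-injective ω-primitive (s≤s (Fin.toℕ<n i)) (s≤s (Fin.toℕ<n j)) eq))

  -- The polynomial ((1 + h)^n - 1 - nh) / h² in h, given by recursion on n so that no division
  -- occurs.
  secondOrder : ℕ → Carrier → Carrier
  secondOrder zero    h = 0#
  secondOrder (suc n) h = (1# + h) * secondOrder n h + n Mult.× 1#

  1+h-expansion : ∀ n h → (1# + h) ^ n ≈ 1# + h * (n Mult.× 1# + h * secondOrder n h)
  1+h-expansion zero    h = solve 1 (λ h → con 1ℤ := con 1ℤ :+ h :* (con 0ℤ :+ h :* con 0ℤ)) refl h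
  1+h-expansion (suc n) h = trans (*-congˡ (1+h-expansion n h))
    (solve 3 (λ h n q → (con 1ℤ :+ h) :* (con 1ℤ :+ h :* (n :+ h :* q)) :=
                        con 1ℤ :+ h :* (con 1ℤ :+ n :+ h :* ((con 1ℤ :+ h) :* q :+ n)))
      refl h (n Mult.× 1#) (secondOrder n h))

  -- The hypothesis concerns the cofactor of w - 1 in w^n - 1. It is close to n when w is close to
  -- 1, which is how the hypothesis is met over ℂ.
  isolated-root : ∀ n {w} → w ^ n ≈ 1# → (let h = w - 1#) →
                  ¬ n Mult.× 1# + h * secondOrder n h ≈ 0# → w ≈ 1#
  isolated-root n {w} wⁿ≈1 factor≉0 = x∙y⁻¹≈ε⇒x≈y w 1# (zeroˡ-cancel factor*h≈0 factor≉0)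
    where
    h = w - 1#
    factor = n Mult.× 1# + h * secondOrder n h
    factor*h≈0 : factor * h ≈ 0#
    factor*h≈0 = begin
      factor * h  ≈⟨ solve 2 (λ f h → f :* h := con 1ℤ :+ h :* f :- con 1ℤ) refl factor h ⟩
      1# + h * factor - 1#  ≈⟨ +-congʳ (1+h-expansion n h) ⟨
      (1# + h) ^ n - 1#  ≈⟨ +-congʳ (^-congˡ n (solve 1 (λ w → con 1ℤ :+ (w :- con 1ℤ) := w) refl w)) ⟩
      w ^ n - 1#  ≈⟨ x≈y⇒x∙y⁻¹≈ε wⁿ≈1 ⟩
      0#  ∎

-- Linear relations between the powers of a root of unity of prime power order.

module Independence (D : CharZeroDomain) where

  open CharZeroDomain D
  open Subrings D
  open Integrality D
  open Polynomials D
  open Solver using (solve; _:=_; _:+_; _:*_; _:-_; :-_; con)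
  open Algebra.Properties.Ring ring
  open Relation.Binary.Reasoning.Setoid setoid

  eval-++ : ∀ {m n} (f : Vec Carrier m) (g : Vec Carrier n) x →
            eval (f ++ g) x ≈ eval f x + x ^ m * eval g x
  eval-++ []      g x = trans (sym (*-identityˡ _)) (sym (+-identityˡ _))
  eval-++ {suc m} (c ∷ f) g x = begin
    c + x * eval (f ++ g) x  ≈⟨ +-congˡ (*-congˡ (eval-++ f g x)) ⟩
    c + x * (eval f x + x ^ m * eval g x)  ≈⟨ solve 5 (λ c x f y g → c :+ x :* (f :+ y :* g) := c :+ x :* f :+ (x :* y) :* g) refl c x (eval f x) (x ^ m) (eval g x) ⟩
    c + x * eval f x + (x * x ^ m) * eval g x  ∎

  eval-tabulate : ∀ {n} (f : Fin n → Carrier) x → eval (tabulate f) x ≈ sum (λ j → f j * x ^ toℕ j)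
  eval-tabulate {zero}  f x = refl
  eval-tabulate {suc n} f x = begin
    f zero + x * eval (tabulate (f ∘ suc)) x
      ≈⟨ +-cong (sym (*-identityʳ _)) (*-congˡ (eval-tabulate (f ∘ suc) x)) ⟩
    f zero * 1# + x * sum (λ j → f (suc j) * x ^ toℕ j)
      ≈⟨ +-congˡ (*-distribˡ-sum x (λ j → f (suc j) * x ^ toℕ j)) ⟩
    f zero * 1# + sum (λ j → x * (f (suc j) * x ^ toℕ j))
      ≈⟨ +-congˡ (sum-cong-≋ (λ j → solve 3 (λ x a b → x :* (a :* b) := a :* (x :* b)) refl x (f (suc j)) (x ^ toℕ j))) ⟩
    sum (λ j → f j * x ^ toℕ j) ∎

  eval-concat : ∀ {m n} (f : Fin n → Vec Carrier m) x →
                eval (concat (tabulate f)) x ≈ sum (λ i → eval (f i) x * (x ^ m) ^ toℕ i)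
  eval-concat {m} {zero}  f x = refl
  eval-concat {m} {suc n} f x = begin
    eval (f zero ++ concat (tabulate (f ∘ suc))) x
      ≈⟨ eval-++ (f zero) _ x ⟩
    eval (f zero) x + x ^ m * eval (concat (tabulate (f ∘ suc))) x
      ≈⟨ +-cong (sym (*-identityʳ _)) (*-congˡ (eval-concat (f ∘ suc) x)) ⟩
    eval (f zero) x * 1# + x ^ m * sum (λ i → eval (f (suc i)) x * (x ^ m) ^ toℕ i)
      ≈⟨ +-congˡ (*-distribˡ-sum (x ^ m) (λ i → eval (f (suc i)) x * (x ^ m) ^ toℕ i)) ⟩
    eval (f zero) x * 1# + sum (λ i → x ^ m * (eval (f (suc i)) x * (x ^ m) ^ toℕ i))
      ≈⟨ +-congˡ (sum-cong-≋ (λ i → solve 3 (λ x a b → x :* (a :* b) := a :* (x :* b)) refl (x ^ m) (eval (f (suc i)) x) ((x ^ m) ^ toℕ i))) ⟩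
    sum (λ i → eval (f i) x * (x ^ m) ^ toℕ i) ∎

  -- The ideals generated by the powers of ϖ intersect in zero. Instead of a general intersection
  -- theorem, this is shown separately for ℤ and for ℤ[ζ₂].
  Separated : Carrier → (Carrier → Set) → Set
  Separated ϖ G = ∀ {x} → ⟨ G ⟩ x → (∀ m → Multiple (ϖ ^ m) ⟨ G ⟩ x) → x ≈ 0#

  module _ {p : ℕ} (p-prime : Prime p) (k : ℕ) {ζ : Carrier} (prim : IsPrimitive (p ℕ.^ suc k) ζ)
           (G : Carrier → Set) (s : ℕ) (0<s : 0 ℕ.< s) (fix : ∀ {g} → G g → g ^ (p ℕ.^ s) ≈ g)
           (separated : Separated (fromℤ (+ p)) G) where

    private
      π = ζ - 1#
      φ = ℕ.pred p ℕ.* p ℕ.^ k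
      T = ⟨ Adjoin G ζ ⟩

      module S = Frobenius G p-prime
      module F = Frobenius (Adjoin G ζ) p-prime
      open S using (ϖ)

      instance
        p-nonTrivial : ℕ.NonTrivial p
        p-nonTrivial = prime⇒nonTrivial p-prime
        p-nonZero : ℕ.NonZero p
        p-nonZero = ℕ.nonTrivial⇒nonZero p

      1<p : 1 ℕ.< p
      1<p = ℕ.nonTrivial⇒n>1 p

      P : ℕ
      P = p ℕ.^ suc k

      0<P : 0 ℕ.< P
      0<P = ℕ.m^n>0 p (suc k)

      G⊆ : ∀ {x} → ⟨ G ⟩ x → T x
      G⊆ = ⟨⟩-map inj₁

      ζ∈T : T ζ
      ζ∈T = gen (inj₂ refl)

      π∈T : T π
      π∈T = sub ζ∈T one

      π≉0 : ¬ π ≈ 0#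
      π≉0 eq = proj₂ prim 1 (s≤s z≤n) (ℕ.<-≤-trans 1<p (ℕ.m≤m*n p (p ℕ.^ k) {{ℕ.m^n≢0 p k}}))
        (trans (*-identityʳ ζ) (x∙y⁻¹≈ε⇒x≈y ζ 1# eq))

      ϖ≉0 : ¬ ϖ ≈ 0#
      ϖ≉0 eq = ℕ.<⇒≢ (ℕ.<-trans (s≤s z≤n) 1<p) (≡.sym (charZero p eq))

      -- Here s > 0 is essential: x^q ≋ x says something about nilpotents modulo p only for q ≥ 2.
      2≤pˢ : 2 ℕ.≤ p ℕ.^ s
      2≤pˢ = ℕ.≤-trans 1<p (≡.subst (ℕ._≤ p ℕ.^ s) (ℕ.*-identityʳ p) (ℕ.^-monoʳ-≤ p 0<s))

      opaque
        -- Modulo p, (ζ - 1)^P ≋ ζ^P + (-1)^P = 1^P + (-1)^P ≋ (1 - 1)^P = 0. Reading the additivity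
        -- backwards at the end makes the sign of (-1)^P irrelevant.
        p∣πᴾ : Multiple ϖ T (π ^ P)
        p∣πᴾ = F.≋0⇒Multiple
          (F.≋-trans (F.freshman^ (suc k) ζ∈T (neg one))
          (F.≋-trans (F.≈⇒≋ (+-congʳ (trans (proj₁ prim) (sym (1^ P)))))
          (F.≋-trans (F.≋-sym (F.freshman^ (suc k) one (neg one)))
          (F.≈⇒≋ 0ᴾ))))
          where
          0ᴾ : (1# + - 1#) ^ P ≈ 0#
          0ᴾ with P | 0<P
          ... | suc n | _ = trans (*-congʳ (-‿inverseʳ 1#)) (zeroˡ _)

      opaque
        πᵠ∣p : Multiple (π ^ φ) T ϖ
        πᵠ∣p = go p ≡.refl
          where
          go : ∀ q → q ≡ p → Multiple (π ^ φ) T ϖ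
          go (suc p′) ≡.refl = π^φ-divides-p {p′} {k} 1<p prim ζ∈T
          go zero     ≡.refl = ⊥-elim (ℕ.<⇒≢ (ℕ.<-trans (s≤s z≤n) 1<p) ≡.refl)

      opaque
        -- The P-th power of x = πc is divisible by p in T, because π^P is; `integrality` brings
        -- this back to x in the smaller ring.
        π∣⇒p∣ : ∀ {x} → ⟨ G ⟩ x → Multiple π T x → Multiple ϖ ⟨ G ⟩ x
        π∣⇒p∣ {x} x∈ (c , c∈ , x≈πc) =
          PowerBasis.integrality G ζ (ℕ.pred P) (≡.subst (λ n → ζ ^ n ≈ 1#) (≡.sym P≡) (proj₁ prim))
            p-prime 2≤pˢ x∈ (S.frobenius-fixes s fix x∈) P
            (Multiple-resp (sym (trans (^-congˡ P x≈πc) (^-distrib-* π c P)))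
              (F.Multiple-*ʳ p∣πᴾ (pow P c∈)))
          where
          P≡ : suc (ℕ.pred P) ≡ P
          P≡ = ℕ.suc-pred P {{ℕ.>-nonZero 0<P}}

      -- Each coefficient of f is the difference of two successive Horner values at 1, so
      -- divisibility of these values gives that of the coefficients.
      recombine : ∀ {n} {f : Vec Carrier (suc n)} → Multiple ϖ ⟨ G ⟩ (remainder 1# f) →
                  All (Multiple ϖ ⟨ G ⟩) (quotient 1# f) → All (Multiple ϖ ⟨ G ⟩) f
      recombine {f = c ∷ []}     e []       = e ∷ []
      recombine {f = c ∷ d ∷ cs} e (e′ ∷ g) =
        Multiple-resp (solve 2 (λ c e → c :+ con 1ℤ :* e :+ e :* (:- con 1ℤ) := c) refl c (remainder 1# (d ∷ cs)))
          (S.Multiple-+ e (S.Multiple-*ʳ e′ (neg one))) ∷ recombine e′ g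

      -- In the expansion of f in powers of π the constant term lies in πT ∩ ⟨ G ⟩,
      -- hence is divisible by p and so by π ^ φ; it can be removed.
      divisible : ∀ n → n ℕ.≤ φ → (f : Vec Carrier n) → All ⟨ G ⟩ f →
                  Multiple (π ^ n) T (eval f ζ) → All (Multiple ϖ ⟨ G ⟩) f
      divisible zero    _   []       _  _ = []
      divisible (suc n) n<φ f f∈ (β , β∈ , eq) =
        recombine p∣e (divisible n (ℕ.<⇒≤ n<φ) g (quotient-closed one f∈) (δ , δ∈ , *-cancelˡ-nonZero π≉0 πg≈))
        where
        e = remainder 1# f
        g = quotient 1# f
        y = π * eval g ζ
        e+y≈ : e + y ≈ (π * π ^ n) * β
        e+y≈ = trans (sym (division 1# f ζ)) eq
        e∈ : ⟨ G ⟩ e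
        e∈ = remainder-closed one f∈
        e≈π : e ≈ π * (π ^ n * β - eval g ζ)
        e≈π = begin
          e  ≈⟨ solve 2 (λ e y → e := e :+ y :- y) refl e y ⟩
          e + y - y  ≈⟨ +-congʳ e+y≈ ⟩
          (π * π ^ n) * β - π * eval g ζ  ≈⟨ solve 4 (λ q r b x → (q :* r) :* b :- q :* x := q :* (r :* b :- x)) refl π (π ^ n) β (eval g ζ) ⟩
          π * (π ^ n * β - eval g ζ)  ∎
        p∣e : Multiple ϖ ⟨ G ⟩ e
        p∣e = π∣⇒p∣ e∈ (π ^ n * β - eval g ζ ,
          sub (mul (pow n π∈T) β∈) (eval-closed (All.map G⊆ (quotient-closed one f∈)) ζ∈T) , e≈π)
        c γ δ : Carrier
        c = proj₁ p∣e
        γ = proj₁ πᵠ∣p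
        l : ℕ
        l = φ ∸ suc n
        ϖ≈ : ϖ ≈ π ^ suc n * (π ^ l * γ)
        ϖ≈ = begin
          ϖ  ≈⟨ proj₂ (proj₂ πᵠ∣p) ⟩
          π ^ φ * γ  ≡⟨ ≡.cong (λ m → π ^ m * γ) (ℕ.m+[n∸m]≡n n<φ) ⟨
          π ^ (suc n ℕ.+ l) * γ  ≈⟨ *-congʳ (^-homo-* π (suc n) l) ⟩
          (π ^ suc n * π ^ l) * γ  ≈⟨ *-assoc _ _ _ ⟩
          π ^ suc n * (π ^ l * γ)  ∎
        -- The constant term equals π^(n+1) (π^l γ) c. Moving it to the other side changes the
        -- cofactor β of π^(n+1) into δ, and one factor π can then be cancelled.
        δ = β - π ^ l * γ * c
        δ∈ : T δ
        δ∈ = sub β∈ (mul (mul (pow l π∈T) (proj₁ (proj₂ πᵠ∣p))) (G⊆ (proj₁ (proj₂ p∣e))))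
        e≈ : e ≈ (π * π ^ n) * (π ^ l * γ) * c
        e≈ = trans (proj₂ (proj₂ p∣e)) (*-congʳ ϖ≈)
        πg≈ : π * eval g ζ ≈ π * (π ^ n * δ)
        πg≈ = begin
          y
            ≈⟨ solve 2 (λ e y → y := e :+ y :- e) refl e y ⟩
          e + y - e
            ≈⟨ +-cong e+y≈ (-‿cong e≈) ⟩
          (π * π ^ n) * β - (π * π ^ n) * (π ^ l * γ) * c
            ≈⟨ solve 5 (λ q r b d c → (q :* r) :* b :- (q :* r) :* d :* c := q :* (r :* (b :- d :* c))) refl π (π ^ n) β (π ^ l * γ) c ⟩
          π * (π ^ n * δ) ∎

      -- The last component raises any divisibility later found for the quotient g by one power of ϖ
      -- for f, which is what the iteration below uses.
      divided : ∀ {n} (f : Vec Carrier n) → All (Multiple ϖ ⟨ G ⟩) f →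
                ∃ λ (g : Vec Carrier n) → All ⟨ G ⟩ g × eval f ζ ≈ ϖ * eval g ζ ×
                  (∀ m → All (Multiple (ϖ ^ m) ⟨ G ⟩) g → All (Multiple (ϖ ^ suc m) ⟨ G ⟩) f)
      divided [] [] = [] , [] , sym (zeroʳ ϖ) , λ m → λ { [] → [] }
      divided (x ∷ f) ((c , c∈ , x≈ϖc) ∷ ms) =
        let g , g∈ , eq , back = divided f ms in
        c ∷ g , c∈ ∷ g∈ ,
        trans (+-cong x≈ϖc (*-congˡ eq))
          (solve 4 (λ p c z g → p :* c :+ z :* (p :* g) := p :* (c :+ z :* g)) refl ϖ c ζ (eval g ζ)) ,
        λ { m ((d , d∈ , c≈) ∷ ds) → (d , d∈ , trans x≈ϖc (trans (*-congˡ c≈) (sym (*-assoc ϖ (ϖ ^ m) d)))) ∷ back m ds }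

      -- The value 0 is divisible by π^φ, so f = ϖg coefficientwise. As ϖ ≠ 0, ζ is a root of g too,
      -- and the division can be repeated.
      root⇒divisible : ∀ m (f : Vec Carrier φ) → All ⟨ G ⟩ f → eval f ζ ≈ 0# → All (Multiple (ϖ ^ m) ⟨ G ⟩) f
      root⇒divisible zero    f f∈ _ = All.map (λ s → _ , s , sym (*-identityˡ _)) f∈
      root⇒divisible (suc m) f f∈ root =
        let g , g∈ , eq , back = divided f (divisible φ ℕ.≤-refl f f∈ (0# , nil , trans root (sym (zeroʳ (π ^ φ)))))
        in back m (root⇒divisible m g g∈ (zeroˡ-cancel (trans (sym eq) root) ϖ≉0))

      all-m : ∀ {n} {f : Vec Carrier n} → All ⟨ G ⟩ f → (∀ m → All (Multiple (ϖ ^ m) ⟨ G ⟩) f) → All (_≈ 0#) f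
      all-m []       h = []
      all-m (s ∷ ss) h = separated s (All.head ∘ h) ∷ all-m ss (All.tail ∘ h)

    opaque
      root⇒zero : (f : Vec Carrier φ) → All ⟨ G ⟩ f → eval f ζ ≈ 0# → All (_≈ 0#) f
      root⇒zero f f∈ root = all-m f∈ (λ m → root⇒divisible m f f∈ root)

  ∑-powers≈0 : ∀ {n ω} → 1 ℕ.< n → IsPrimitive n ω → sum {n} (λ i → ω ^ toℕ i) ≈ 0#
  ∑-powers≈0 {n} {ω} 1<n prim = begin
    sum {n} (λ i → ω ^ toℕ i)  ≈⟨ sum-cong-≋ {n} (λ i → *-identityˡ (ω ^ toℕ i)) ⟨
    sum {n} (λ i → 1# * ω ^ toℕ i)  ≈⟨ eval-tabulate {n} (λ _ → 1#) ω ⟨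
    eval (tabulate {n = n} (λ _ → 1#)) ω ≡⟨ ≡.cong (λ v → eval v ω) (tabulate-ones n) ⟩
    eval (replicate n 1#) ω  ≈⟨ eval-cong (replicate n 1#) (*-identityʳ ω) ⟨
    eval (replicate n 1#) (ω ^ 1)  ≈⟨ geometric-sum 1<n prim {1} (s≤s z≤n) 1<n ⟩
    0#  ∎
    where
    tabulate-ones : ∀ n → tabulate {n = n} (λ _ → 1#) ≡ replicate n 1#
    tabulate-ones zero    = ≡.refl
    tabulate-ones (suc n) = ≡.cong (1# ∷_) (tabulate-ones n)
    eval-cong : ∀ {n} (h : Vec Carrier n) {x y} → x ≈ y → eval h x ≈ eval h y
    eval-cong []      _   = refl
    eval-cong (c ∷ h) x≈y = +-congˡ (*-cong x≈y (eval-cong h x≈y))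

  ∑∑-ω : ∀ {m n} ζ (c : Fin m → Fin n → Carrier) →
         sum (λ i → sum (λ j → c i j * ζ ^ (toℕ j ℕ.+ n ℕ.* toℕ i))) ≈
         sum (λ i → sum (λ j → c i j * ζ ^ toℕ j) * (ζ ^ n) ^ toℕ i)
  ∑∑-ω {m} {n} ζ c = sum-cong-≋ (λ i → sym (trans (*-distribʳ-sum ((ζ ^ n) ^ toℕ i) (λ j → c i j * ζ ^ toℕ j))
    (sum-cong-≋ {n} (λ j → trans (*-assoc (c i j) (ζ ^ toℕ j) ((ζ ^ n) ^ toℕ i)) (*-congˡ (begin
      ζ ^ toℕ j * (ζ ^ n) ^ toℕ i  ≈⟨ *-congˡ (^-assocʳ ζ n (toℕ i)) ⟩
      ζ ^ toℕ j * ζ ^ (n ℕ.* toℕ i)  ≈⟨ ^-homo-* ζ (toℕ j) (n ℕ.* toℕ i) ⟨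
      ζ ^ (toℕ j ℕ.+ n ℕ.* toℕ i)  ∎))))))

  ∑∑-linear : ∀ {m n} p (a b z : Fin m → Fin n → Carrier) →
    sum (λ i → sum (λ j → (a i j - p * b i j) * z i j)) ≈
    sum (λ i → sum (λ j → a i j * z i j)) - p * sum (λ i → sum (λ j → b i j * z i j))
  ∑∑-linear {m} {n} p a b z = begin
    sum (λ i → sum (λ j → (a i j - p * b i j) * z i j))
      ≈⟨ sum-cong-≋ {m} (λ i → trans
           (sum-cong-≋ {n} (λ j → solve 4 (λ a p b z → (a :- p :* b) :* z := a :* z :+ (:- p) :* (b :* z)) refl
             (a i j) p (b i j) (z i j)))
           (trans (∑-distrib-+ (λ j → a i j * z i j) (λ j → (- p) * (b i j * z i j)))
             (+-congˡ (sym (*-distribˡ-sum (- p) (λ j → b i j * z i j)))))) ⟩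
    sum (λ i → sum (λ j → a i j * z i j) + (- p) * sum (λ j → b i j * z i j))
      ≈⟨ trans (∑-distrib-+ (λ i → sum (λ j → a i j * z i j)) (λ i → (- p) * sum (λ j → b i j * z i j)))
           (+-congˡ (sym (*-distribˡ-sum (- p) (λ i → sum (λ j → b i j * z i j))))) ⟩
    sum (λ i → sum (λ j → a i j * z i j)) + (- p) * sum (λ i → sum (λ j → b i j * z i j))
      ≈⟨ +-congˡ (-‿distribˡ-* p _) ⟨
    sum (λ i → sum (λ j → a i j * z i j)) - p * sum (λ i → sum (λ j → b i j * z i j)) ∎

  -- Coefficients independent of i factor out the sum of all powers of ζ^n, which is zero.
  -- `relations-constant` is the converse for prime powers.
  constant-relation : ∀ {m n ζ} → 1 ℕ.< m → IsPrimitive m (ζ ^ n) → (c : Fin n → Carrier) →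
    sum {m} (λ i → sum (λ j → c j * ζ ^ (toℕ j ℕ.+ n ℕ.* toℕ i))) ≈ 0#
  constant-relation {m} {n} {ζ} 1<m prim c = begin
    sum {m} (λ i → sum (λ j → c j * ζ ^ (toℕ j ℕ.+ n ℕ.* toℕ i)))  ≈⟨ ∑∑-ω {m} ζ (λ _ → c) ⟩
    sum {m} (λ i → g * (ζ ^ n) ^ toℕ i)  ≈⟨ *-distribˡ-sum {m} g (λ i → (ζ ^ n) ^ toℕ i) ⟨
    g * sum {m} (λ i → (ζ ^ n) ^ toℕ i)  ≈⟨ *-congˡ (∑-powers≈0 1<m prim) ⟩
    g * 0#  ≈⟨ zeroʳ g ⟩
    0#  ∎
    where g = sum (λ j → c j * ζ ^ toℕ j)

  -- Subtracting row zero times 1 + ω + ... + ω^(p-1) = 0 leaves the differences `d` in rows 1 to p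
  -- - 1. Dividing by ω moves them to the exponents below φ = (p-1)p^k, where `root⇒zero` applies.
  relations-constant : ∀ {p′} (p-prime : Prime (suc p′)) k {ζ} → IsPrimitive (suc p′ ℕ.^ suc k) ζ →
    ∀ (G : Carrier → Set) s → 0 ℕ.< s → (∀ {g} → G g → g ^ (suc p′ ℕ.^ s) ≈ g) →
    Separated (fromℤ (+ suc p′)) G →
    (c : Fin (suc p′) → Fin (suc p′ ℕ.^ k) → Carrier) → (∀ i j → ⟨ G ⟩ (c i j)) →
    sum (λ i → sum (λ j → c i j * ζ ^ (toℕ j ℕ.+ suc p′ ℕ.^ k ℕ.* toℕ i))) ≈ 0# →
    ∀ i j → c i j ≈ c zero j
  relations-constant {p′} p-prime k {ζ} prim G s 0<s fix separated c c∈ eq = equal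
    where
    p = suc p′
    pᵏ = p ℕ.^ k
    ω = ζ ^ pᵏ
    1<p : 1 ℕ.< p
    1<p = ℕ.nonTrivial⇒n>1 p {{prime⇒nonTrivial p-prime}}
    ω-primitive : IsPrimitive p ω
    ω-primitive = primitive-^ pᵏ p (ℕ.m^n>0 p k) (≡.subst (λ n → IsPrimitive n ζ) (ℕ.*-comm p pᵏ) prim)
    d : Fin p′ → Fin pᵏ → Carrier
    d i j = c (suc i) j - c zero j
    g : Fin p → Carrier
    g i = sum (λ j → c i j * ζ ^ toℕ j)
    f : Vec Carrier (p′ ℕ.* pᵏ)
    f = concat (tabulate (λ i → tabulate (d i)))
    ∑ω : Carrier
    ∑ω = sum {p′} (λ i → ω ^ toℕ i)
    1+ω∑ω≈0 : 1# + ω * ∑ω ≈ 0#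
    1+ω∑ω≈0 = trans (+-congˡ (*-distribˡ-sum {p′} ω (λ i → ω ^ toℕ i))) (∑-powers≈0 1<p ω-primitive)
    d-sum : ∀ i → eval (tabulate (d i)) ζ ≈ g (suc i) - g zero
    d-sum i = begin
      eval (tabulate (d i)) ζ
        ≈⟨ eval-tabulate (d i) ζ ⟩
      sum (λ j → d i j * ζ ^ toℕ j)
        ≈⟨ sum-cong-≋ (λ j → solve 3 (λ a b z → (a :- b) :* z := a :* z :+ (:- con 1ℤ) :* (b :* z)) refl (c (suc i) j) (c zero j) (ζ ^ toℕ j)) ⟩
      sum (λ j → c (suc i) j * ζ ^ toℕ j + (- 1#) * (c zero j * ζ ^ toℕ j))
        ≈⟨ ∑-distrib-+ (λ j → c (suc i) j * ζ ^ toℕ j) (λ j → (- 1#) * (c zero j * ζ ^ toℕ j)) ⟩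
      g (suc i) + sum (λ j → (- 1#) * (c zero j * ζ ^ toℕ j))
        ≈⟨ +-congˡ (*-distribˡ-sum (- 1#) (λ j → c zero j * ζ ^ toℕ j)) ⟨
      g (suc i) + (- 1#) * g zero
        ≈⟨ +-congˡ (-1*x≈-x (g zero)) ⟩
      g (suc i) - g zero ∎
    total : sum (λ i → g i * ω ^ toℕ i) ≈ 0#
    total = trans (sym (∑∑-ω ζ c)) eq
    tail : Carrier
    tail = sum (λ i → g (suc i) * ω ^ toℕ i)
    root : eval f ζ ≈ 0#
    root = zeroˡ-cancel (begin
      ω * eval f ζ
        ≈⟨ *-congˡ (eval-concat (λ i → tabulate (d i)) ζ) ⟩
      ω * sum (λ i → eval (tabulate (d i)) ζ * ω ^ toℕ i)
        ≈⟨ *-congˡ (sum-cong-≋ (λ i → trans (*-congʳ (d-sum i))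
             (solve 3 (λ a b z → (a :- b) :* z := a :* z :+ (:- b) :* z) refl (g (suc i)) (g zero) (ω ^ toℕ i)))) ⟩
      ω * sum (λ i → g (suc i) * ω ^ toℕ i + (- g zero) * ω ^ toℕ i)
        ≈⟨ *-congˡ (∑-distrib-+ (λ i → g (suc i) * ω ^ toℕ i) (λ i → (- g zero) * ω ^ toℕ i)) ⟩
      ω * (tail + sum {p′} (λ i → (- g zero) * ω ^ toℕ i))
        ≈⟨ *-congˡ (+-congˡ (*-distribˡ-sum {p′} (- g zero) (λ i → ω ^ toℕ i))) ⟨
      ω * (tail + (- g zero) * ∑ω)
        ≈⟨ solve 4 (λ w t a s → w :* (t :+ (:- a) :* s) := (a :* con 1ℤ :+ w :* t) :- a :* (con 1ℤ :+ w :* s)) refl ω tail (g zero) ∑ω ⟩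
      (g zero * 1# + ω * tail) - g zero * (1# + ω * ∑ω)
        ≈⟨ +-cong (trans (+-congˡ (trans (*-distribˡ-sum ω (λ i → g (suc i) * ω ^ toℕ i))
              (sum-cong-≋ (λ i → solve 3 (λ w a z → w :* (a :* z) := a :* (w :* z)) refl ω (g (suc i)) (ω ^ toℕ i))))) total)
            (-‿cong (trans (*-congˡ 1+ω∑ω≈0) (zeroʳ _))) ⟩
      0# - 0#
        ≈⟨ -‿inverseʳ 0# ⟩
      0# ∎) (primitive-≉0 (ℕ.<-trans (s≤s z≤n) 1<p) ω-primitive)
    all-zero : ∀ i j → d i j ≈ 0#
    all-zero i = All.tabulate⁻ (All.tabulate⁻ (All.concat⁻ (tabulate (λ i → tabulate (d i)))
      (root⇒zero p-prime k prim G s 0<s fix separated f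
        (All.concat⁺ (All.tabulate⁺ (λ i → All.tabulate⁺ (λ j → sub (c∈ (suc i) j) (c∈ zero j))))) root)) i)
    equal : ∀ i j → c i j ≈ c zero j
    equal zero    j = refl
    equal (suc i) j = x∙y⁻¹≈ε⇒x≈y _ _ (all-zero i j)

-- Coprime prime powers.

coprime-* : ∀ {m n o} → Coprime m n → Coprime m o → Coprime m (n ℕ.* o)
coprime-* m⊥n m⊥o (d∣m , d∣no) =
  m⊥o (d∣m , coprime-divisor (λ (e∣d , e∣n) → m⊥n (∣-trans e∣d d∣m , e∣n)) d∣no)

coprime-^ : ∀ {m n} k → Coprime m n → Coprime m (n ℕ.^ k)
coprime-^ zero    m⊥n (_ , d∣1) = ∣1⇒≡1 d∣1
coprime-^ (suc k) m⊥n = coprime-* m⊥n (coprime-^ k m⊥n)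

primes⇒coprime : ∀ {p q} → Prime p → Prime q → p ≢ q → Coprime p q
primes⇒coprime p-prime q-prime p≢q (d∣p , d∣q)
  with prime⇒irreducible p-prime d∣p | prime⇒irreducible q-prime d∣q
... | inj₁ d≡1 | _        = d≡1
... | inj₂ _   | inj₁ d≡1 = d≡1
... | inj₂ d≡p | inj₂ d≡q = ⊥-elim (p≢q (≡.trans (≡.sym d≡p) d≡q))

primes⇒coprime-^ : ∀ {p q} → Prime p → Prime q → p ≢ q → ∀ k l → Coprime (p ℕ.^ k) (q ℕ.^ l)
primes⇒coprime-^ p-prime q-prime p≢q k l =
  coprime-^ l λ (d∣pᵏ , d∣q) → coprime-^ k (primes⇒coprime q-prime p-prime (p≢q ∘ ≡.sym)) (d∣q , d∣pᵏ)

-- Sums over products of index sets.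

module SumCombine {c ℓ} (M : CommutativeMonoid c ℓ) where

  open CommutativeMonoid M renaming (_∙_ to _+_; ∙-congˡ to +-congˡ)
  open Algebra.Properties.CommutativeMonoid.Sum M

  sum-↑ : ∀ m {n} (f : Fin (m ℕ.+ n) → Carrier) → sum f ≈ sum (λ i → f (i ↑ˡ n)) + sum (λ j → f (m ↑ʳ j))
  sum-↑ zero    f = sym (identityˡ _)
  sum-↑ (suc m) f = trans (+-congˡ (sum-↑ m (f ∘ suc))) (sym (assoc _ _ _))

  sum-combine : ∀ m {n} (f : Fin (m ℕ.* n) → Carrier) → sum f ≈ sum (λ i → sum (λ j → f (combine {m} i j)))
  sum-combine zero        f = refl
  sum-combine (suc m) {n} f = trans (sum-↑ n f) (+-congˡ (sum-combine m (f ∘ (n ↑ʳ_))))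

  sum-combine⁴ : ∀ a b c {d} (f : Fin ((a ℕ.* b) ℕ.* (c ℕ.* d)) → Carrier) → sum f ≈
    sum λ i → sum λ j → sum λ x → sum λ y → f (combine (combine {a} {b} i j) (combine {c} x y))
  sum-combine⁴ a b c {d} f = trans (sum-combine (a ℕ.* b) f) (trans
    (sum-combine a (λ s → sum λ t → f (combine s t)))
    (sum-cong-≋ {a} λ i → sum-cong-≋ {b} λ j → sum-combine c (λ t → f (combine (combine i j) t))))

-- Relations over ℤ and the separatedness of ℤ and ℤ[ζ].

module Integers (D : CharZeroDomain) where

  open CharZeroDomain D
  open Subrings D
  open Integrality D
  open Polynomials D
  open Independence D
  open Solver using (solve; _:=_; _:+_; _:*_; _:-_; :-_; con)
  open Algebra.Properties.Ring ring
  open SumCombine +-commutativeMonoid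
  open Relation.Binary.Reasoning.Setoid setoid

  None : Carrier → Set
  None _ = ⊥

  fromℤ-zero : ∀ i → fromℤ i ≈ 0# → i ≡ 0ℤ
  fromℤ-zero (+ n)    eq = ≡.cong +_ (charZero n eq)
  fromℤ-zero -[1+ n ] eq with charZero (suc n) (trans (sym (-‿involutive _)) (trans (-‿cong eq) -0#≈0#))
  ... | ()

  fromℤ-injective : ∀ {i j} → fromℤ i ≈ fromℤ j → i ≡ j
  fromℤ-injective {i} {j} eq = ℤ.i-j≡0⇒i≡j i j (fromℤ-zero (i ℤ.- j)
    (trans (fromℤ-+ i (ℤ.- j)) (trans (+-congˡ (fromℤ-neg j)) (x≈y⇒x∙y⁻¹≈ε eq))))

  ⟨None⟩⇒ℤ : ∀ {x} → ⟨ None ⟩ x → ∃ λ i → x ≈ fromℤ i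
  ⟨None⟩⇒ℤ one = 1ℤ , refl
  ⟨None⟩⇒ℤ (add s t) = let i , eq = ⟨None⟩⇒ℤ s; j , eq′ = ⟨None⟩⇒ℤ t in
    i ℤ.+ j , trans (+-cong eq eq′) (sym (fromℤ-+ i j))
  ⟨None⟩⇒ℤ (neg s) = let i , eq = ⟨None⟩⇒ℤ s in ℤ.- i , trans (-‿cong eq) (sym (fromℤ-neg i))
  ⟨None⟩⇒ℤ (mul s t) = let i , eq = ⟨None⟩⇒ℤ s; j , eq′ = ⟨None⟩⇒ℤ t in
    i ℤ.* j , trans (*-cong eq eq′) (sym (fromℤ-* i j))
  ⟨None⟩⇒ℤ (resp eq s) = let i , eq′ = ⟨None⟩⇒ℤ s in i , trans (sym eq) eq′

  fromℤ-^ : ∀ p m → fromℤ (+ p) ^ m ≈ fromℤ (+ (p ℕ.^ m))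
  fromℤ-^ p zero    = refl
  fromℤ-^ p (suc m) = trans (*-congˡ (fromℤ-^ p m)) (trans (sym (fromℤ-* (+ p) (+ (p ℕ.^ m))))
    (reflexive (≡.cong fromℤ (≡.sym (ℤ.pos-* p (p ℕ.^ m))))))

  n<pⁿ : ∀ {p} → 1 ℕ.< p → ∀ n → n ℕ.< p ℕ.^ n
  n<pⁿ 1<p zero    = s≤s z≤n
  n<pⁿ {p@(suc _)} 1<p (suc n) = ℕ.≤-<-trans (n<pⁿ 1<p n) (ℕ.^-monoʳ-< p 1<p (ℕ.n<1+n n))

  -- For x = i the exponent to test is |i| itself: a nonzero multiple of p^|i| has absolute value at
  -- least p^|i| > |i|.
  separated-None : ∀ {p} → 1 ℕ.< p → Separated (fromℤ (+ p)) None
  separated-None {p} 1<p {x} s ms with ⟨None⟩⇒ℤ s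
  ... | i , x≈i with ms ℤ.∣ i ∣
  ... | c , c∈ , x≈ with ⟨None⟩⇒ℤ c∈
  ... | j , c≈j = trans x≈i (reflexive (≡.cong fromℤ (ℤ.∣i∣≡0⇒i≡0 {i} (small ℤ.∣ j ∣ ∣i∣≡))))
    where
    pⁱ = p ℕ.^ ℤ.∣ i ∣
    ∣i∣≡ : ℤ.∣ i ∣ ≡ pⁱ ℕ.* ℤ.∣ j ∣
    ∣i∣≡ = ≡.trans (≡.cong ℤ.∣_∣ (fromℤ-injective {i} {+ pⁱ ℤ.* j} (begin
      fromℤ i  ≈⟨ x≈i ⟨
      x  ≈⟨ x≈ ⟩
      fromℤ (+ p) ^ ℤ.∣ i ∣ * c  ≈⟨ *-cong (fromℤ-^ p ℤ.∣ i ∣) c≈j ⟩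
      fromℤ (+ pⁱ) * fromℤ j  ≈⟨ fromℤ-* (+ pⁱ) j ⟨
      fromℤ (+ pⁱ ℤ.* j)  ∎))) (ℤ.∣i*j∣≡∣i∣*∣j∣ (+ pⁱ) j)
    small : ∀ k → ℤ.∣ i ∣ ≡ pⁱ ℕ.* k → ℤ.∣ i ∣ ≡ 0
    small zero    eq = ≡.trans eq (ℕ.*-zeroʳ pⁱ)
    small (suc k) eq = ⊥-elim (ℕ.<⇒≱ (n<pⁿ 1<p ℤ.∣ i ∣) (≡.subst (pⁱ ℕ.≤_) (≡.sym eq) (ℕ.m≤m*n pⁱ (suc k))))

  prime>1 : ∀ {p} → Prime p → 1 ℕ.< p
  prime>1 {p} p-prime = ℕ.nonTrivial⇒n>1 p {{prime⇒nonTrivial p-prime}}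

  relations-ℤ : ∀ {p′} (p-prime : Prime (suc p′)) k {ζ} → IsPrimitive (suc p′ ℕ.^ suc k) ζ →
    (c : Fin (suc p′) → Fin (suc p′ ℕ.^ k) → Carrier) → (∀ i j → ⟨ None ⟩ (c i j)) →
    sum (λ i → sum (λ j → c i j * ζ ^ (toℕ j ℕ.+ suc p′ ℕ.^ k ℕ.* toℕ i))) ≈ 0# →
    ∀ i j → c i j ≈ c zero j
  relations-ℤ p-prime k prim = relations-constant p-prime k prim None 1 (s≤s z≤n) (λ ())
    (separated-None (prime>1 p-prime))

  ^-multiple : ∀ {x} m n → x ^ n ≈ 1# → x ^ (m ℕ.* n) ≈ 1#
  ^-multiple {x} m n eq =
    trans (^-congʳ x (ℕ.*-comm m n)) (trans (sym (^-assocʳ x n m)) (trans (^-congˡ m eq) (1^ m)))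

  coprime-orders : ∀ {m n x} → Coprime m n → x ^ m ≈ 1# → x ^ n ≈ 1# → x ≈ 1#
  coprime-orders {m} {n} {x} m⊥n xᵐ≈1 xⁿ≈1 with coprime-Bézout m⊥n
  ... | Bézout.+- a b eq = trans (sym (*-identityʳ x)) (trans (*-congˡ (sym (^-multiple b n xⁿ≈1)))
    (trans (reflexive (≡.cong (x ^_) eq)) (^-multiple a m xᵐ≈1)))
  ... | Bézout.-+ a b eq = trans (sym (*-identityʳ x)) (trans (*-congˡ (sym (^-multiple a m xᵐ≈1)))
    (trans (reflexive (≡.cong (x ^_) eq)) (^-multiple b n xⁿ≈1)))

  ^-% : ∀ {ζ} n .{{_ : ℕ.NonZero n}} → ζ ^ n ≈ 1# → ∀ m → ζ ^ m ≈ ζ ^ (m ℕ.% n)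
  ^-% {ζ} n ζⁿ≈1 m = begin
    ζ ^ m  ≡⟨ ≡.cong (ζ ^_) (ℕ.m≡m%n+[m/n]*n m n) ⟩
    ζ ^ (m ℕ.% n ℕ.+ m ℕ./ n ℕ.* n)  ≈⟨ ^-homo-* ζ (m ℕ.% n) (m ℕ./ n ℕ.* n) ⟩
    ζ ^ (m ℕ.% n) * ζ ^ (m ℕ./ n ℕ.* n)  ≈⟨ *-congˡ (trans (^-congʳ ζ (ℕ.*-comm (m ℕ./ n) n)) (sym (^-assocʳ ζ n (m ℕ./ n)))) ⟩
    ζ ^ (m ℕ.% n) * (ζ ^ n) ^ (m ℕ./ n)  ≈⟨ *-congˡ (trans (^-congˡ (m ℕ./ n) ζⁿ≈1) (1^ (m ℕ./ n))) ⟩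
    ζ ^ (m ℕ.% n) * 1#  ≈⟨ *-identityʳ _ ⟩
    ζ ^ (m ℕ.% n)  ∎

  -- The powers of p repeat modulo n, and p is invertible there.
  frobenius-order : ∀ {n p ζ} → 0 ℕ.< n → 0 ℕ.< p → ζ ^ n ≈ 1# → (∀ i → Coprime (p ℕ.^ i) n) →
                    ∃ λ s → 0 ℕ.< s × ζ ^ (p ℕ.^ s) ≈ ζ
  frobenius-order {n} {p} {ζ} 0<n 0<p ζⁿ≈1 coprime = s , ℕ.m<n⇒0<n∸m i<j , (begin
    ζ ^ (p ℕ.^ s)  ≡⟨ ≡.cong (ζ ^_) 1+r ⟨
    ζ * ζ ^ r  ≈⟨ *-congˡ ζʳ≈1 ⟩
    ζ * 1#  ≈⟨ *-identityʳ ζ ⟩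
    ζ  ∎)
    where
    instance
      n-nz : ℕ.NonZero n
      n-nz = ℕ.>-nonZero 0<n
      p-nz : ℕ.NonZero p
      p-nz = ℕ.>-nonZero 0<p
    residue : Fin (suc n) → Fin n
    residue i = fromℕ< (ℕ.m%n<n (p ℕ.^ toℕ i) n)
    collision = Fin.pigeonhole (ℕ.n<1+n n) residue
    i = toℕ (proj₁ collision)
    j = toℕ (proj₁ (proj₂ collision))
    i<j : i ℕ.< j
    i<j = proj₁ (proj₂ (proj₂ collision))
    s = j ∸ i
    same : p ℕ.^ i ℕ.% n ≡ p ℕ.^ j ℕ.% n
    same = ≡.trans (≡.sym (Fin.toℕ-fromℕ< _)) (≡.trans (≡.cong toℕ (proj₂ (proj₂ (proj₂ collision)))) (Fin.toℕ-fromℕ< _))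
    r = p ℕ.^ s ∸ 1
    1+r : suc r ≡ p ℕ.^ s
    1+r = ℕ.m+[n∸m]≡n (ℕ.m^n>0 p s)
    ζʳ≈1 : ζ ^ r ≈ 1#
    ζʳ≈1 = coprime-orders (coprime i)
      (*-cancelˡ-nonZero (^-≉0 (p ℕ.^ i) (unit≉0 n 0<n ζⁿ≈1)) (begin
        ζ ^ (p ℕ.^ i) * (ζ ^ r) ^ (p ℕ.^ i)  ≈⟨ ^-distrib-* ζ (ζ ^ r) (p ℕ.^ i) ⟨
        (ζ ^ suc r) ^ (p ℕ.^ i)  ≡⟨ ≡.cong (λ m → (ζ ^ m) ^ (p ℕ.^ i)) 1+r ⟩
        (ζ ^ (p ℕ.^ s)) ^ (p ℕ.^ i)  ≈⟨ ^-assocʳ ζ (p ℕ.^ s) (p ℕ.^ i) ⟩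
        ζ ^ (p ℕ.^ s ℕ.* p ℕ.^ i)  ≡⟨ ≡.cong (ζ ^_) (≡.trans (≡.sym (ℕ.^-distribˡ-+-* p s i)) (≡.cong (p ℕ.^_) (ℕ.m∸n+n≡m (ℕ.<⇒≤ i<j)))) ⟩
        ζ ^ (p ℕ.^ j)  ≈⟨ ^-% n ζⁿ≈1 (p ℕ.^ j) ⟩
        ζ ^ (p ℕ.^ j ℕ.% n)  ≡⟨ ≡.cong (ζ ^_) same ⟨
        ζ ^ (p ℕ.^ i ℕ.% n)  ≈⟨ ^-% n ζⁿ≈1 (p ℕ.^ i) ⟨
        ζ ^ (p ℕ.^ i)  ≈⟨ *-identityʳ _ ⟨
        ζ ^ (p ℕ.^ i) * 1#  ∎))
      (trans (^-assocʳ ζ r n) (^-multiple r n ζⁿ≈1))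

  spanned-by-powers : ∀ G {ζ} n → 0 ℕ.< n → ζ ^ n ≈ 1# → ∀ {x} → ⟨ Adjoin G ζ ⟩ x →
    ∃ λ (c : Fin n → Carrier) → (∀ i → ⟨ G ⟩ (c i)) × x ≈ sum (λ i → c i * ζ ^ toℕ i)
  spanned-by-powers G {ζ} (suc n) _ eq = PowerBasis.spanned G ζ n eq

  module _ {q′} (q-prime : Prime (suc q′)) k {ζ} (prim : IsPrimitive (suc q′ ℕ.^ suc k) ζ) where

    private
      q = suc q′
      qᵏ = q ℕ.^ k

      form : (Fin q → Fin qᵏ → Carrier) → Carrier
      form c = sum (λ i → sum (λ j → c i j * ζ ^ (toℕ j ℕ.+ qᵏ ℕ.* toℕ i)))

      formed : ∀ {x} → ⟨ Adjoin None ζ ⟩ x →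
               ∃ λ (c : Fin q → Fin qᵏ → Carrier) → (∀ i j → ⟨ None ⟩ (c i j)) × x ≈ form c
      formed s = let c , c∈ , eq = spanned-by-powers None (q ℕ.^ suc k) (ℕ.m^n>0 q (suc k)) (proj₁ prim) s in
        (λ i j → c (combine i j)) , (λ i j → c∈ (combine i j)) ,
        trans eq (trans (sum-combine q {qᵏ} (λ t → c t * ζ ^ toℕ t))
          (sum-cong-≋ {q} (λ i → sum-cong-≋ {qᵏ} (λ j → *-congˡ {c (combine i j)} (^-congʳ ζ
            (≡.trans (Fin.toℕ-combine i j) (ℕ.+-comm (qᵏ ℕ.* toℕ i) (toℕ j))))))))

    ω-primitive : IsPrimitive q (ζ ^ qᵏ)
    ω-primitive = primitive-^ qᵏ q (ℕ.m^n>0 q k) (≡.subst (λ n → IsPrimitive n ζ) (ℕ.*-comm q qᵏ) prim)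

    -- Coordinates a of x are determined only up to rows independent of i. If x = p^m y and y has
    -- coordinates b, then a - p^m b is a relation over ℤ, hence constant in i, so p^m divides a_ij
    -- - a_0j. This holds for all m, so a is constant in i, and such a combination vanishes.
    separated-adjoin : ∀ {p} → 1 ℕ.< p → Separated (fromℤ (+ p)) (Adjoin None ζ)
    separated-adjoin {p} 1<p {x} x∈ ms = trans x≈ (trans
      (sum-cong-≋ (λ i → sum-cong-≋ (λ j → *-congʳ {ζ ^ (toℕ j ℕ.+ qᵏ ℕ.* toℕ i)} (a-constant i j))))
      (constant-relation (prime>1 q-prime) ω-primitive (a zero)))
      where
      ϖ = fromℤ (+ p)
      a = proj₁ (formed x∈)
      a∈ = proj₁ (proj₂ (formed x∈))
      x≈ = proj₂ (proj₂ (formed x∈))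
      module _ (m : ℕ) where
        ϖᵐ = ϖ ^ m
        b′ = formed (proj₁ (proj₂ (ms m)))
        b = proj₁ b′
        c : Fin q → Fin qᵏ → Carrier
        c i j = a i j - ϖᵐ * b i j
        c-relation : form c ≈ 0#
        c-relation = begin
          form c
            ≈⟨ ∑∑-linear ϖᵐ a b (λ i j → ζ ^ (toℕ j ℕ.+ qᵏ ℕ.* toℕ i)) ⟩
          form a - ϖᵐ * form b
            ≈⟨ +-congʳ (trans (sym x≈) (trans (proj₂ (proj₂ (ms m))) (*-congˡ (proj₂ (proj₂ b′))))) ⟩
          ϖᵐ * form b - ϖᵐ * form b
            ≈⟨ -‿inverseʳ _ ⟩
          0# ∎
        c-constant : ∀ i j → c i j ≈ c zero j
        c-constant = relations-ℤ q-prime k prim c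
          (λ i j → sub (a∈ i j) (mul (pow m (fromℤ-closed (+ p))) (proj₁ (proj₂ b′) i j))) c-relation
        difference : ∀ i j → Multiple ϖᵐ ⟨ None ⟩ (a i j - a zero j)
        difference i j = b i j - b zero j , sub (proj₁ (proj₂ b′) i j) (proj₁ (proj₂ b′) zero j) , (begin
          a i j - a zero j
            ≈⟨ solve 4 (λ a a₀ p b → a :- a₀ := a :- p :* b :+ (p :* b :- a₀)) refl (a i j) (a zero j) ϖᵐ (b i j) ⟩
          c i j + (ϖᵐ * b i j - a zero j)
            ≈⟨ +-congʳ (c-constant i j) ⟩
          c zero j + (ϖᵐ * b i j - a zero j)
            ≈⟨ solve 4 (λ a₀ p b b₀ → a₀ :- p :* b₀ :+ (p :* b :- a₀) := p :* (b :- b₀)) refl (a zero j) ϖᵐ (b i j) (b zero j) ⟩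
          ϖᵐ * (b i j - b zero j) ∎)
      a-constant : ∀ i j → a i j ≈ a zero j
      a-constant i j = x∙y⁻¹≈ε⇒x≈y _ _
        (separated-None 1<p (sub (a∈ i j) (a∈ zero j)) (λ m → difference m i j))

-- Splitting a matrix of natural numbers into a row part and a column part.

argmin : ∀ {n} (f : Fin (suc n) → ℕ) → ∃ λ i → ∀ j → f i ℕ.≤ f j
argmin {zero}  f = zero , λ { zero → ℕ.≤-refl }
argmin {suc n} f with argmin (f ∘ suc)
... | i , least with ℕ.≤-total (f zero) (f (suc i))
...   | inj₁ f₀≤ = zero , λ { zero → ℕ.≤-refl ; (suc j) → ℕ.≤-trans f₀≤ (least j) }
...   | inj₂ ≤f₀ = suc i , λ { zero → ≤f₀ ; (suc j) → least j }

-- Subtracting from every row the row with the smallest initial entry keeps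
-- both summands nonnegative.
cross⇒sum : ∀ {m n} (f : Fin (suc m) → Fin (suc n) → ℕ) →
            (∀ i x → f i x ℕ.+ f zero zero ≡ f i zero ℕ.+ f zero x) →
            ∃₂ λ (b : Fin (suc m) → ℕ) (c : Fin (suc n) → ℕ) → ∀ i x → f i x ≡ b i ℕ.+ c x
cross⇒sum f cross = (λ i → f i zero ∸ f i₀ zero) , f i₀ , λ i x →
  ℕ.+-cancelʳ-≡ (f i₀ zero) (f i x) (f i zero ∸ f i₀ zero ℕ.+ f i₀ x) (begin
    f i x ℕ.+ f i₀ zero
      ≡⟨ exchange i x ⟩
    f i zero ℕ.+ f i₀ x
      ≡⟨ ≡.cong (ℕ._+ f i₀ x) (ℕ.m∸n+n≡m (proj₂ (argmin (λ i → f i zero)) i)) ⟨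
    f i zero ∸ f i₀ zero ℕ.+ f i₀ zero ℕ.+ f i₀ x
      ≡⟨ solve 3 (λ a b c → a :+ b :+ c := a :+ c :+ b) ≡.refl (f i zero ∸ f i₀ zero) (f i₀ zero) (f i₀ x) ⟩
    f i zero ∸ f i₀ zero ℕ.+ f i₀ x ℕ.+ f i₀ zero ∎)
  where
  open ≡.≡-Reasoning
  open Data.Nat.Solver.+-*-Solver
  i₀ = proj₁ (argmin (λ i → f i zero))
  -- `cross` compares with row zero only; adding its instances at `i` and `i₀` and cancelling moves
  -- the comparison to row `i₀`.
  exchange : ∀ i x → f i x ℕ.+ f i₀ zero ≡ f i zero ℕ.+ f i₀ x
  exchange i x = ℕ.+-cancelʳ-≡ (f zero zero ℕ.+ f zero x) _ _ (begin
    f i x ℕ.+ f i₀ zero ℕ.+ (f zero zero ℕ.+ f zero x)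
      ≡⟨ solve 4 (λ a b c d → a :+ b :+ (c :+ d) := (a :+ c) :+ (b :+ d)) ≡.refl (f i x) (f i₀ zero) (f zero zero) (f zero x) ⟩
    (f i x ℕ.+ f zero zero) ℕ.+ (f i₀ zero ℕ.+ f zero x)
      ≡⟨ ≡.cong₂ ℕ._+_ (cross i x) (≡.sym (cross i₀ x)) ⟩
    (f i zero ℕ.+ f zero x) ℕ.+ (f i₀ x ℕ.+ f zero zero)
      ≡⟨ solve 4 (λ a b c d → a :+ b :+ (c :+ d) := a :+ c :+ (d :+ b)) ≡.refl (f i zero) (f zero x) (f i₀ x) (f zero zero) ⟩
    f i zero ℕ.+ f i₀ x ℕ.+ (f zero zero ℕ.+ f zero x) ∎)

-- Vanishing sums for two prime powers, and the list of all roots of unity of such an order.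

module RootsOfUnity (D : CharZeroDomain) where

  open CharZeroDomain D
  open Subrings D
  open Integrality D
  open Polynomials D
  open Independence D
  open Integers D
  open Solver using (solve; _:=_; _:+_; _:*_; _:-_; :-_; con)
  open Algebra.Properties.Ring ring
  open Relation.Binary.Reasoning.Setoid setoid

  fromNat : ℕ → Carrier
  fromNat n = fromℤ (+ n)

  fromNat-+ : ∀ m n → fromNat (m ℕ.+ n) ≈ fromNat m + fromNat n
  fromNat-+ m n = fromℤ-+ (+ m) (+ n)

  fromNat-injective : ∀ {m n} → fromNat m ≈ fromNat n → m ≡ n
  fromNat-injective eq = ℤ.+-injective (fromℤ-injective eq)

  module _ {p′ q′} (p-prime : Prime (suc p′)) (q-prime : Prime (suc q′)) (p≢q : suc p′ ≢ suc q′) (k l : ℕ)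
           {ζ₁ ζ₂} (prim₁ : IsPrimitive (suc p′ ℕ.^ suc k) ζ₁) (prim₂ : IsPrimitive (suc q′ ℕ.^ suc l) ζ₂) where

    private
      p q pᵏ qˡ : ℕ
      p = suc p′
      q = suc q′
      pᵏ = p ℕ.^ k
      qˡ = q ℕ.^ l

    z₁ : Fin p → Fin pᵏ → Carrier
    z₁ i j = ζ₁ ^ (toℕ j ℕ.+ pᵏ ℕ.* toℕ i)

    z₂ : Fin q → Fin qˡ → Carrier
    z₂ x y = ζ₂ ^ (toℕ y ℕ.+ qˡ ℕ.* toℕ x)

    weightedSum : (Fin p → Fin pᵏ → Fin q → Fin qˡ → ℕ) → Carrier
    weightedSum a = sum λ i → sum λ j → sum λ x → sum λ y → fromNat (a i j x y) * (z₁ i j * z₂ x y)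

    private
      inner : (Fin q → Fin qˡ → ℕ) → Carrier
      inner c = sum λ x → sum λ y → fromNat (c x y) * z₂ x y

      inner-factor : ∀ c z → sum (λ x → sum (λ y → fromNat (c x y) * (z * z₂ x y))) ≈ inner c * z
      inner-factor c z = trans
        (sum-cong-≋ {q} λ x → trans
          (sum-cong-≋ {qˡ} λ y → solve 3 (λ a z w → a :* (z :* w) := (a :* w) :* z) refl (fromNat (c x y)) z (z₂ x y))
          (sym (*-distribʳ-sum z (λ y → fromNat (c x y) * z₂ x y))))
        (sym (*-distribʳ-sum z (λ x → sum (λ y → fromNat (c x y) * z₂ x y))))

      weightedSum-inner : ∀ a → weightedSum a ≈ sum λ i → sum λ j → inner (a i j) * z₁ i j
      weightedSum-inner a = sum-cong-≋ {p} λ i → sum-cong-≋ {pᵏ} λ j → inner-factor (a i j) (z₁ i j)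

      inner-+ : ∀ b c → inner (λ x y → b x y ℕ.+ c x y) ≈ inner b + inner c
      inner-+ b c = trans
        (sum-cong-≋ {q} λ x → trans
          (sum-cong-≋ {qˡ} λ y → trans (*-congʳ (fromNat-+ (b x y) (c x y))) (distribʳ (z₂ x y) (fromNat (b x y)) (fromNat (c x y))))
          (∑-distrib-+ (λ y → fromNat (b x y) * z₂ x y) (λ y → fromNat (c x y) * z₂ x y)))
        (∑-distrib-+ (λ x → sum λ y → fromNat (b x y) * z₂ x y) (λ x → sum λ y → fromNat (c x y) * z₂ x y))

      inner-≡ : ∀ b c → (∀ x y → b x y ≡ c x y) → inner b ≈ inner c
      inner-≡ b c eq = sum-cong-≋ {q} λ x → sum-cong-≋ {qˡ} λ y →
        *-congʳ {z₂ x y} (reflexive (≡.cong fromNat (eq x y)))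

      inner-injective : ∀ b c → inner b ≈ inner c →
                        ∀ x y → b x y ℕ.+ c zero y ≡ b zero y ℕ.+ c x y
      inner-injective b c eq x y = fromNat-injective (begin
        fromNat (b x y ℕ.+ c zero y)
          ≈⟨ fromNat-+ (b x y) (c zero y) ⟩
        fromNat (b x y) + fromNat (c zero y)
          ≈⟨ solve 3 (λ b c c₀ → b :+ c₀ := (b :- con 1ℤ :* c) :+ c₀ :+ c) refl (fromNat (b x y)) (fromNat (c x y)) (fromNat (c zero y)) ⟩
        d x y + fromNat (c zero y) + fromNat (c x y)
          ≈⟨ +-congʳ (+-congʳ (relations-ℤ q-prime l prim₂ d
               (λ x y → sub (fromℤ-closed (+ b x y)) (mul one (fromℤ-closed (+ c x y)))) vanishes x y)) ⟩
        d zero y + fromNat (c zero y) + fromNat (c x y)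
          ≈⟨ solve 3 (λ b c c₀ → b :- con 1ℤ :* c₀ :+ c₀ :+ c := b :+ c) refl (fromNat (b zero y)) (fromNat (c x y)) (fromNat (c zero y)) ⟩
        fromNat (b zero y) + fromNat (c x y)
          ≈⟨ fromNat-+ (b zero y) (c x y) ⟨
        fromNat (b zero y ℕ.+ c x y) ∎)
        where
        d : Fin q → Fin qˡ → Carrier
        -- The factor `1#` only gives the difference the shape `a - p * b` of `∑∑-linear`.
        d x y = fromNat (b x y) - 1# * fromNat (c x y)
        vanishes : sum (λ x → sum (λ y → d x y * z₂ x y)) ≈ 0#
        vanishes = trans (∑∑-linear 1# (λ x y → fromNat (b x y)) (λ x y → fromNat (c x y)) z₂)
          (x≈y⇒x∙y⁻¹≈ε (trans eq (sym (*-identityˡ (inner c)))))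

      inner-closed : ∀ c → ⟨ Adjoin None ζ₂ ⟩ (inner c)
      inner-closed c = ∑-closed {n = q} λ x → ∑-closed {n = qˡ} λ y →
        mul (fromℤ-closed (+ c x y)) (pow (toℕ y ℕ.+ qˡ ℕ.* toℕ x) (gen (inj₂ refl)))

    -- The coefficient of `z₁ i j` is `inner (a i j)` in ℤ[ζ₂], which must not depend on i.
    -- Comparing integer coefficients then gives the exchange identity separately for each pair (j,
    -- y), and each pair is split on its own.
    vanishing⇒sumForm : ∀ a → weightedSum a ≈ 0# →
      ∃₂ λ (b : Fin p → Fin pᵏ → Fin qˡ → ℕ) (c : Fin pᵏ → Fin q → Fin qˡ → ℕ) →
      ∀ i j x y → a i j x y ≡ b i j y ℕ.+ c j x y
    vanishing⇒sumForm a eq =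
      (λ i j y → proj₁ (summands j y) i) , (λ j x y → proj₁ (proj₂ (summands j y)) x) ,
      λ i j x y → proj₂ (proj₂ (summands j y)) i x
      where
      order = frobenius-order {q ℕ.^ suc l} {p} (ℕ.m^n>0 q (suc l)) (s≤s z≤n) (proj₁ prim₂)
                (λ i → primes⇒coprime-^ p-prime q-prime p≢q i (suc l))
      fix : ∀ {g} → Adjoin None ζ₂ g → g ^ (p ℕ.^ proj₁ order) ≈ g
      fix (inj₂ g≈ζ) = trans (^-congˡ (p ℕ.^ proj₁ order) g≈ζ) (trans (proj₂ (proj₂ order)) (sym g≈ζ))
      constant : ∀ i j → inner (a i j) ≈ inner (a zero j)
      constant = relations-constant p-prime k prim₁ (Adjoin None ζ₂) (proj₁ order) (proj₁ (proj₂ order)) fix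
        (separated-adjoin q-prime l prim₂ (prime>1 p-prime))
        (λ i j → inner (a i j)) (λ i j → inner-closed (a i j)) (trans (sym (weightedSum-inner a)) eq)
      summands : ∀ j y → _
      summands j y = cross⇒sum (λ i x → a i j x y)
        (λ i x → inner-injective (a i j) (a zero j) (constant i j) x y)

    -- The part b is constant in x and dies in the inner sum; the part c is constant in i and dies
    -- in the outer one.
    sumForm⇒vanishing : ∀ a (b : Fin p → Fin pᵏ → Fin qˡ → ℕ) (c : Fin pᵏ → Fin q → Fin qˡ → ℕ) →
      (∀ i j x y → a i j x y ≡ b i j y ℕ.+ c j x y) → weightedSum a ≈ 0#
    sumForm⇒vanishing a b c eq = begin
      weightedSum a
        ≈⟨ weightedSum-inner a ⟩
      sum (λ i → sum λ j → inner (a i j) * z₁ i j)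
        ≈⟨ sum-cong-≋ {p} (λ i → sum-cong-≋ {pᵏ} (λ j → *-congʳ {z₁ i j} (begin
             inner (a i j)  ≈⟨ inner-≡ (a i j) (λ x y → b i j y ℕ.+ c j x y) (eq i j) ⟩
             inner (λ x y → b i j y ℕ.+ c j x y)  ≈⟨ inner-+ (λ _ → b i j) (c j) ⟩
             inner (λ x y → b i j y) + inner (c j)  ≈⟨ +-congʳ (constant-relation {q} {qˡ} (prime>1 q-prime)
                                                                    (ω-primitive q-prime l prim₂) (fromNat ∘ b i j)) ⟩
             0# + inner (c j)  ≈⟨ +-identityˡ _ ⟩
             inner (c j)  ∎))) ⟩
      sum {p} (λ i → sum λ j → inner (c j) * z₁ i j)
        ≈⟨ constant-relation {p} {pᵏ} (prime>1 p-prime) (ω-primitive p-prime k prim₁) (λ j → inner (c j)) ⟩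
      0# ∎

  primitive-^-coprime : ∀ {m n ζ} → Coprime m n → IsPrimitive n ζ → IsPrimitive n (ζ ^ m)
  primitive-^-coprime {m} {n} {ζ} m⊥n (ζⁿ≈1 , least) =
    trans (^-assocʳ ζ m n) (^-multiple m n ζⁿ≈1) , λ d 0<d d<n eq → least d 0<d d<n
      (coprime-orders m⊥n (trans (^-assocʳ ζ d m) (trans (^-congʳ ζ (ℕ.*-comm d m)) (trans (sym (^-assocʳ ζ m d)) eq)))
        (trans (^-assocʳ ζ d n) (^-multiple d n ζⁿ≈1)))

  module _ {m n ζ₁ ζ₂} (0<m : 0 ℕ.< m) (0<n : 0 ℕ.< n) (m⊥n : Coprime m n)
           (prim₁ : IsPrimitive m ζ₁) (prim₂ : IsPrimitive n ζ₂) where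

    private
      r : Fin m × Fin n → Carrier
      r (a , b) = ζ₁ ^ toℕ a * ζ₂ ^ toℕ b

    -- The n-th power removes the factor from ζ₂, while ζ₁^n is still primitive of order m, so the
    -- first exponent is determined. Cancelling its factor determines the second.
    roots-injective : ∀ {s t} → r s ≈ r t → s ≡ t
    roots-injective {a , b} {a′ , b′} eq = ≡.cong₂ _,_ a≡a′ (Fin.toℕ-injective
      (primitive-injective prim₂ (Fin.toℕ<n b) (Fin.toℕ<n b′)
        (*-cancelˡ-nonZero (^-≉0 (toℕ a) (primitive-≉0 0<m prim₁))
          (trans eq (*-congʳ (^-congʳ ζ₁ (≡.cong toℕ (≡.sym a≡a′))))))))
      where
      ^n : ∀ a b → (ζ₁ ^ a * ζ₂ ^ b) ^ n ≈ (ζ₁ ^ n) ^ a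
      ^n a b = begin
        (ζ₁ ^ a * ζ₂ ^ b) ^ n  ≈⟨ ^-distrib-* (ζ₁ ^ a) (ζ₂ ^ b) n ⟩
        (ζ₁ ^ a) ^ n * (ζ₂ ^ b) ^ n  ≈⟨ *-cong (trans (^-assocʳ ζ₁ a n) (^-congʳ ζ₁ (ℕ.*-comm a n)))
                                                    (trans (^-assocʳ ζ₂ b n) (^-multiple b n (proj₁ prim₂))) ⟩
        ζ₁ ^ (n ℕ.* a) * 1#  ≈⟨ *-identityʳ _ ⟩
        ζ₁ ^ (n ℕ.* a)  ≈⟨ ^-assocʳ ζ₁ n a ⟨
        (ζ₁ ^ n) ^ a  ∎
      a≡a′ : a ≡ a′
      a≡a′ = Fin.toℕ-injective (primitive-injective
        (primitive-^-coprime (λ (d∣n , d∣m) → m⊥n (d∣m , d∣n)) prim₁) (Fin.toℕ<n a) (Fin.toℕ<n a′)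
        (trans (sym (^n (toℕ a) (toℕ b))) (trans (^-congˡ n eq) (^n (toℕ a′) (toℕ b′)))))

    roots-^ : ∀ s → r s ^ (m ℕ.* n) ≈ 1#
    roots-^ (a , b) = begin
      (ζ₁ ^ toℕ a * ζ₂ ^ toℕ b) ^ (m ℕ.* n)  ≈⟨ ^-distrib-* _ _ (m ℕ.* n) ⟩
      (ζ₁ ^ toℕ a) ^ (m ℕ.* n) * (ζ₂ ^ toℕ b) ^ (m ℕ.* n)  ≈⟨ *-cong
          (trans (^-congʳ _ (ℕ.*-comm m n)) (^-multiple n m (trans (^-assocʳ ζ₁ (toℕ a) m) (^-multiple (toℕ a) m (proj₁ prim₁)))))
          (^-multiple m n (trans (^-assocʳ ζ₂ (toℕ b) n) (^-multiple (toℕ b) n (proj₁ prim₂)))) ⟩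
      1# * 1#  ≈⟨ *-identityˡ 1# ⟩
      1#  ∎

    module _ (1? : ∀ {w} → w ^ (m ℕ.* n) ≈ 1# → Dec (w ≈ 1#)) where

      -- A finite search, which cannot fail: otherwise z^(mn) - 1 = ∏ (z - r t) would be nonzero.
      -- Comparing z with r s amounts to deciding whether the root of unity r s^(mn-1) z is 1, which
      -- is what `1?` provides.
      roots-complete : ∀ {z} → z ^ (m ℕ.* n) ≈ 1# → ∃ λ s → z ≈ r s
      roots-complete {z} zᵐⁿ≈1 with Fin.any? (λ t → z≟ (remQuot {m} n t))
        where
        mn = m ℕ.* n
        mn≡ : suc (mn ∸ 1) ≡ mn
        mn≡ = ℕ.m+[n∸m]≡n (ℕ.*-mono-≤ 0<m 0<n)
        z≟ : ∀ s → Dec (z ≈ r s)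
        z≟ s = Dec.map′
          (λ eq → *-cancelˡ-nonZero {r s ^ (mn ∸ 1)} (^-≉0 (mn ∸ 1) (unit≉0 mn (ℕ.*-mono-≤ 0<m 0<n) (roots-^ s)))
            (trans eq (sym inverse)))
          (λ z≈r → trans (*-congˡ z≈r) inverse)
          (1? (trans (^-distrib-* _ z mn) (trans (*-cong
            (trans (^-assocʳ (r s) (mn ∸ 1) mn) (^-multiple (mn ∸ 1) mn (roots-^ s))) zᵐⁿ≈1) (*-identityˡ 1#))))
          where
          inverse : r s ^ (mn ∸ 1) * r s ≈ 1#
          inverse = trans (*-comm _ _) (trans (^-congʳ (r s) mn≡) (roots-^ s))
      ... | yes (t , z≈r) = remQuot {m} n t , z≈r
      ... | no none = ⊥-elim (go (m ℕ.* n) ≡.refl (ℕ.*-mono-≤ 0<m 0<n))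
        where
        go : ∀ N → N ≡ m ℕ.* n → 0 ℕ.< N → ⊥
        go (suc N) eq _ = product-≉0 {suc N} (λ t → z - r̂ t)
          (λ t z-r≈0 → none (≡.subst Fin eq t , trans (x∙y⁻¹≈ε⇒x≈y _ _ z-r≈0) refl))
          (trans (sym (xⁿ-a-factorization N r̂ 1# r̂-injective
              (λ t → trans (^-congʳ (r̂ t) eq) (roots-^ (remQuot {m} n (≡.subst Fin eq t)))) z))
            (trans (+-congʳ (trans (^-congʳ z eq) zᵐⁿ≈1)) (-‿inverseʳ 1#)))
          where
          r̂ : Fin (suc N) → Carrier
          r̂ t = r (remQuot {m} n (≡.subst Fin eq t))
          r̂-injective : ∀ {s t} → r̂ s ≈ r̂ t → s ≡ t
          r̂-injective {s} {t} eq′ = ≡.subst-injective eq (≡.trans (≡.sym (Fin.combine-remQuot {m} n _))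
            (≡.trans (≡.cong (uncurry combine) (roots-injective eq′)) (Fin.combine-remQuot {m} n _)))

-- Counting how often a finite function takes each value.

module ℕ-Sum = Algebra.Properties.CommutativeMonoid.Sum ℕ.+-0-commutativeMonoid

Count-unique : ∀ {N} {P Q : Fin N → Set} {m m′} → (∀ n → P n ⇔ Q n) → Count P m → Count Q m′ → m ≡ m′
Count-unique P⇔Q (S , S⇔ , ∣S∣≡m) (T , T⇔ , ∣T∣≡m′) = ≡.trans (≡.sym ∣S∣≡m)
  (≡.trans (≡.cong ∣_∣ (Subset.⊆-antisym
      (λ {n} n∈S → from (T⇔ n) (to (P⇔Q n) (to (S⇔ n) n∈S)))
      (λ {n} n∈T → from (S⇔ n) (from (P⇔Q n) (to (T⇔ n) n∈T)))))
    ∣T∣≡m′)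
  where open Equivalence

Count-resp : ∀ {N} {P Q : Fin N → Set} {m} → (∀ n → P n ⇔ Q n) → Count P m → Count Q m
Count-resp P⇔Q (S , S⇔ , ∣S∣≡m) =
  S , (λ n → mk⇔ (to (P⇔Q n) ∘ to (S⇔ n)) (from (S⇔ n) ∘ from (P⇔Q n))) , ∣S∣≡m
  where open Equivalence

module _ {M : ℕ} where

  χ : Fin M → Fin M → ℕ
  χ a b = if does (a Fin.≟ b) then 1 else 0

  χ-≡ : ∀ a → χ a a ≡ 1
  χ-≡ a = ≡.cong (if_then 1 else 0) (dec-true (a Fin.≟ a) ≡.refl)

  count : ∀ {N} → (Fin N → Fin M) → Fin M → ℕ
  count f κ = ℕ-Sum.sum λ n → χ (f n) κ

  count-Count : ∀ {N} (f : Fin N → Fin M) κ → Count (λ n → f n ≡ κ) (count f κ)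
  count-Count f κ = tabulate (λ n → does (f n Fin.≟ κ)) , member , size f
    where
    member : ∀ n → n ∈ tabulate (λ n → does (f n Fin.≟ κ)) ⇔ f n ≡ κ
    member n = mk⇔
      (λ n∈ → decided (f n Fin.≟ κ) (≡.trans (≡.sym (Vec.lookup∘tabulate _ n)) (Vec.[]=⇒lookup n∈)))
      (λ fn≡κ → Vec.lookup⇒[]= n _ (≡.trans (Vec.lookup∘tabulate _ n) (dec-true (f n Fin.≟ κ) fn≡κ)))
      where
      decided : ∀ {A : Set} (A? : Dec A) → does A? ≡ true → A
      decided (yes a) _ = a
    size : ∀ {N} (f : Fin N → Fin M) → ∣ tabulate (λ n → does (f n Fin.≟ κ)) ∣ ≡ count f κ
    size {zero}  f = ≡.refl
    size {suc N} f with does (f zero Fin.≟ κ)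
    ... | true  = ≡.cong suc (size (f ∘ suc))
    ... | false = size (f ∘ suc)

  occurs : ∀ {N} (f : Fin N → Fin M) κ → count f κ ≢ 0 → ∃ λ n → f n ≡ κ
  occurs {zero}  f κ ≢0 = ⊥-elim (≢0 ≡.refl)
  occurs {suc N} f κ ≢0 with f zero Fin.≟ κ
  ... | yes eq = zero , eq
  ... | no _   = let n , eq = occurs (f ∘ suc) κ ≢0 in suc n , eq

  -- Match the first column of g with some column of f, remove both and recurse.
  equal-counts⇒permutation : ∀ {N} (f g : Fin N → Fin M) → (∀ κ → count f κ ≡ count g κ) →
                             ∃ λ (σ : Permutation′ N) → ∀ n → f (σ ⟨$⟩ʳ n) ≡ g n
  equal-counts⇒permutation {zero}  f g eq = Perm.id , λ ()
  equal-counts⇒permutation {suc N} f g eq = Perm.insert zero m (proj₁ rest) , matches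
    where
    κ = g zero
    found : ∃ λ n → f n ≡ κ
    found = occurs f κ λ ≡0 → ℕ.1+n≢0 (≡.trans
      (≡.cong (ℕ._+ count (g ∘ suc) κ) (≡.sym (χ-≡ κ))) (≡.trans (≡.sym (eq κ)) ≡0))
    m = proj₁ found
    rest = equal-counts⇒permutation (f ∘ punchIn m) (g ∘ suc) λ κ′ → ℕ.+-cancelˡ-≡ (χ κ κ′) _ _
      (≡.trans (≡.cong (λ a → χ a κ′ ℕ.+ count (f ∘ punchIn m) κ′) (≡.sym (proj₂ found)))
        (≡.trans (≡.sym (ℕ-Sum.sum-remove {i = m} (λ n → χ (f n) κ′))) (eq κ′)))
    matches : ∀ n → f (Perm.insert zero m (proj₁ rest) ⟨$⟩ʳ n) ≡ g n
    matches zero    = proj₂ found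
    matches (suc n) = ≡.trans (≡.cong f (Perm.insert-punchIn zero m (proj₁ rest) n)) (proj₂ rest n)

sum-constant : ∀ n {f : Fin n → ℕ} c → (∀ i → f i ≡ c) → ℕ-Sum.sum f ≡ n ℕ.* c
sum-constant zero    c eq = ≡.refl
sum-constant (suc n) c eq = ≡.cong₂ ℕ._+_ (eq zero) (sum-constant n c (eq ∘ suc))

-- A block of `A zero` zeros is put in front of the function built for the other values.
with-counts : ∀ {M} (A : Fin M → ℕ) → ∃ λ (f : Fin (ℕ-Sum.sum A) → Fin M) → ∀ κ → count f κ ≡ A κ
with-counts {zero}  A = (λ ()) , λ ()
with-counts {suc M} A = f , counts
  where
  open ≡.≡-Reasoning
  rest = with-counts (A ∘ suc)
  f : Fin (A zero ℕ.+ ℕ-Sum.sum (A ∘ suc)) → Fin (suc M)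
  f n = [ (λ _ → zero) , suc ∘ proj₁ rest ]′ (splitAt (A zero) n)
  count-split : ∀ κ → count f κ ≡
    ℕ-Sum.sum {A zero} (λ _ → χ zero κ) ℕ.+ ℕ-Sum.sum (λ n → χ (suc (proj₁ rest n)) κ)
  count-split κ = ≡.trans (SumCombine.sum-↑ ℕ.+-0-commutativeMonoid (A zero) (λ n → χ (f n) κ))
    (≡.cong₂ ℕ._+_
      (ℕ-Sum.sum-cong-≗ λ i → ≡.cong (λ s → χ ([ (λ _ → zero) , suc ∘ proj₁ rest ]′ s) κ) (Fin.splitAt-↑ˡ (A zero) i _))
      (ℕ-Sum.sum-cong-≗ λ j → ≡.cong (λ s → χ ([ (λ _ → zero) , suc ∘ proj₁ rest ]′ s) κ) (Fin.splitAt-↑ʳ (A zero) _ j)))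
  counts : ∀ κ → count f κ ≡ A κ
  counts zero = begin
    count f zero  ≡⟨ count-split zero ⟩
    ℕ-Sum.sum {A zero} (λ _ → 1) ℕ.+ ℕ-Sum.sum {ℕ-Sum.sum (A ∘ suc)} (λ _ → 0)
      ≡⟨ ≡.cong₂ ℕ._+_ (sum-constant (A zero) 1 (λ _ → ≡.refl)) (sum-constant (ℕ-Sum.sum (A ∘ suc)) 0 (λ _ → ≡.refl)) ⟩
    A zero ℕ.* 1 ℕ.+ ℕ-Sum.sum (A ∘ suc) ℕ.* 0
      ≡⟨ ≡.cong₂ ℕ._+_ (ℕ.*-identityʳ (A zero)) (ℕ.*-zeroʳ (ℕ-Sum.sum (A ∘ suc))) ⟩
    A zero ℕ.+ 0  ≡⟨ ℕ.+-identityʳ (A zero) ⟩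
    A zero  ∎
  counts (suc κ) = begin
    count f (suc κ)  ≡⟨ count-split (suc κ) ⟩
    ℕ-Sum.sum {A zero} (λ _ → 0) ℕ.+ ℕ-Sum.sum (λ n → χ (suc (proj₁ rest n)) (suc κ))
      ≡⟨ ≡.cong₂ ℕ._+_ (≡.trans (sum-constant (A zero) 0 (λ _ → ≡.refl)) (ℕ.*-zeroʳ (A zero))) ≡.refl ⟩
    count (proj₁ rest) κ  ≡⟨ proj₂ rest κ ⟩
    A (suc κ)  ∎

module SumByValue (M : CommutativeMonoid 0ℓ 0ℓ) where

  open CommutativeMonoid M renaming (_∙_ to _+_; ε to 0#; ∙-cong to +-cong; ∙-congˡ to +-congˡ)
  open Algebra.Properties.CommutativeMonoid.Sum M
  open Algebra.Properties.Monoid.Mult monoid using (×-homo-+) renaming (_×_ to _⋆_)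
  open Relation.Binary.Reasoning.Setoid setoid

  sum-χ : ∀ {M} (κ : Fin M) (g : Fin M → Carrier) → sum (λ κ′ → χ κ κ′ ⋆ g κ′) ≈ g κ
  sum-χ {suc M} zero g = begin
    1 ⋆ g zero + sum {M} (λ κ′ → 0#)  ≈⟨ +-cong (identityʳ _) (sum-replicate-zero M) ⟩
    g zero + 0#  ≈⟨ identityʳ _ ⟩
    g zero  ∎
  sum-χ {suc M} (suc κ) g = begin
    0# + sum (λ κ′ → χ (suc κ) (suc κ′) ⋆ g (suc κ′))
      ≈⟨ identityˡ _ ⟩
    sum (λ κ′ → χ (suc κ) (suc κ′) ⋆ g (suc κ′))
      ≡⟨⟩
    sum (λ κ′ → χ κ κ′ ⋆ g (suc κ′))
      ≈⟨ sum-χ κ (g ∘ suc) ⟩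
    g (suc κ) ∎

  sum-by-value : ∀ {N K} (f : Fin N → Fin K) (g : Fin K → Carrier) →
                 sum (λ n → g (f n)) ≈ sum (λ κ → count f κ ⋆ g κ)
  sum-by-value {zero}  {M} f g = sym (sum-replicate-zero M)
  sum-by-value {suc N} {M} f g = begin
    g (f zero) + sum (λ n → g (f (suc n)))
      ≈⟨ +-cong (sym (sum-χ (f zero) g)) (sum-by-value (f ∘ suc) g) ⟩
    sum (λ κ → χ (f zero) κ ⋆ g κ) + sum (λ κ → count (f ∘ suc) κ ⋆ g κ)
      ≈⟨ ∑-distrib-+ (λ κ → χ (f zero) κ ⋆ g κ) (λ κ → count (f ∘ suc) κ ⋆ g κ) ⟨
    sum (λ κ → χ (f zero) κ ⋆ g κ + count (f ∘ suc) κ ⋆ g κ)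
      ≈⟨ sum-cong-≋ {M} (λ κ → ×-homo-+ (g κ) (χ (f zero) κ) (count (f ∘ suc) κ)) ⟨
    sum (λ κ → count f κ ⋆ g κ) ∎

sum-count : ∀ {N M} (f : Fin N → Fin M) → ℕ-Sum.sum (count f) ≡ N
sum-count {N} {M} f = begin
  ℕ-Sum.sum (count f)  ≡⟨ ℕ-Sum.∑-comm (λ κ n → χ (f n) κ) ⟩
  ℕ-Sum.sum (λ n → ℕ-Sum.sum (χ (f n))) ≡⟨ sum-constant N 1 (λ n → row (f n)) ⟩
  N ℕ.* 1  ≡⟨ ℕ.*-identityʳ N ⟩
  N  ∎
  where
  open ≡.≡-Reasoning
  open Algebra.Properties.Monoid.Mult ℕ.+-0-monoid using () renaming (_×_ to _×ℕ_)
  ×ℕ1 : ∀ n → n ×ℕ 1 ≡ n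
  ×ℕ1 zero    = ≡.refl
  ×ℕ1 (suc n) = ≡.cong suc (×ℕ1 n)
  row : ∀ κ → ℕ-Sum.sum (χ κ) ≡ 1
  row κ = ≡.trans (ℕ-Sum.sum-cong-≗ λ κ′ → ≡.sym (×ℕ1 (χ κ κ′)))
    (SumByValue.sum-χ ℕ.+-0-commutativeMonoid κ (λ _ → 1))

-- Cardinality of decidable subsets.

Restricted : (Ω : Setoid 0ℓ 0ℓ) → (Setoid.Carrier Ω → Set) → Setoid 0ℓ 0ℓ
Restricted Ω E = On.setoid {B = Σ (Setoid.Carrier Ω) E} Ω proj₁

-- Elements of the restricted setoid are compared by their first components, so P may have several
-- proofs at one index without changing the count.
cardinality-Fin : ∀ {n} {P : Fin n → Set} → (∀ i → Dec (P i)) →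
                  ∃ λ m → HasCardinality (Restricted (≡.setoid (Fin n)) P) m
cardinality-Fin {zero} P? = 0 , record
  { to = λ { (() , _) } ; from = λ () ; to-cong = λ { {() , _} } ; from-cong = λ { {()} }
  ; inverse = (λ { {()} }) , λ { {() , _} } }
cardinality-Fin {suc n} {P} P? = extend (P? zero) (cardinality-Fin (P? ∘ suc))
  where
  extend : Dec (P zero) → ∃ (HasCardinality (Restricted (≡.setoid (Fin n)) (P ∘ suc))) →
           ∃ (HasCardinality (Restricted (≡.setoid (Fin (suc n))) P))
  extend (yes p₀) (m , I) = suc m , record
    { to        = to
    ; from      = from
    ; to-cong   = λ {i} {j} → to-cong i j
    ; from-cong = λ { ≡.refl → ≡.refl }
    ; inverse   = (λ {x} {y} → inverseˡ x y) , λ {x} {y} → inverseʳ x y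
    }
    where
    module I = Inverse I
    to : Σ (Fin (suc n)) P → Fin (suc m)
    to (zero  , _) = zero
    to (suc i , p) = suc (I.to (i , p))
    from : Fin (suc m) → Σ (Fin (suc n)) P
    from zero    = zero , p₀
    from (suc k) = suc (proj₁ (I.from k)) , proj₂ (I.from k)
    to-cong : ∀ i j → proj₁ i ≡ proj₁ j → to i ≡ to j
    to-cong (zero  , _) (zero  , _) _  = ≡.refl
    to-cong (suc i , p) (suc j , q) eq = ≡.cong suc (I.to-cong (Fin.suc-injective eq))
    inverseˡ : ∀ x y → proj₁ y ≡ proj₁ (from x) → to y ≡ x
    inverseˡ zero    (zero , _)  _  = ≡.refl
    inverseˡ (suc k) (suc j , p) eq = ≡.cong suc (I.inverseˡ (Fin.suc-injective eq))
    inverseʳ : ∀ x y → y ≡ to x → proj₁ (from y) ≡ proj₁ x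
    inverseʳ (zero  , _) _ ≡.refl = ≡.refl
    inverseʳ (suc i , p) _ ≡.refl = ≡.cong suc (I.inverseʳ ≡.refl)
  extend (no ¬p₀) (m , I) = m , record
    { to        = to
    ; from      = λ k → suc (proj₁ (I.from k)) , proj₂ (I.from k)
    ; to-cong   = λ {i} {j} → to-cong i j
    ; from-cong = λ { ≡.refl → ≡.refl }
    ; inverse   = (λ {x} {y} → inverseˡ x y) , λ {x} {y} → inverseʳ x y
    }
    where
    module I = Inverse I
    to : Σ (Fin (suc n)) P → Fin m
    to (zero  , p) = ⊥-elim (¬p₀ p)
    to (suc i , p) = I.to (i , p)
    to-cong : ∀ i j → proj₁ i ≡ proj₁ j → to i ≡ to j
    to-cong (zero  , p) _           _  = ⊥-elim (¬p₀ p)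
    to-cong (suc i , p) (suc j , q) eq = I.to-cong (Fin.suc-injective eq)
    inverseˡ : ∀ k y → proj₁ y ≡ suc (proj₁ (I.from k)) → to y ≡ k
    inverseˡ k (suc j , p) eq = I.inverseˡ (Fin.suc-injective eq)
    inverseʳ : ∀ x y → y ≡ to x → suc (proj₁ (I.from y)) ≡ proj₁ x
    inverseʳ (zero  , p) _ _      = ⊥-elim (¬p₀ p)
    inverseʳ (suc i , p) _ ≡.refl = ≡.cong suc (I.inverseʳ ≡.refl)

-- The rings of real and complex numbers.

open import Defs
open import Relation.Binary.PropositionalEquality using (refl; sym; trans; cong; cong₂; subst; setoid)

<⇒≱ℚ : ∀ {p q} → p ℚ.< q → ¬ q ℚ.≤ p
<⇒≱ℚ p<q q≤p = ℚ.<-irrefl refl (ℚ.<-≤-trans p<q q≤p)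

p≤p+q : ∀ p {q} → 0ℚ ℚ.≤ q → p ℚ.≤ p ℚ.+ q
p≤p+q p {q} 0≤q = subst (ℚ._≤ p ℚ.+ q) (ℚ.+-identityʳ p) (ℚ.+-monoʳ-≤ p 0≤q)

0<p*q : ∀ {p q} → 0ℚ ℚ.< p → 0ℚ ℚ.< q → 0ℚ ℚ.< p ℚ.* q
0<p*q {p} {q} 0<p 0<q = ℚ.positive⁻¹ (p ℚ.* q) {{ℚ.pos*pos⇒pos p {{ℚ.positive 0<p}} q {{ℚ.positive 0<q}}}}

pointwise : ∀ {x y} → (∀ n → seq x n ≡ seq y n) → x ≈ℝ y
pointwise {x} {y} x≡y = mk≈ℝ λ ε 0<ε → 0 , λ n _ →
  subst (ℚ._< ε) (sym (trans (cong (dist (seq x n)) (sym (x≡y n))) (dist-refl (seq x n)))) 0<ε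

+ℝ-cong : ∀ {x x′ y y′} → x ≈ℝ x′ → y ≈ℝ y′ → x +ℝ y ≈ℝ x′ +ℝ y′
+ℝ-cong {x} {x′} {y} {y′} x≈ y≈ = mk≈ℝ λ ε 0<ε →
  let K , p = close x≈ _ (half-pos 0<ε)
      L , q = close y≈ _ (half-pos 0<ε)
  in K ℕ.⊔ L , λ n M≤n → ℚ.≤-<-trans (dist-+ (seq x n) (seq y n) (seq x′ n) (seq y′ n))
       (subst (_ ℚ.<_) (halves ε) (ℚ.+-mono-< (p n (ℕ.m⊔n≤o⇒m≤o K L M≤n)) (q n (ℕ.m⊔n≤o⇒n≤o K L M≤n))))

-ℝ-cong : ∀ {x y} → x ≈ℝ y → -ℝ x ≈ℝ -ℝ y
-ℝ-cong {x} {y} x≈y = mk≈ℝ λ ε 0<ε → let K , p = close x≈y ε 0<ε in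
  K , λ n K≤n → subst (ℚ._< ε) (sym (dist-neg (seq x n) (seq y n))) (p n K≤n)

*ℝ-cong : ∀ {x x′ y y′} → x ≈ℝ x′ → y ≈ℝ y′ → x *ℝ y ≈ℝ x′ *ℝ y′
*ℝ-cong {x} {x′} {y} {y′} x≈ y≈ = mk≈ℝ λ ε 0<ε →
  let K , B , 0<B , xB = bounded x′
      L , C , 0<C , yC = bounded y
      δ , 0<δ , δB     = divide (half-pos 0<ε) 0<B
      η , 0<η , ηC     = divide (half-pos 0<ε) 0<C
      K′ , p           = close x≈ η 0<η
      L′ , q           = close y≈ δ 0<δ
      M₁ = K ℕ.⊔ L
      M₂ = K′ ℕ.⊔ L′
  in M₁ ℕ.⊔ M₂ , λ n M≤n →
    let M₁≤n = ℕ.m⊔n≤o⇒m≤o M₁ M₂ M≤n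
        M₂≤n = ℕ.m⊔n≤o⇒n≤o M₁ M₂ M≤n
    in dist-*-< {δ} {η} {B} {C} {ε} (seq x n) (seq y n) (seq x′ n) (seq y′ n)
         (p n (ℕ.m⊔n≤o⇒m≤o K′ L′ M₂≤n)) (yC n (ℕ.m⊔n≤o⇒n≤o K L M₁≤n)) 0<C ηC
         (q n (ℕ.m⊔n≤o⇒n≤o K′ L′ M₂≤n)) (xB n (ℕ.m⊔n≤o⇒m≤o K L M₁≤n)) 0<B δB

ℝ-setoid : Setoid 0ℓ 0ℓ
ℝ-setoid = record
  { Carrier = ℝ
  ; _≈_ = _≈ℝ_
  ; isEquivalence = record { refl = ≈ℝ-refl ; sym = ≈ℝ-sym ; trans = ≈ℝ-trans }
  }

+ℝ-identityʳ : ∀ x → x +ℝ 0ℝ ≈ℝ x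
+ℝ-identityʳ x = pointwise λ n → ℚ.+-identityʳ (seq x n)

+ℝ-assoc : ∀ x y z → (x +ℝ y) +ℝ z ≈ℝ x +ℝ (y +ℝ z)
+ℝ-assoc x y z = pointwise λ n → ℚ.+-assoc (seq x n) (seq y n) (seq z n)

+ℝ-comm : ∀ x y → x +ℝ y ≈ℝ y +ℝ x
+ℝ-comm x y = pointwise λ n → ℚ.+-comm (seq x n) (seq y n)

+ℝ-identityˡ : ∀ x → 0ℝ +ℝ x ≈ℝ x
+ℝ-identityˡ x = pointwise λ n → ℚ.+-identityˡ (seq x n)

+ℝ-inverseˡ : ∀ x → (-ℝ x) +ℝ x ≈ℝ 0ℝ
+ℝ-inverseˡ x = pointwise λ n → ℚ.+-inverseˡ (seq x n)

*ℝ-identityʳ : ∀ x → x *ℝ 1ℝ ≈ℝ x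
*ℝ-identityʳ x = pointwise λ n → ℚ.*-identityʳ (seq x n)

+ℝ-inverseʳ : ∀ x → x +ℝ (-ℝ x) ≈ℝ 0ℝ
+ℝ-inverseʳ x = pointwise λ n → ℚ.+-inverseʳ (seq x n)

*ℝ-distribʳ-+ℝ : ∀ x y z → (y +ℝ z) *ℝ x ≈ℝ (y *ℝ x) +ℝ (z *ℝ x)
*ℝ-distribʳ-+ℝ x y z = pointwise λ n → ℚ.*-distribʳ-+ (seq x n) (seq y n) (seq z n)

*ℝ-assoc : ∀ x y z → (x *ℝ y) *ℝ z ≈ℝ x *ℝ (y *ℝ z)
*ℝ-assoc x y z = pointwise λ n → ℚ.*-assoc (seq x n) (seq y n) (seq z n)

*ℝ-comm : ∀ x y → x *ℝ y ≈ℝ y *ℝ x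
*ℝ-comm x y = pointwise λ n → ℚ.*-comm (seq x n) (seq y n)

*ℝ-identityˡ : ∀ x → 1ℝ *ℝ x ≈ℝ x
*ℝ-identityˡ x = pointwise λ n → ℚ.*-identityˡ (seq x n)

*ℝ-distribˡ-+ℝ : ∀ x y z → x *ℝ (y +ℝ z) ≈ℝ (x *ℝ y) +ℝ (x *ℝ z)
*ℝ-distribˡ-+ℝ x y z = pointwise λ n → ℚ.*-distribˡ-+ (seq x n) (seq y n) (seq z n)

opaque
  ℝ-isCommutativeRing : IsCommutativeRing _≈ℝ_ _+ℝ_ _*ℝ_ -ℝ_ 0ℝ 1ℝ
  ℝ-isCommutativeRing = record
    { isRing = record
      { +-isAbelianGroup = record
        { isGroup = record
          { isMonoid = record
            { isSemigroup = record
              { isMagma = record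
                { isEquivalence = Setoid.isEquivalence ℝ-setoid
                ; ∙-cong        = λ p q → mk≈ℝ (close (+ℝ-cong p q))
                }
              ; assoc = +ℝ-assoc
              }
            ; identity = +ℝ-identityˡ , +ℝ-identityʳ
            }
          ; inverse = +ℝ-inverseˡ , +ℝ-inverseʳ
          ; ⁻¹-cong = λ p → mk≈ℝ (close (-ℝ-cong p))
          }
        ; comm = +ℝ-comm
        }
      ; *-cong     = λ p q → mk≈ℝ (close (*ℝ-cong p q))
      ; *-assoc    = *ℝ-assoc
      ; *-identity = *ℝ-identityˡ , *ℝ-identityʳ
      ; distrib    = *ℝ-distribˡ-+ℝ , *ℝ-distribʳ-+ℝ
      }
    ; *-comm = *ℝ-comm
    }

ℝ-commutativeRing : CommutativeRing 0ℓ 0ℓ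
ℝ-commutativeRing = record { isCommutativeRing = ℝ-isCommutativeRing }

opaque
  ℂ-isCommutativeRing : IsCommutativeRing _≈_ _+ℂ_ _*ℂ_ -ℂ_ 0ℂ 1ℂ
  ℂ-isCommutativeRing = record
    { isRing = record
      { +-isAbelianGroup = record
        { isGroup = record
          { isMonoid = record
            { isSemigroup = record
              { isMagma = record
                { isEquivalence = Setoid.isEquivalence ℂ-setoid
                ; ∙-cong = λ (p ≈, q) (r ≈, s) → mk≈ℝ (close (+ℝ-cong p r)) ≈, mk≈ℝ (close (+ℝ-cong q s))
                }
              ; assoc = λ z w v → mk≈ℝ (close (R.+-assoc (re z) (re w) (re v))) ≈, mk≈ℝ (close (R.+-assoc (im z) (im w) (im v)))
              }
            ; identity = (λ z → mk≈ℝ (close (R.+-identityˡ (re z))) ≈, mk≈ℝ (close (R.+-identityˡ (im z)))) , (λ z → mk≈ℝ (close (R.+-identityʳ (re z))) ≈, mk≈ℝ (close (R.+-identityʳ (im z))))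
            }
          ; inverse = (λ z → mk≈ℝ (close (R.-‿inverseˡ (re z))) ≈, mk≈ℝ (close (R.-‿inverseˡ (im z)))) , (λ z → mk≈ℝ (close (R.-‿inverseʳ (re z))) ≈, mk≈ℝ (close (R.-‿inverseʳ (im z))))
          ; ⁻¹-cong = λ (p ≈, q) → mk≈ℝ (close (-ℝ-cong p)) ≈, mk≈ℝ (close (-ℝ-cong q))
          }
        ; comm = λ z w → mk≈ℝ (close (R.+-comm (re z) (re w))) ≈, mk≈ℝ (close (R.+-comm (im z) (im w)))
        }
      ; *-cong = λ (p ≈, q) (r ≈, s) →
          mk≈ℝ (close (+ℝ-cong (*ℝ-cong p r) (-ℝ-cong (*ℝ-cong q s)))) ≈,
          mk≈ℝ (close (+ℝ-cong (*ℝ-cong p s) (*ℝ-cong q r)))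
      ; *-assoc = λ z w v → mk≈ℝ (close (I.assoc-re (re z) (im z) (re w) (im w) (re v) (im v)))
                         ≈, mk≈ℝ (close (I.assoc-im (re z) (im z) (re w) (im w) (re v) (im v)))
      ; *-identity = (λ z → mk≈ℝ (close (I.identity-re (re z) (im z))) ≈, mk≈ℝ (close (I.identity-im (re z) (im z))))
                   , (λ z → mk≈ℝ (close (I.identityʳ-re (re z) (im z))) ≈, mk≈ℝ (close (I.identityʳ-im (re z) (im z))))
      ; distrib = (λ z w v → mk≈ℝ (close (I.distrib-re (re z) (im z) (re w) (im w) (re v) (im v)))
                          ≈, mk≈ℝ (close (I.distrib-im (re z) (im z) (re w) (im w) (re v) (im v))))
                , (λ z w v → mk≈ℝ (close (I.distribʳ-re (re z) (im z) (re w) (im w) (re v) (im v)))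
                          ≈, mk≈ℝ (close (I.distribʳ-im (re z) (im z) (re w) (im w) (re v) (im v))))
      }
    ; *-comm = λ z w → mk≈ℝ (close (I.comm-re (re z) (im z) (re w) (im w))) ≈, mk≈ℝ (close (I.comm-im (re z) (im z) (re w) (im w)))
    }
    where
    module R = CommutativeRing ℝ-commutativeRing
    module I = GaussianIdentities ℝ-commutativeRing

-- Absence of zero divisors in the real and complex numbers.

Eventually : (ℕ → Set) → Set
Eventually P = ∃ λ K → ∀ n → K ℕ.≤ n → P n

eventually₂ : ∀ {P Q R : ℕ → Set} → (∀ n → P n → Q n → R n) → Eventually P → Eventually Q → Eventually R
eventually₂ f (K , p) (L , q) = K ℕ.⊔ L , λ n M≤n →
  f n (p n (ℕ.m⊔n≤o⇒m≤o K L M≤n)) (q n (ℕ.m⊔n≤o⇒n≤o K L M≤n))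

dist-0 : ∀ a → dist a 0ℚ ≡ ℚ.∣ a ∣
dist-0 a = cong ℚ.∣_∣ (ℚ.+-identityʳ a)

≈0⇒small : ∀ {x} → x ≈ℝ 0ℝ → ∀ ε → 0ℚ ℚ.< ε → Eventually (λ n → ℚ.∣ seq x n ∣ ℚ.< ε)
≈0⇒small {x} x≈0 ε 0<ε = let K , p = close x≈0 ε 0<ε in
  K , λ n K≤n → subst (ℚ._< ε) (dist-0 (seq x n)) (p n K≤n)

small⇒≈0 : ∀ {x} → (∀ ε → 0ℚ ℚ.< ε → Eventually (λ n → ℚ.∣ seq x n ∣ ℚ.< ε)) → x ≈ℝ 0ℝ
small⇒≈0 {x} small = mk≈ℝ λ ε 0<ε → let K , p = small ε 0<ε in
  K , λ n K≤n → subst (ℚ._< ε) (sym (dist-0 (seq x n))) (p n K≤n)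

-- Positive separation from zero, with a rational witness; `¬ x ≈ℝ 0ℝ` by itself supplies no such
-- bound.
Away : ℝ → Set
Away x = ∃ λ δ → 0ℚ ℚ.< δ × Eventually (λ n → δ ℚ.≤ ℚ.∣ seq x n ∣)

away⇒≉0 : ∀ {x} → Away x → ¬ x ≈ℝ 0ℝ
away⇒≉0 (δ , 0<δ , K , p) x≈0 = let L , q = ≈0⇒small x≈0 δ 0<δ in
  <⇒≱ℚ (q (K ℕ.⊔ L) (ℕ.m≤n⊔m K L)) (p (K ℕ.⊔ L) (ℕ.m≤m⊔n K L))

-- The decidable substitute for x ≈ 0 or not: one term known up to ε/4 is compared with ε/2. Both
-- outcomes may be correct, but at least one can always be found.
small⊎away : ∀ x ε → 0ℚ ℚ.< ε → Eventually (λ n → ℚ.∣ seq x n ∣ ℚ.≤ ε) ⊎ Away x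
small⊎away x ε 0<ε with cauchy x f (half-pos (half-pos 0<ε))
  where f = ½ ℚ.* (½ ℚ.* ε)
... | K , p = decide (ℚ.≤-total ℚ.∣ a ∣ e)
  where
  a = seq x K
  e = ½ ℚ.* ε
  f = ½ ℚ.* e
  0≤f : 0ℚ ℚ.≤ f
  0≤f = ℚ.<⇒≤ (half-pos (half-pos 0<ε))
  f≤e : f ℚ.≤ e
  f≤e = subst (f ℚ.≤_) (halves e) (p≤p+q f 0≤f)
  open ℚ.≤-Reasoning
  decide : ℚ.∣ a ∣ ℚ.≤ e ⊎ e ℚ.≤ ℚ.∣ a ∣ → Eventually (λ n → ℚ.∣ seq x n ∣ ℚ.≤ ε) ⊎ Away x
  decide (inj₁ a≤e) = inj₁ (K , λ n K≤n → begin
    ℚ.∣ seq x n ∣  ≡⟨ dist-0 (seq x n) ⟨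
    dist (seq x n) 0ℚ  ≤⟨ dist-triangle (seq x n) a 0ℚ ⟩
    dist (seq x n) a ℚ.+ dist a 0ℚ  ≡⟨ cong (dist (seq x n) a ℚ.+_) (dist-0 a) ⟩
    dist (seq x n) a ℚ.+ ℚ.∣ a ∣  ≤⟨ ℚ.+-mono-≤ (ℚ.≤-trans (ℚ.<⇒≤ (p n K K≤n ℕ.≤-refl)) f≤e) a≤e ⟩
    e ℚ.+ e  ≡⟨ halves ε ⟩
    ε  ∎)
  decide (inj₂ e≤a) = inj₂ (f , half-pos (half-pos 0<ε) , K , λ n K≤n → ℚ.≮⇒≥ λ xₙ<f → <⇒≱ℚ (begin-strict
    ℚ.∣ a ∣  ≡⟨ dist-0 a ⟨
    dist a 0ℚ  ≤⟨ dist-triangle a (seq x n) 0ℚ ⟩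
    dist a (seq x n) ℚ.+ dist (seq x n) 0ℚ  ≡⟨ cong (dist a (seq x n) ℚ.+_) (dist-0 (seq x n)) ⟩
    dist a (seq x n) ℚ.+ ℚ.∣ seq x n ∣  <⟨ ℚ.+-mono-< (p K n ℕ.≤-refl K≤n) xₙ<f ⟩
    f ℚ.+ f  ≡⟨ halves e ⟩
    e  ∎) e≤a)

-- A bare negation suffices for x because, at each ε, either y is small as wanted or y is away from
-- zero. In the second case x would be zero, which is refuted.
*ℝ-cancel-0 : ∀ {x y} → x *ℝ y ≈ℝ 0ℝ → ¬ x ≈ℝ 0ℝ → y ≈ℝ 0ℝ
*ℝ-cancel-0 {x} {y} xy≈0 x≉0 = small⇒≈0 λ ε 0<ε → decide ε 0<ε (small⊎away y (½ ℚ.* ε) (half-pos 0<ε))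
  where
  open ℚ.≤-Reasoning
  away : Away y → x ≈ℝ 0ℝ
  away (δ , 0<δ , y≥δ) = small⇒≈0 λ ε 0<ε →
    eventually₂ (λ n δ≤y xy<εδ → ℚ.≰⇒> λ ε≤x → <⇒≱ℚ xy<εδ (begin
        ε ℚ.* δ  ≤⟨ ℚ.*-monoʳ-≤-nonNeg δ {{ℚ.nonNegative (ℚ.<⇒≤ 0<δ)}} ε≤x ⟩
        ℚ.∣ seq x n ∣ ℚ.* δ  ≤⟨ ℚ.*-monoˡ-≤-nonNeg ℚ.∣ seq x n ∣ {{ℚ.nonNegative (ℚ.0≤∣p∣ (seq x n))}} δ≤y ⟩
        ℚ.∣ seq x n ∣ ℚ.* ℚ.∣ seq y n ∣  ≡⟨ ℚ.∣p*q∣≡∣p∣*∣q∣ (seq x n) (seq y n) ⟨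
        ℚ.∣ seq x n ℚ.* seq y n ∣  ∎))
      y≥δ (≈0⇒small xy≈0 (ε ℚ.* δ) (0<p*q 0<ε 0<δ))
  decide : ∀ ε → 0ℚ ℚ.< ε → Eventually (λ n → ℚ.∣ seq y n ∣ ℚ.≤ ½ ℚ.* ε) ⊎ Away y →
           Eventually (λ n → ℚ.∣ seq y n ∣ ℚ.< ε)
  decide ε 0<ε (inj₁ (K , p)) = K , λ n K≤n → ℚ.≤-<-trans (p n K≤n)
    (subst (½ ℚ.* ε ℚ.<_) (halves ε) (subst (ℚ._< ½ ℚ.* ε ℚ.+ ½ ℚ.* ε) (ℚ.+-identityʳ (½ ℚ.* ε)) (ℚ.+-monoʳ-< (½ ℚ.* ε) (half-pos 0<ε))))
  decide ε 0<ε (inj₂ y-away) = ⊥-elim (x≉0 (away y-away))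

0≤p*p : ∀ p → 0ℚ ℚ.≤ p ℚ.* p
0≤p*p p = subst (0ℚ ℚ.≤_) ∣p∣∣p∣≡pp (ℚ.nonNegative⁻¹ _ {{ℚ.nonNeg*nonNeg⇒nonNeg ℚ.∣ p ∣ {{n}} ℚ.∣ p ∣ {{n}}}})
  where
  n = ℚ.nonNegative (ℚ.0≤∣p∣ p)
  ∣p∣∣p∣≡pp : ℚ.∣ p ∣ ℚ.* ℚ.∣ p ∣ ≡ p ℚ.* p
  ∣p∣∣p∣≡pp with ℚ.∣p∣≡p∨∣p∣≡-p p
  ... | inj₁ eq = cong₂ ℚ._*_ eq eq
  ... | inj₂ eq = trans (cong₂ ℚ._*_ eq eq) (solve 1 (λ p → (:- p) :* (:- p) := p :* p) refl p)
    where open +-*-Solver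

squares-0 : ∀ {x y} → x *ℝ x +ℝ y *ℝ y ≈ℝ 0ℝ → x ≈ℝ 0ℝ
squares-0 {x} {y} eq = small⇒≈0 λ ε 0<ε →
  let K , p = ≈0⇒small eq (ε ℚ.* ε) (0<p*q 0<ε 0<ε)
  in K , λ n K≤n → ℚ.≰⇒> λ ε≤x → <⇒≱ℚ (p n K≤n) (let a = seq x n; b = seq y n in begin
    ε ℚ.* ε  ≤⟨ ℚ.*-monoʳ-≤-nonNeg ε {{ℚ.nonNegative (ℚ.<⇒≤ 0<ε)}} ε≤x ⟩
    ℚ.∣ a ∣ ℚ.* ε  ≤⟨ ℚ.*-monoˡ-≤-nonNeg ℚ.∣ a ∣ {{ℚ.nonNegative (ℚ.0≤∣p∣ a)}} ε≤x ⟩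
    ℚ.∣ a ∣ ℚ.* ℚ.∣ a ∣  ≡⟨ ℚ.∣p*q∣≡∣p∣*∣q∣ a a ⟨
    ℚ.∣ a ℚ.* a ∣  ≡⟨ ℚ.0≤p⇒∣p∣≡p (0≤p*p a) ⟩
    a ℚ.* a  ≤⟨ p≤p+q (a ℚ.* a) (0≤p*p b) ⟩
    a ℚ.* a ℚ.+ b ℚ.* b  ≡⟨ ℚ.0≤p⇒∣p∣≡p (ℚ.≤-trans (0≤p*p a) (p≤p+q (a ℚ.* a) (0≤p*p b))) ⟨
    ℚ.∣ a ℚ.* a ℚ.+ b ℚ.* b ∣  ∎)
  where open ℚ.≤-Reasoning

0+0≈0 : ∀ {x y} → x ≈ℝ 0ℝ → y ≈ℝ 0ℝ → x +ℝ y ≈ℝ 0ℝ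
0+0≈0 {x} {y} x≈0 y≈0 = ≈ℝ-trans {x +ℝ y} {0ℝ +ℝ 0ℝ} {0ℝ}
  (mk≈ℝ (close (+ℝ-cong x≈0 y≈0))) (pointwise λ _ → refl)

*0≈0 : ∀ x {y} → y ≈ℝ 0ℝ → x *ℝ y ≈ℝ 0ℝ
*0≈0 x {y} y≈0 = ≈ℝ-trans {x *ℝ y} {x *ℝ 0ℝ} {0ℝ}
  (mk≈ℝ (close (*ℝ-cong {x} {x} ≈ℝ-refl y≈0))) (pointwise λ n → ℚ.*-zeroʳ (seq x n))

opaque
  -- Multiplying zw by the conjugate of z gives |z|² w, which reduces both coordinates of w to real
  -- cancellation.
  *ℂ-cancel-0 : ∀ z w → z *ℂ w ≈ 0ℂ → ¬ z ≈ 0ℂ → w ≈ 0ℂ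
  *ℂ-cancel-0 (a +i b) (c +i d) (re≈0 ≈, im≈0) z≉0 =
    *ℝ-cancel-0 {norm} {c} norm*c≈0 norm≉0 ≈, *ℝ-cancel-0 {norm} {d} norm*d≈0 norm≉0
    where
    open GaussianIdentities ℝ-commutativeRing using (norm-re; norm-im)
    norm r s : ℝ
    norm = a *ℝ a +ℝ b *ℝ b
    r = a *ℝ c +ℝ (-ℝ (b *ℝ d))
    s = a *ℝ d +ℝ b *ℝ c
    r≈0 : r ≈ℝ 0ℝ
    r≈0 = mk≈ℝ (close re≈0)
    s≈0 : s ≈ℝ 0ℝ
    s≈0 = mk≈ℝ (close im≈0)
    norm*c≈0 : norm *ℝ c ≈ℝ 0ℝ
    norm*c≈0 = ≈ℝ-trans {norm *ℝ c} {a *ℝ r +ℝ b *ℝ s} {0ℝ} (mk≈ℝ (close (norm-re a b c d)))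
      (0+0≈0 {a *ℝ r} {b *ℝ s} (*0≈0 a {r} r≈0) (*0≈0 b {s} s≈0))
    norm*d≈0 : norm *ℝ d ≈ℝ 0ℝ
    norm*d≈0 = ≈ℝ-trans {norm *ℝ d} {a *ℝ s +ℝ (-ℝ b) *ℝ r} {0ℝ} (mk≈ℝ (close (norm-im a b c d)))
      (0+0≈0 {a *ℝ s} {(-ℝ b) *ℝ r} (*0≈0 a {s} s≈0) (*0≈0 (-ℝ b) {r} r≈0))
    norm≉0 : ¬ norm ≈ℝ 0ℝ
    norm≉0 eq = z≉0 (squares-0 {a} {b} eq ≈, squares-0 {b} {a}
      (≈ℝ-trans {b *ℝ b +ℝ a *ℝ a} {norm} {0ℝ} (+ℝ-comm (b *ℝ b) (a *ℝ a)) eq))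

-- Opaque copies of the operations: unfolding the originals would make
-- conversion checking compare proofs of the Cauchy property.
infixl 6 _⊕_
infixl 7 _⊗_
infix  8 ⊖_

opaque
  _⊕_ _⊗_ : ℂ → ℂ → ℂ
  _⊕_ = _+ℂ_
  _⊗_ = _*ℂ_

  ⊖_ : ℂ → ℂ
  ⊖_ = -ℂ_

  𝟘 𝟙 : ℂ
  𝟘 = 0ℂ
  𝟙 = 1ℂ

  ⊕≡+ℂ : ∀ z w → z ⊕ w ≡ z +ℂ w
  ⊕≡+ℂ z w = refl

  ⊗≡*ℂ : ∀ z w → z ⊗ w ≡ z *ℂ w
  ⊗≡*ℂ z w = refl

  𝟘≡0ℂ : 𝟘 ≡ 0ℂ
  𝟘≡0ℂ = refl

  𝟙≡1ℂ : 𝟙 ≡ 1ℂ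
  𝟙≡1ℂ = refl

  ⊕-⊗-isCommutativeRing : IsCommutativeRing _≈_ _⊕_ _⊗_ ⊖_ 𝟘 𝟙
  ⊕-⊗-isCommutativeRing = ℂ-isCommutativeRing

  ⊗-noZeroDivisors : ∀ z w → z ⊗ w ≈ 𝟘 → ¬ z ≈ 𝟘 → w ≈ 𝟘
  ⊗-noZeroDivisors = *ℂ-cancel-0

ℂ-commutativeRing : CommutativeRing 0ℓ 0ℓ
ℂ-commutativeRing = record { isCommutativeRing = ⊕-⊗-isCommutativeRing }

module ℂ-Ring where
  open CommutativeRing ℂ-commutativeRing public hiding (zero)
  open Algebra.Properties.Semiring.Mult semiring public using (_×_)
  open Algebra.Properties.Ring ring public using (x≈y⇒x∙y⁻¹≈ε; x∙y⁻¹≈ε⇒x≈y)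

≥1⇒≉0 : ∀ x → (∀ k → 1ℚ ℚ.≤ seq x k) → ¬ x ≈ℝ 0ℝ
≥1⇒≉0 x 1≤x = away⇒≉0 {x} (1ℚ , 0<1 , 0 , λ k _ →
  subst (1ℚ ℚ.≤_) (sym (ℚ.0≤p⇒∣p∣≡p (ℚ.≤-trans (ℚ.<⇒≤ 0<1) (1≤x k)))) (1≤x k))

opaque
  unfolding _⊕_

  0≤re-× : ∀ n k → 0ℚ ℚ.≤ seq (re (n ℂ-Ring.× 𝟙)) k
  0≤re-× zero    k = ℚ.≤-refl
  0≤re-× (suc n) k = ℚ.≤-trans (ℚ.<⇒≤ 0<1) (p≤p+q 1ℚ (0≤re-× n k))

  1≤re-× : ∀ n k → 1ℚ ℚ.≤ seq (re (suc n ℂ-Ring.× 𝟙)) k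
  1≤re-× n k = p≤p+q 1ℚ (0≤re-× n k)

  re-≈0 : ∀ z → z ≈ 𝟘 → re z ≈ℝ 0ℝ
  re-≈0 z = re-≈

  im-≈0 : ∀ z → z ≈ 𝟘 → im z ≈ℝ 0ℝ
  im-≈0 z = im-≈

ℂ-charZero : ∀ n → n ℂ-Ring.× 𝟙 ≈ 𝟘 → n ≡ 0
ℂ-charZero zero    _  = refl
ℂ-charZero (suc n) eq = ⊥-elim (≥1⇒≉0 (re (suc n ℂ-Ring.× 𝟙)) (1≤re-× n) (re-≈0 _ eq))

ℂ-domain : CharZeroDomain
ℂ-domain = record
  { commutativeRing = ℂ-commutativeRing
  ; noZeroDivisors  = ⊗-noZeroDivisors
  ; ×-charZero      = ℂ-charZero
  }

-- Deciding whether a root of unity equals 1.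

module RootsNearOne where

  open Subrings ℂ-domain using (_^_)
  open Polynomials ℂ-domain using (secondOrder; isolated-root)

  -- Bounds are kept on the two coordinates instead of the modulus, so no square root occurs; the
  -- price is a factor 2 in products.
  Bounded : ℂ → ℚ → Set
  Bounded z q = Eventually (λ n → ℚ.∣ seq (re z) n ∣ ℚ.≤ q × ℚ.∣ seq (im z) n ∣ ℚ.≤ q)

  ∣+∣≤ : ∀ {a b q r} → ℚ.∣ a ∣ ℚ.≤ q → ℚ.∣ b ∣ ℚ.≤ r → ℚ.∣ a ℚ.+ b ∣ ℚ.≤ q ℚ.+ r
  ∣+∣≤ {a} {b} a≤ b≤ = ℚ.≤-trans (ℚ.∣p+q∣≤∣p∣+∣q∣ a b) (ℚ.+-mono-≤ a≤ b≤)

  ∣*∣≤ : ∀ {a b q r} → 0ℚ ℚ.≤ q → ℚ.∣ a ∣ ℚ.≤ q → ℚ.∣ b ∣ ℚ.≤ r → ℚ.∣ a ℚ.* b ∣ ℚ.≤ q ℚ.* r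
  ∣*∣≤ {a} {b} {q} {r} 0≤q a≤ b≤ = begin
    ℚ.∣ a ℚ.* b ∣  ≡⟨ ℚ.∣p*q∣≡∣p∣*∣q∣ a b ⟩
    ℚ.∣ a ∣ ℚ.* ℚ.∣ b ∣  ≤⟨ ℚ.*-monoʳ-≤-nonNeg ℚ.∣ b ∣ {{ℚ.nonNegative (ℚ.0≤∣p∣ b)}} a≤ ⟩
    q ℚ.* ℚ.∣ b ∣  ≤⟨ ℚ.*-monoˡ-≤-nonNeg q {{ℚ.nonNegative 0≤q}} b≤ ⟩
    q ℚ.* r  ∎
    where open ℚ.≤-Reasoning

  bounded-mono : ∀ {z q r} → q ℚ.≤ r → Bounded z q → Bounded z r
  bounded-mono q≤r (K , p) = K , λ n K≤n → ℚ.≤-trans (proj₁ (p n K≤n)) q≤r , ℚ.≤-trans (proj₂ (p n K≤n)) q≤r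

  nℚ : ℕ → ℚ
  nℚ zero    = 0ℚ
  nℚ (suc n) = 1ℚ ℚ.+ nℚ n

  opaque
    unfolding _⊕_

    bounded-⊕ : ∀ z w {q r} → Bounded z q → Bounded w r → Bounded (z ⊕ w) (q ℚ.+ r)
    bounded-⊕ z w = eventually₂ λ n (a≤ , b≤) (c≤ , d≤) → ∣+∣≤ a≤ c≤ , ∣+∣≤ b≤ d≤

    bounded-⊗ : ∀ z w {q r} → 0ℚ ℚ.≤ q → Bounded z q → Bounded w r → Bounded (z ⊗ w) (q ℚ.* r ℚ.+ q ℚ.* r)
    bounded-⊗ z w {q} {r} 0≤q = eventually₂ λ n (a≤ , b≤) (c≤ , d≤) →
      ∣+∣≤ (∣*∣≤ 0≤q a≤ c≤)
        (subst (ℚ._≤ q ℚ.* r) (sym (ℚ.∣-p∣≡∣p∣ (seq (im z) n ℚ.* seq (im w) n))) (∣*∣≤ 0≤q b≤ d≤)) ,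
      ∣+∣≤ (∣*∣≤ 0≤q a≤ d≤) (∣*∣≤ 0≤q b≤ c≤)

    bounded-𝟘 : Bounded 𝟘 0ℚ
    bounded-𝟘 = 0 , λ _ _ → ℚ.≤-refl , ℚ.≤-refl

    bounded-𝟙 : Bounded 𝟙 1ℚ
    bounded-𝟙 = 0 , λ _ _ → ℚ.≤-refl , ℚ.<⇒≤ 0<1

  bounded-× : ∀ n → Bounded (n ℂ-Ring.× 𝟙) (nℚ n)
  bounded-× zero    = bounded-𝟘
  bounded-× (suc n) = bounded-⊕ 𝟙 (n ℂ-Ring.× 𝟙) bounded-𝟙 (bounded-× n)

  -- Follows the recursion of `secondOrder` for h with coordinates at most 1: then 1 + h has
  -- coordinates at most 2, and a product of complex numbers doubles the product of the bounds.
  bound : ℕ → ℚ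
  bound zero    = 0ℚ
  bound (suc n) = ((1ℚ ℚ.+ 1ℚ) ℚ.* bound n ℚ.+ (1ℚ ℚ.+ 1ℚ) ℚ.* bound n) ℚ.+ nℚ n

  0≤nℚ : ∀ n → 0ℚ ℚ.≤ nℚ n
  0≤nℚ zero    = ℚ.≤-refl
  0≤nℚ (suc n) = ℚ.+-mono-≤ (ℚ.<⇒≤ 0<1) (0≤nℚ n)

  0≤2 : 0ℚ ℚ.≤ 1ℚ ℚ.+ 1ℚ
  0≤2 = ℚ.+-mono-≤ (ℚ.<⇒≤ 0<1) (ℚ.<⇒≤ 0<1)

  0≤* : ∀ {p q} → 0ℚ ℚ.≤ p → 0ℚ ℚ.≤ q → 0ℚ ℚ.≤ p ℚ.* q
  0≤* {p} {q} 0≤p 0≤q = ℚ.nonNegative⁻¹ (p ℚ.* q)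
    {{ℚ.nonNeg*nonNeg⇒nonNeg p {{ℚ.nonNegative 0≤p}} q {{ℚ.nonNegative 0≤q}}}}

  0≤bound : ∀ n → 0ℚ ℚ.≤ bound n
  0≤bound zero    = ℚ.≤-refl
  0≤bound (suc n) = ℚ.+-mono-≤ (ℚ.+-mono-≤ (0≤* 0≤2 (0≤bound n)) (0≤* 0≤2 (0≤bound n))) (0≤nℚ n)

  bounded-secondOrder : ∀ n {h} → Bounded h 1ℚ → Bounded (secondOrder n h) (bound n)
  bounded-secondOrder zero    h≤ = bounded-𝟘
  bounded-secondOrder (suc n) {h} h≤ =
    bounded-⊕ ((𝟙 ⊕ h) ⊗ secondOrder n h) (n ℂ-Ring.× 𝟙)
      (bounded-⊗ (𝟙 ⊕ h) (secondOrder n h) 0≤2 (bounded-⊕ 𝟙 h bounded-𝟙 h≤) (bounded-secondOrder n {h} h≤))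
      (bounded-× n)

  ½≤∣a+b∣ : ∀ {a b} → 1ℚ ℚ.≤ a → ℚ.∣ b ∣ ℚ.≤ ½ → ½ ℚ.≤ ℚ.∣ a ℚ.+ b ∣
  ½≤∣a+b∣ {a} {b} 1≤a b≤½ = ℚ.≮⇒≥ λ a+b<½ → <⇒≱ℚ (begin-strict
    a  ≡⟨ ℚ.0≤p⇒∣p∣≡p (ℚ.≤-trans (ℚ.<⇒≤ 0<1) 1≤a) ⟨
    ℚ.∣ a ∣  ≡⟨ cong ℚ.∣_∣ (solve 2 (λ a b → a := (a :+ b) :+ (:- b)) refl a b) ⟩
    ℚ.∣ (a ℚ.+ b) ℚ.+ ℚ.- b ∣  ≤⟨ ℚ.∣p+q∣≤∣p∣+∣q∣ (a ℚ.+ b) (ℚ.- b) ⟩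
    ℚ.∣ a ℚ.+ b ∣ ℚ.+ ℚ.∣ ℚ.- b ∣  <⟨ ℚ.+-mono-<-≤ a+b<½ (subst (ℚ._≤ ½) (sym (ℚ.∣-p∣≡∣p∣ b)) b≤½) ⟩
    ½ ℚ.+ ½  ≡⟨⟩
    1ℚ  ∎) 1≤a
    where
    open ℚ.≤-Reasoning
    open +-*-Solver

  opaque
    unfolding _⊕_

    n+small-away : ∀ n z → Bounded z ½ → Away (re (suc n ℂ-Ring.× 𝟙 ⊕ z))
    n+small-away n z (K , p) = ½ , ℚ.positive⁻¹ ½ , K , λ k K≤k → ½≤∣a+b∣ (1≤re-× n k) (proj₁ (p k K≤k))

  n+small≉0 : ∀ n z → Bounded z ½ → ¬ suc n ℂ-Ring.× 𝟙 ⊕ z ≈ 𝟘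
  n+small≉0 n z b eq = away⇒≉0 (n+small-away n z b) (re-≈0 _ eq)

  -- A root of unity close to 1 equals 1: n + h secondOrder n h is invertible.
  1? : ∀ n → 0 ℕ.< n → ∀ {w} → w ^ n ≈ 𝟙 → Dec (w ≈ 𝟙)
  1? (suc m) _ {w} wⁿ≈1 = decide (small⊎away (re h) δ 0<δ) (small⊎away (im h) δ 0<δ)
    where
    n = suc m
    h = w ⊕ ⊖ 𝟙
    -- Chosen to dominate both 1 and twice the bound of `secondOrder`, so that δ = ½ / B satisfies δ
    -- ≤ 1 and keeps h times `secondOrder n h` within ½ of zero in each coordinate.
    B = (bound n ℚ.+ bound n) ℚ.+ 1ℚ
    0≤2bound = ℚ.+-mono-≤ (0≤bound n) (0≤bound n)
    0<B : 0ℚ ℚ.< B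
    0<B = ℚ.+-mono-≤-< 0≤2bound 0<1
    δ-data = divide {½} {B} (ℚ.positive⁻¹ ½) 0<B
    δ = proj₁ δ-data
    0<δ : 0ℚ ℚ.< δ
    0<δ = proj₁ (proj₂ δ-data)
    δB≡½ : δ ℚ.* B ≡ ½
    δB≡½ = proj₂ (proj₂ δ-data)
    instance
      δ-nonNeg : ℚ.NonNegative δ
      δ-nonNeg = ℚ.nonNegative (ℚ.<⇒≤ 0<δ)
    open ℚ.≤-Reasoning
    δ≤1 : δ ℚ.≤ 1ℚ
    δ≤1 = begin
      δ  ≡⟨ ℚ.*-identityʳ δ ⟨
      δ ℚ.* 1ℚ  ≤⟨ ℚ.*-monoˡ-≤-nonNeg δ (subst (ℚ._≤ B) (ℚ.+-identityˡ 1ℚ) (ℚ.+-monoˡ-≤ 1ℚ 0≤2bound)) ⟩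
      δ ℚ.* B  ≡⟨ δB≡½ ⟩
      ½  ≤⟨ p≤p+q ½ (ℚ.<⇒≤ (ℚ.positive⁻¹ ½)) ⟩
      1ℚ  ∎
    2δb≤½ : δ ℚ.* bound n ℚ.+ δ ℚ.* bound n ℚ.≤ ½
    2δb≤½ = begin
      δ ℚ.* bound n ℚ.+ δ ℚ.* bound n  ≡⟨ ℚ.*-distribˡ-+ δ (bound n) (bound n) ⟨
      δ ℚ.* (bound n ℚ.+ bound n)  ≤⟨ ℚ.*-monoˡ-≤-nonNeg δ (p≤p+q (bound n ℚ.+ bound n) (ℚ.<⇒≤ 0<1)) ⟩
      δ ℚ.* B  ≡⟨ δB≡½ ⟩
      ½  ∎
    decide : Eventually (λ k → ℚ.∣ seq (re h) k ∣ ℚ.≤ δ) ⊎ Away (re h) →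
             Eventually (λ k → ℚ.∣ seq (im h) k ∣ ℚ.≤ δ) ⊎ Away (im h) → Dec (w ≈ 𝟙)
    decide (inj₂ away) _ = no λ w≈1 → away⇒≉0 away (re-≈0 h (ℂ-Ring.x≈y⇒x∙y⁻¹≈ε w≈1))
    decide _ (inj₂ away) = no λ w≈1 → away⇒≉0 away (im-≈0 h (ℂ-Ring.x≈y⇒x∙y⁻¹≈ε w≈1))
    decide (inj₁ re≤) (inj₁ im≤) = yes (isolated-root n wⁿ≈1 (n+small≉0 m (h ⊗ secondOrder n h)
      (bounded-mono {h ⊗ secondOrder n h} 2δb≤½ (bounded-⊗ h (secondOrder n h) (ℚ.<⇒≤ 0<δ) h≤δ
        (bounded-secondOrder n {h} (bounded-mono {h} δ≤1 h≤δ))))))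
      where
      h≤δ : Bounded h δ
      h≤δ = eventually₂ (λ _ → _,_) re≤ im≤

-- Partial Butson matrices with two rows and their multiplicities.

module ButsonMatrices where

  open RootsNearOne using (1?)

  module ℂD = CharZeroDomain ℂ-domain
  open Subrings ℂ-domain using (_^_; sum; 1^; sum-cong-≋)
  open Polynomials ℂ-domain using (IsPrimitive)
  open RootsOfUnity ℂ-domain using (roots-complete; roots-injective; roots-^; fromNat)

  module _ {A : Set} {_≈₁_ _≈₂_ : Rel A 0ℓ} {_∙_ _∘_ : A → A → A} {ε ι : A}
           (∙≡∘ : ∀ x y → x ∙ y ≡ x ∘ y) (ε≡ι : ε ≡ ι) where

    private
      rawMonoid₁ rawMonoid₂ : RawMonoid 0ℓ 0ℓ
      rawMonoid₁ = record { Carrier = A ; _≈_ = _≈₁_ ; _∙_ = _∙_ ; ε = ε }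
      rawMonoid₂ = record { Carrier = A ; _≈_ = _≈₂_ ; _∙_ = _∘_ ; ε = ι }
      module M₁ = Algebra.Definitions.RawMonoid rawMonoid₁
      module M₂ = Algebra.Definitions.RawMonoid rawMonoid₂

    -- Powers are multiples in the multiplicative monoid. This passes from the operations of the
    -- statement to their opaque copies by propositional equality, one step at a time.
    ×-≡ : ∀ n x → n M₁.× x ≡ n M₂.× x
    ×-≡ zero    x = ε≡ι
    ×-≡ (suc n) x = trans (cong (x ∙_) (×-≡ n x)) (∙≡∘ x _)

    sum-≡ : ∀ {n} (f : Fin n → A) → M₁.sum f ≡ M₂.sum f
    sum-≡ {zero}  f = ε≡ι
    sum-≡ {suc n} f = trans (cong (f zero ∙_) (sum-≡ (λ i → f (suc i)))) (∙≡∘ (f zero) _)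

  ^ℂ≡^ : ∀ z n → z ^ℂ n ≡ z ^ n
  ^ℂ≡^ z n = ×-≡ {_≈₁_ = _≈_} {_≈_} {_*ℂ_} {_⊗_} (λ z w → sym (⊗≡*ℂ z w)) (sym 𝟙≡1ℂ) n z

  sumℂ≡sum : ∀ {n} (f : Fin n → ℂ) → sumℂ f ≡ sum f
  sumℂ≡sum f = sum-≡ {_≈₁_ = _≈_} {_≈_} {_+ℂ_} {_⊕_} (λ z w → sym (⊕≡+ℂ z w)) (sym 𝟘≡0ℂ) f

  *ℂ≡⊗ : ∀ a b {a′ b′} → a ≡ a′ → b ≡ b′ → a *ℂ b ≡ a′ ⊗ b′
  *ℂ≡⊗ a b refl refl = sym (⊗≡*ℂ a b)

  root-^ : ∀ q z → z ^ℂ q ≈ 1ℂ → z ^ q ≈ 𝟙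
  root-^ q z eq = subst (z ^ q ≈_) (sym 𝟙≡1ℂ) (subst (_≈ 1ℂ) (^ℂ≡^ z q) eq)

  root-^ℂ : ∀ q z → z ^ q ≈ 𝟙 → z ^ℂ q ≈ 1ℂ
  root-^ℂ q z eq = subst (z ^ℂ q ≈_) 𝟙≡1ℂ (subst (_≈ 𝟙) (sym (^ℂ≡^ z q)) eq)

  isPrimitive : ∀ {n ζ} → IsPrimitiveRoot n ζ → IsPrimitive n ζ
  isPrimitive {n} {ζ} (ζⁿ≈1 , least) = root-^ n ζ ζⁿ≈1 , λ d 0<d d<n eq → least d 0<d d<n (root-^ℂ d ζ eq)

  opaque
    unfolding _⊕_

    conjugate : ℂ → ℂ
    conjugate = conj

    conjugate≡conj : ∀ z → conjugate z ≡ conj z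
    conjugate≡conj z = refl

    conj-⊕ : ∀ z w → conjugate (z ⊕ w) ≈ conjugate z ⊕ conjugate w
    conj-⊕ z w = pointwise (λ _ → refl) ≈, pointwise (λ n → ℚ.neg-distrib-+ (seq (im z) n) (seq (im w) n))

    conj-⊗ : ∀ z w → conjugate (z ⊗ w) ≈ conjugate z ⊗ conjugate w
    conj-⊗ z w = mk≈ℝ (close (conj-re (re z) (im z) (re w) (im w)))
              ≈, mk≈ℝ (close (conj-im (re z) (im z) (re w) (im w)))
      where open GaussianIdentities ℝ-commutativeRing using (conj-re; conj-im)

    conj-𝟘 : conjugate 𝟘 ≈ 𝟘
    conj-𝟘 = pointwise (λ _ → refl) ≈, pointwise (λ _ → refl)

    conj-𝟙 : conjugate 𝟙 ≈ 𝟙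
    conj-𝟙 = pointwise (λ _ → refl) ≈, pointwise (λ _ → refl)

    conj-cong : ∀ {z w} → z ≈ w → conjugate z ≈ conjugate w
    conj-cong (p ≈, q) = mk≈ℝ (close p) ≈, mk≈ℝ (close (-ℝ-cong q))

    conj-involutive : ∀ z → conjugate (conjugate z) ≈ z
    conj-involutive z = pointwise (λ _ → refl) ≈, pointwise (λ n → Algebra.Properties.Group.⁻¹-involutive ℚ.+-0-group (seq (im z) n))

  conj-^ : ∀ z n → conjugate (z ^ n) ≈ conjugate z ^ n
  conj-^ z zero    = conj-𝟙
  conj-^ z (suc n) = ℂD.trans (conj-⊗ z (z ^ n)) (ℂD.*-congˡ (conj-^ z n))

  conj-sum : ∀ {n} (f : Fin n → ℂ) → conjugate (sum f) ≈ sum (conjugate ∘ f)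
  conj-sum {zero}  f = conj-𝟘
  conj-sum {suc n} f = ℂD.trans (conj-⊕ (f zero) _) (ℂD.+-congˡ (conj-sum (f ∘ suc)))

  conj-root : ∀ {q z} → z ^ q ≈ 𝟙 → conjugate z ^ q ≈ 𝟙
  conj-root {q} {z} eq = ℂD.trans (ℂD.sym (conj-^ z q)) (ℂD.trans (conj-cong eq) conj-𝟙)

  conj≈0 : ∀ {z} → conjugate z ≈ 𝟘 → z ≈ 𝟘
  conj≈0 {z} eq = ℂD.trans (ℂD.sym (conj-involutive z)) (ℂD.trans (conj-cong eq) conj-𝟘)

  module _ {M N q} (H : Matrix M N q) where

    hermitian : ∀ (u v : Fin N → ℂ) → ⟪_,_⟫ {M} {N} {q} u v ≡ sum (λ n → u n ⊗ conjugate (v n))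
    hermitian u v = trans (sumℂ≡sum (λ n → u n *ℂ conj (v n))) (sum-cong-≡ (λ n →
      trans (sym (⊗≡*ℂ (u n) (conj (v n)))) (cong (u n ⊗_) (sym (conjugate≡conj (v n))))))
      where
      sum-cong-≡ : ∀ {n} {f g : Fin n → ℂ} → (∀ i → f i ≡ g i) → sum f ≡ sum g
      sum-cong-≡ {zero}  eq = refl
      sum-cong-≡ {suc n} eq = cong₂ _⊕_ (eq zero) (sum-cong-≡ (eq ∘ suc))

    product : Fin M → Fin M → ℂ
    product a b = sum (λ n → entry H a n ⊗ conjugate (entry H b n))

    orthogonal⇔ : ∀ a b → ⟪_,_⟫ {M} {N} {q} (entry H a) (entry H b) ≈ 0ℂ ⇔ product a b ≈ 𝟘
    orthogonal⇔ a b = mk⇔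
      (λ eq → subst (product a b ≈_) (sym 𝟘≡0ℂ) (subst (_≈ 0ℂ) (hermitian (entry H a) (entry H b)) eq))
      (λ eq → subst (_≈ 0ℂ) (sym (hermitian (entry H a) (entry H b))) (subst (product a b ≈_) 𝟘≡0ℂ eq))

    product-flip : ∀ a b → conjugate (product a b) ≈ product b a
    product-flip a b = ℂD.trans (conj-sum (λ n → entry H a n ⊗ conjugate (entry H b n)))
      (sum-cong-≋ {N} (λ n → ℂD.trans (conj-⊗ (entry H a n) (conjugate (entry H b n)))
        (ℂD.trans (ℂD.*-congˡ (conj-involutive (entry H b n))) (ℂD.*-comm (conjugate (entry H a n)) (entry H b n)))))

  -- The two implicit row counts suc 1 and 2 are convertible, but comparing the
  -- inner products they index would unfold the Cauchy proofs.
  module _ {N q} (H : Matrix 2 N q) where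

    to-butson : PartialButson {suc 1} {N} {q} H → PartialButson {2} {N} {q} H
    to-butson pb a b a≢b = Equivalence.from (orthogonal⇔ {2} H a b) (Equivalence.to (orthogonal⇔ {suc 1} H a b) (pb a b a≢b))

    from-butson : PartialButson {2} {N} {q} H → PartialButson {suc 1} {N} {q} H
    from-butson pb a b a≢b = Equivalence.from (orthogonal⇔ {suc 1} H a b) (Equivalence.to (orthogonal⇔ {2} H a b) (pb a b a≢b))

  module _ {N q} (H : Matrix 2 N q) where

    -- The only other pair of distinct rows is the reversed one, whose scalar product is the
    -- conjugate.
    partialButson⇔ : PartialButson H ⇔ product H zero (suc zero) ≈ 𝟘
    partialButson⇔ = mk⇔ (λ pb → Equivalence.to (orthogonal⇔ H zero (suc zero)) (pb zero (suc zero) (λ ()))) orthogonal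
      where
      orthogonal : product H zero (suc zero) ≈ 𝟘 → PartialButson H
      orthogonal eq zero       zero       0≢0 = ⊥-elim (0≢0 refl)
      orthogonal eq zero       (suc zero) _   = Equivalence.from (orthogonal⇔ H zero (suc zero)) eq
      orthogonal eq (suc zero) zero       _   = Equivalence.from (orthogonal⇔ H (suc zero) zero)
        (ℂD.trans (ℂD.sym (product-flip H zero (suc zero))) (ℂD.trans (conj-cong eq) conj-𝟘))
      orthogonal eq (suc zero) (suc zero) 1≢1 = ⊥-elim (1≢1 refl)

  -- Against a row of ones the scalar product is the conjugate of the sum of the second row.
  dephased-partialButson⇔ : ∀ {N q} (H : Matrix 2 N q) → Dephased H →
                            PartialButson H ⇔ sum (entry H (suc zero)) ≈ 𝟘
  dephased-partialButson⇔ {N} H dephased = mk⇔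
    (λ pb → conj≈0 (ℂD.trans (conj-sum v) (ℂD.trans (ℂD.sym product≈) (to pb))))
    (λ eq → from (ℂD.trans product≈ (ℂD.trans (ℂD.sym (conj-sum v)) (ℂD.trans (conj-cong eq) conj-𝟘))))
    where
    open Equivalence (partialButson⇔ H)
    v : Fin N → ℂ
    v = entry H (suc zero)
    product≈ : product H zero (suc zero) ≈ sum (conjugate ∘ v)
    product≈ = sum-cong-≋ {N} (λ n → ℂD.trans
      (ℂD.*-congʳ {conjugate (v n)} (subst (entry H zero n ≈_) (sym 𝟙≡1ℂ) (dephased n))) (ℂD.*-identityˡ (conjugate (v n))))

  -- q is kept abstract so that powers with exponent q do not unfold.
  module TwoPrimePowers {p′ q′ k l q : ℕ} (q≡PQ : q ≡ suc p′ ℕ.^ suc k ℕ.* suc q′ ℕ.^ suc l)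
                        (p-prime : Prime (suc p′)) (q-prime : Prime (suc q′)) (p≢q : suc p′ ≢ suc q′) (N : ℕ)
                        {ζ₁ ζ₂ : ℂ} (prim₁ : IsPrimitiveRoot (suc p′ ℕ.^ suc k) ζ₁)
                        (prim₂ : IsPrimitiveRoot (suc q′ ℕ.^ suc l) ζ₂) where

    private
      p₁ p₂ P Q pᵏ qˡ : ℕ
      p₁ = suc p′
      p₂ = suc q′
      P = suc p′ ℕ.^ suc k
      Q = suc q′ ℕ.^ suc l
      pᵏ = suc p′ ℕ.^ k
      qˡ = suc q′ ℕ.^ l

    private
      0<P : 0 ℕ.< P
      0<P = ℕ.m^n>0 p₁ (suc k)
      0<Q : 0 ℕ.< Q
      0<Q = ℕ.m^n>0 p₂ (suc l)
      P⊥Q = primes⇒coprime-^ p-prime q-prime p≢q (suc k) (suc l)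
      prim₁′ = isPrimitive {suc p′ ℕ.^ suc k} {ζ₁} prim₁
      prim₂′ = isPrimitive {suc q′ ℕ.^ suc l} {ζ₂} prim₂

    r : Fin P × Fin Q → ℂ
    r (a , b) = ζ₁ ^ toℕ a ⊗ ζ₂ ^ toℕ b

    ρ : Fin (P ℕ.* Q) → ℂ
    ρ κ = r (remQuot {P} Q κ)

    flat : Fin p₁ → Fin pᵏ → Fin p₂ → Fin qˡ → Fin (P ℕ.* Q)
    flat i j x y = combine {P} {Q} (combine {p₁} {pᵏ} i j) (combine {p₂} {qˡ} x y)

    unflat : Fin (P ℕ.* Q) → Fin p₁ × Fin pᵏ × Fin p₂ × Fin qˡ
    unflat κ = let a , b = remQuot {P} Q κ
                   i , j = remQuot {p₁} pᵏ a
                   x , y = remQuot {p₂} qˡ b in i , j , x , y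

    flat-unflat : ∀ κ → (let i , j , x , y = unflat κ) → flat i j x y ≡ κ
    flat-unflat κ = trans
      (cong₂ combine (Fin.combine-remQuot {p₁} pᵏ (proj₁ (remQuot {P} Q κ)))
                     (Fin.combine-remQuot {p₂} qˡ (proj₂ (remQuot {P} Q κ))))
      (Fin.combine-remQuot {P} Q κ)

    unflat-flat : ∀ i j x y → unflat (flat i j x y) ≡ (i , j , x , y)
    unflat-flat i j x y = trans
      (cong (λ (a , b) → let i , j = remQuot {p₁} pᵏ a ; x , y = remQuot {p₂} qˡ b in i , j , x , y)
        (Fin.remQuot-combine {P} {Q} (combine {p₁} {pᵏ} i j) (combine {p₂} {qˡ} x y)))
      (cong₂ (λ (i , j) (x , y) → i , j , x , y) (Fin.remQuot-combine {p₁} {pᵏ} i j) (Fin.remQuot-combine {p₂} {qˡ} x y))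

    z₁ : Fin p₁ → Fin pᵏ → ℂ
    z₁ i j = ζ₁ ^ (toℕ j ℕ.+ pᵏ ℕ.* toℕ i)

    z₂ : Fin p₂ → Fin qˡ → ℂ
    z₂ x y = ζ₂ ^ (toℕ y ℕ.+ qˡ ℕ.* toℕ x)

    ρ-flat : ∀ i j x y → ρ (flat i j x y) ≡ z₁ i j ⊗ z₂ x y
    ρ-flat i j x y = trans (cong r (Fin.remQuot-combine {P} {Q} _ _))
      (cong₂ (λ a b → ζ₁ ^ a ⊗ ζ₂ ^ b)
        (trans (Fin.toℕ-combine i j) (ℕ.+-comm (pᵏ ℕ.* toℕ i) (toℕ j)))
        (trans (Fin.toℕ-combine x y) (ℕ.+-comm (qˡ ℕ.* toℕ x) (toℕ y))))

    rootAt≡ρ : ∀ i j x y → rootAt ζ₁ (suc p′) (suc k) i j *ℂ rootAt ζ₂ (suc q′) (suc l) x y ≡ ρ (flat i j x y)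
    rootAt≡ρ i j x y = trans (*ℂ≡⊗ (rootAt ζ₁ (suc p′) (suc k) i j) (rootAt ζ₂ (suc q′) (suc l) x y)
      (^ℂ≡^ ζ₁ (toℕ j ℕ.+ pᵏ ℕ.* toℕ i)) (^ℂ≡^ ζ₂ (toℕ y ℕ.+ qˡ ℕ.* toℕ x))) (sym (ρ-flat i j x y))

    ρ-injective : ∀ {κ κ′} → ρ κ ≈ ρ κ′ → κ ≡ κ′
    ρ-injective {κ} {κ′} eq = trans (sym (Fin.combine-remQuot {P} Q κ)) (trans
      (cong (uncurry combine) (roots-injective 0<P 0<Q P⊥Q prim₁′ prim₂′ eq)) (Fin.combine-remQuot {P} Q κ′))

    opaque
      -- Opaque, so that type checking does not unfold the search through the roots; only the
      -- specification of the index is used afterwards.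
      indexed : (z : RootOfUnity q) → ∃ λ κ → value z ≈ ρ κ
      indexed z = let s , z≈ = roots-complete 0<P 0<Q P⊥Q prim₁′ prim₂′ (1? (P ℕ.* Q) (ℕ.*-mono-≤ 0<P 0<Q))
                                 (subst (λ n → value z ^ n ≈ 𝟙) q≡PQ (root-^ q (value z) (isRoot z)))
                  in uncurry combine s , ℂD.trans z≈ (ℂD.reflexive (cong r (sym (uncurry (Fin.remQuot-combine {P} {Q}) s))))

    index : RootOfUnity q → Fin (P ℕ.* Q)
    index z = proj₁ (indexed z)

    value≈ρ : ∀ z → value z ≈ ρ (index z)
    value≈ρ z = proj₂ (indexed z)

    root : Fin (P ℕ.* Q) → RootOfUnity q
    root κ = mkRoot (ρ κ) (root-^ℂ q (ρ κ) (subst (λ n → ρ κ ^ n ≈ 𝟙) (sym q≡PQ)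
      (roots-^ 0<P 0<Q P⊥Q prim₁′ prim₂′ (remQuot {P} Q κ))))

    Multiplicity : Set
    Multiplicity = Multiplicities (suc p′) (suc k) (suc q′) (suc l)

    Matrices : Set
    Matrices = Matrix 2 N q

    indices : Matrices → Fin N → Fin (P ℕ.* Q)
    indices H n = index (H (suc zero) n)

    multiplicities : Matrices → Multiplicity
    multiplicities H i j x y = count (indices H) (flat i j x y)

    entry⇔index : ∀ (H : Matrices) i j x y n →
      entry H (suc zero) n ≈ rootAt ζ₁ (suc p′) (suc k) i j *ℂ rootAt ζ₂ (suc q′) (suc l) x y ⇔ indices H n ≡ flat i j x y
    entry⇔index H i j x y n = mk⇔
      (λ eq → ρ-injective (ℂD.trans (ℂD.sym (value≈ρ (H (suc zero) n))) (subst (entry H (suc zero) n ≈_) (rootAt≡ρ i j x y) eq)))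
      (λ eq → subst (entry H (suc zero) n ≈_) (trans (cong ρ eq) (sym (rootAt≡ρ i j x y))) (value≈ρ (H (suc zero) n)))

    multiplicities-correct : ∀ (H : Matrices) → IsMultiplicityMatrix (suc p′) (suc k) (suc q′) (suc l) ζ₁ ζ₂ H (multiplicities H)
    multiplicities-correct H i j x y = Count-resp
      (λ n → mk⇔ (from (entry⇔index H i j x y n)) (to (entry⇔index H i j x y n)))
      (count-Count (indices H) (flat i j x y))
      where open Equivalence

    multiplicities-unique : ∀ (H : Matrices) A → IsMultiplicityMatrix (suc p′) (suc k) (suc q′) (suc l) ζ₁ ζ₂ H A →
                            ∀ i j x y → A i j x y ≡ multiplicities H i j x y
    multiplicities-unique H A isMult i j x y =
      Count-unique (entry⇔index H i j x y) (isMult i j x y) (count-Count (indices H) (flat i j x y))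

    private
      weightedSum : Multiplicity → ℂ
      weightedSum = RootsOfUnity.weightedSum ℂ-domain p-prime q-prime p≢q k l prim₁′ prim₂′

    entries-sum : ∀ (H : Matrices) → sum (entry H (suc zero)) ≈ weightedSum (multiplicities H)
    entries-sum H = begin
      sum (entry H (suc zero))
        ≈⟨ sum-cong-≋ {N} (λ n → value≈ρ (H (suc zero) n)) ⟩
      sum (λ n → ρ (indices H n))
        ≈⟨ SumByValue.sum-by-value ℂD.+-commutativeMonoid (indices H) ρ ⟩
      sum (λ κ → count (indices H) κ ℂ-Ring.× ρ κ)
        ≈⟨ SumCombine.sum-combine⁴ ℂD.+-commutativeMonoid p₁ pᵏ p₂ {qˡ} (λ κ → count (indices H) κ ℂ-Ring.× ρ κ) ⟩
      sum (λ i → sum λ j → sum λ x → sum λ y → multiplicities H i j x y ℂ-Ring.× ρ (flat i j x y))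
        ≈⟨ sum-cong-≋ {p₁} (λ i → sum-cong-≋ {pᵏ} (λ j → sum-cong-≋ {p₂} (λ x → sum-cong-≋ {qˡ} (λ y →
             ℂD.trans (×≈fromNat (multiplicities H i j x y) (ρ (flat i j x y)))
               (ℂD.reflexive (cong (fromNat (multiplicities H i j x y) ⊗_) (ρ-flat i j x y))))))) ⟩
      weightedSum (multiplicities H) ∎
      where
      open import Relation.Binary.Reasoning.Setoid ℂD.setoid
      open import Algebra.Properties.Semiring.Mult ℂD.semiring using (×-assoc-*; ×-congʳ)
      open import Algebra.Properties.Semiring.Mult.TCOptimised ℂD.semiring using (×ᵤ≈×)
      ×≈fromNat : ∀ n z → n ℂ-Ring.× z ≈ fromNat n ⊗ z
      ×≈fromNat n z = ℂD.trans (×-congʳ n (ℂD.sym (ℂD.*-identityˡ z)))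
        (ℂD.trans (ℂD.sym (×-assoc-* n 𝟙 z)) (ℂD.*-congʳ {z} (×ᵤ≈× n 𝟙)))

    butson⇔sumForm : ∀ (H : Matrices) → Dephased H → PartialButson H ⇔ IsSumForm (suc p′) (suc k) (suc q′) (suc l) (multiplicities H)
    butson⇔sumForm H dephased = mk⇔
      (λ pb → RootsOfUnity.vanishing⇒sumForm ℂ-domain p-prime q-prime p≢q k l prim₁′ prim₂′ (multiplicities H)
        (ℂD.trans (ℂD.sym (entries-sum H)) (to pb)))
      (λ (b , c , eq) → from (ℂD.trans (entries-sum H)
        (RootsOfUnity.sumForm⇒vanishing ℂ-domain p-prime q-prime p≢q k l prim₁′ prim₂′ (multiplicities H) b c eq)))
      where open Equivalence (dephased-partialButson⇔ {N} {q} H dephased)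

    sumForm-resp : ∀ {A A′ : Multiplicity} → (∀ i j x y → A i j x y ≡ A′ i j x y) →
                   IsSumForm (suc p′) (suc k) (suc q′) (suc l) A → IsSumForm (suc p′) (suc k) (suc q′) (suc l) A′
    sumForm-resp A≡A′ (b , c , eq) = b , c , λ i j x y → trans (sym (A≡A′ i j x y)) (eq i j x y)

    characterization : ∀ (H : Matrices) → Dephased H → ∀ A → IsMultiplicityMatrix (suc p′) (suc k) (suc q′) (suc l) ζ₁ ζ₂ H A →
                       PartialButson H ⇔ IsSumForm (suc p′) (suc k) (suc q′) (suc l) A
    characterization H dephased A isMult = mk⇔
      (λ pb → sumForm-resp {multiplicities H} {A} (λ i j x y → sym (A≡ i j x y)) (to pb))
      (λ sumForm → from (sumForm-resp {A} {multiplicities H} A≡ sumForm))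
      where
      A≡ = multiplicities-unique H A isMult
      open Equivalence (butson⇔sumForm H dephased)

    total-multiplicities : ∀ (H : Matrices) → total (suc p′) (suc k) (suc q′) (suc l) (multiplicities H) ≡ N
    total-multiplicities H = trans
      (sym (SumCombine.sum-combine⁴ ℕ.+-0-commutativeMonoid p₁ pᵏ p₂ {qˡ} (count (indices H)))) (sum-count (indices H))

    module _ (A : Multiplicity) (sumForm : IsSumForm (suc p′) (suc k) (suc q′) (suc l) A)
             (total≡N : total (suc p′) (suc k) (suc q′) (suc l) A ≡ N) where

      private
        Â : Fin (P ℕ.* Q) → ℕ
        Â κ = let i , j , x , y = unflat κ in A i j x y

        Â-flat : ∀ i j x y → Â (flat i j x y) ≡ A i j x y
        Â-flat i j x y = cong (λ (i , j , x , y) → A i j x y) (unflat-flat i j x y)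

        sum-Â : ℕ-Sum.sum Â ≡ N
        sum-Â = trans (SumCombine.sum-combine⁴ ℕ.+-0-commutativeMonoid p₁ pᵏ p₂ {qˡ} Â)
          (trans (ℕ-Sum.sum-cong-≗ {p₁} λ i → ℕ-Sum.sum-cong-≗ {pᵏ} λ j → ℕ-Sum.sum-cong-≗ {p₂} λ x →
            ℕ-Sum.sum-cong-≗ {qˡ} λ y → Â-flat i j x y) total≡N)

        -- `with-counts` produces as many columns as the entries of A sum to; the hypothesis on the
        -- total turns this into N.
        columns : ∃ λ (f : Fin N → Fin (P ℕ.* Q)) → ∀ κ → count f κ ≡ Â κ
        columns = subst (λ n → ∃ λ (f : Fin n → Fin (P ℕ.* Q)) → ∀ κ → count f κ ≡ Â κ) sum-Â (with-counts Â)

      realize : Matrices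
      realize zero       n = mkRoot 𝟙 (root-^ℂ q 𝟙 (1^ q))
      realize (suc zero) n = root (proj₁ columns n)

      realize-dephased : Dephased realize
      realize-dephased n = subst (𝟙 ≈_) 𝟙≡1ℂ ℂD.refl

      realize-multiplicities : ∀ i j x y → multiplicities realize i j x y ≡ A i j x y
      realize-multiplicities i j x y = trans
        -- `index` was found by a search, but ρ is injective, so it returns the index that `root`
        -- was given.
        (ℕ-Sum.sum-cong-≗ {N} (λ n → cong (λ κ → χ κ (flat i j x y))
          (sym (ρ-injective (value≈ρ (root (proj₁ columns n)))))))
        (trans (proj₂ columns (flat i j x y)) (Â-flat i j x y))

      realize-butson : PartialButson realize
      realize-butson = Equivalence.from (butson⇔sumForm realize realize-dephased)
        (sumForm-resp {A} {multiplicities realize} (λ i j x y → sym (realize-multiplicities i j x y)) sumForm)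

    module Butson = Setoid (dephasedPartialButsonSetoid 1 N q)
    module SumForm = Setoid (sumFormSetoid (suc p′) (suc k) (suc q′) (suc l) N)

    invariant : ∀ (H H′ : Matrices) (σ : Permutation′ N) → (∀ a n → entry H a (σ ⟨$⟩ʳ n) ≈ entry H′ a n) →
                ∀ i j x y → multiplicities H i j x y ≡ multiplicities H′ i j x y
    invariant H H′ σ eq i j x y = trans
      (ℕ-Sum.sum-permute (λ n → χ (indices H n) (flat i j x y)) σ)
      (ℕ-Sum.sum-cong-≗ {N} (λ n → cong (λ κ → χ κ (flat i j x y)) (ρ-injective
        (ℂD.trans (ℂD.sym (value≈ρ (H (suc zero) (σ ⟨$⟩ʳ n))))
          (ℂD.trans (eq (suc zero) n) (value≈ρ (H′ (suc zero) n)))))))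

    -- Equal multiplicities provide a permutation matching the second rows; on the first rows, all
    -- ones, any permutation will do.
    complete : ∀ (H H′ : Matrices) → Dephased H → Dephased H′ →
               (∀ i j x y → multiplicities H i j x y ≡ multiplicities H′ i j x y) →
               ∃ λ (σ : Permutation′ N) → ∀ a n → entry H a (σ ⟨$⟩ʳ n) ≈ entry H′ a n
    complete H H′ dephased dephased′ eq = σ , matches
      where
      equal : ∃ λ (σ : Permutation′ N) → ∀ n → indices H (σ ⟨$⟩ʳ n) ≡ indices H′ n
      equal = equal-counts⇒permutation (indices H) (indices H′) λ κ →
        let i , j , x , y = unflat κ in
        subst (λ κ → count (indices H) κ ≡ count (indices H′) κ) (flat-unflat κ) (eq i j x y)
      σ = proj₁ equal
      matches : ∀ a n → entry H a (σ ⟨$⟩ʳ n) ≈ entry H′ a n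
      matches zero       n = ℂD.trans (dephased (σ ⟨$⟩ʳ n)) (ℂD.sym (dephased′ n))
      matches (suc zero) n = ℂD.trans (value≈ρ (H (suc zero) (σ ⟨$⟩ʳ n)))
        (ℂD.trans (ℂD.reflexive (cong ρ (proj₂ equal n))) (ℂD.sym (value≈ρ (H′ (suc zero) n))))

    classify : Butson.Carrier → SumForm.Carrier
    classify (H , dephased , pb) =
      multiplicities H , Equivalence.to (butson⇔sumForm H dephased) (to-butson H pb) , total-multiplicities H

    classify-cong : ∀ X Y → X Butson.≈ Y → classify X SumForm.≈ classify Y
    classify-cong (H , _) (H′ , _) (σ , eq) = invariant H H′ σ eq

    classify-injective : ∀ X Y → classify X SumForm.≈ classify Y → X Butson.≈ Y
    classify-injective (H , dephased , _) (H′ , dephased′ , _) = complete H H′ dephased dephased′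

    realized : SumForm.Carrier → Butson.Carrier
    realized (A , sumForm , total≡N) =
      realize A sumForm total≡N , realize-dephased A sumForm total≡N ,
      from-butson (realize A sumForm total≡N) (realize-butson A sumForm total≡N)

    classify-realized : ∀ A X → X Butson.≈ realized A → classify X SumForm.≈ A
    classify-realized Â@(A , sumForm , total≡N) X X≈ i j x y =
      trans (classify-cong X (realized Â) X≈ i j x y) (realize-multiplicities A sumForm total≡N i j x y)

    classification : Bijection (dephasedPartialButsonSetoid 1 N q) (sumFormSetoid (suc p′) (suc k) (suc q′) (suc l) N)
    classification = record
      { to        = classify
      ; cong      = λ {X} {Y} → classify-cong X Y
      ; bijective = (λ {X} {Y} → classify-injective X Y) , λ A → realized A , λ {X} → classify-realized A X
      }

-- Order twice a prime: uniform matrices and simple random walks.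

module RandomWalks where

  open RootsNearOne using (1?)
  open ButsonMatrices

  open Subrings ℂ-domain
    using (_^_; sum; sum-cong-≋; ^-congʳ; ^-distrib-*; *-distribˡ-sum; ∑-distrib-+; sum-replicate-zero; fromℤ-closed)
  open Polynomials ℂ-domain using (IsPrimitive; primitive-^)
  open Independence ℂ-domain using (∑-powers≈0)
  open Integers ℂ-domain using (relations-ℤ; fromℤ-injective; prime>1)
  open RootsOfUnity ℂ-domain using (roots-complete; roots-injective; roots-^)

  Vec-↔ : ∀ {A : Set} {a} → A ↔ Fin a → ∀ n → Vec A n ↔ Fin (a ℕ.^ n)
  Vec-↔ A↔ zero    = mk↔ₛ′ (λ _ → zero) (λ _ → []) (λ { zero → refl }) (λ { [] → refl })
  Vec-↔ A↔ (suc n) = ↔-trans uncons (↔-trans (A↔ ×-↔ Vec-↔ A↔ n) (↔-sym Fin.*↔×))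
    where
    uncons : ∀ {A : Set} {n} → Vec A (suc n) ↔ (A × Vec A n)
    uncons = mk↔ₛ′ (λ { (x ∷ xs) → x , xs }) (λ (x , xs) → x ∷ xs) (λ _ → refl) (λ { (x ∷ xs) → refl })

  cardinality-↔ : ∀ {X : Set} {a} {F : X → Set} → X ↔ Fin a → (∀ x → Dec (F x)) →
                  ∃ λ m → HasCardinality (Restricted (setoid X) F) m
  cardinality-↔ {X} {a} {F} K F? = proj₁ counted , record
    { to        = to
    ; from      = from
    ; to-cong   = λ {x} {y} eq → J.to-cong (cong K.to eq)
    ; from-cong = λ { refl → refl }
    ; inverse   = (λ {k} {x} eq → J.inverseˡ (trans (cong K.to eq) (K.inverseˡ refl)))
                , (λ {x} {k} eq → trans (cong K.from (J.inverseʳ {to′ x} eq)) (K.inverseʳ refl))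
    }
    where
    module K = Inverse K
    counted = cardinality-Fin {a} {F ∘ K.from} (F? ∘ K.from)
    module J = Inverse (proj₂ counted)
    to′ : Σ X F → Σ (Fin a) (F ∘ K.from)
    to′ (x , f) = K.to x , subst F (sym (K.inverseʳ refl)) f
    to : Σ X F → Fin (proj₁ counted)
    to x = J.to (to′ x)
    from : Fin (proj₁ counted) → Σ X F
    from k = K.from (proj₁ (J.from k)) , proj₂ (J.from k)

  module _ {Ω : Setoid 0ℓ 0ℓ} {X : Set} {w : ℕ} (I : Inverse Ω (setoid (X × X))) (K : X ↔ Fin (suc w))
           {E : Setoid.Carrier Ω → Set} {F : X → Set} (F? : ∀ x → Dec (F x))
           (E⇔F : ∀ ω → E ω ⇔ F (proj₂ (Inverse.to I ω))) where

    private
      module I = Inverse I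
      module K = Inverse K
      counted = cardinality-↔ {F = F} K F?
      m = proj₁ counted
      module J = Inverse (proj₂ counted)
      module Ω = Setoid Ω

      Ω-card : HasCardinality Ω (suc w ℕ.* suc w)
      Ω-card = record
        { to        = pair ∘ I.to
        ; from      = I.from ∘ unpair
        ; to-cong   = cong pair ∘ I.to-cong
        ; from-cong = λ { refl → Ω.refl }
        ; inverse   = (λ {k} eq → trans (cong pair (I.inverseˡ eq)) (P.inverseˡ refl))
                    , (λ {ω} eq → I.inverseʳ (P.inverseʳ eq))
        }
        where
        P : (X × X) ↔ Fin (suc w ℕ.* suc w)
        P = ↔-trans (K ×-↔ K) (↔-sym Fin.*↔×)
        module P = Inverse P
        pair = P.to
        unpair = P.from

      E-card : HasCardinality (Restricted Ω E) (suc w ℕ.* m)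
      E-card = record
        { to        = to
        ; from      = from
        ; to-cong   = λ {ω} {ω′} eq → cong₂ combine (cong (K.to ∘ proj₁) (I.to-cong eq))
                        (J.to-cong (cong proj₂ (I.to-cong eq)))
        ; from-cong = λ { refl → Ω.refl }
        ; inverse   = (λ {k} {ω} → inverseˡ k ω) , λ {ω} {k} → inverseʳ ω k
        }
        where
        image : Σ Ω.Carrier E → Σ X F
        image (ω , e) = proj₂ (I.to ω) , Equivalence.to (E⇔F ω) e
        to : Σ Ω.Carrier E → Fin (suc w ℕ.* m)
        to ω = combine (K.to (proj₁ (I.to (proj₁ ω)))) (J.to (image ω))
        point : Fin (suc w) × Fin m → Ω.Carrier
        point (a , b) = I.from (K.from a , proj₁ (J.from b))
        from : Fin (suc w ℕ.* m) → Σ Ω.Carrier E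
        from k = point s , Equivalence.from (E⇔F (point s))
          (subst F (sym (cong proj₂ (I.inverseˡ Ω.refl))) (proj₂ (J.from (proj₂ s))))
          where s = remQuot {suc w} m k
        inverseˡ : ∀ k ω → proj₁ ω Ω.≈ proj₁ (from k) → to ω ≡ k
        inverseˡ k ω eq = trans (cong₂ combine
            (trans (cong (K.to ∘ proj₁) toω) (K.inverseˡ refl))
            (J.inverseˡ {proj₂ s} {image ω} (cong proj₂ toω)))
          (Fin.combine-remQuot {suc w} m k)
          where
          s = remQuot {suc w} m k
          toω : I.to (proj₁ ω) ≡ (K.from (proj₁ s) , proj₁ (J.from (proj₂ s)))
          toω = I.inverseˡ eq
        inverseʳ : ∀ ω k → k ≡ to ω → proj₁ (from k) Ω.≈ proj₁ ω
        inverseʳ ω k refl = I.inverseʳ (cong₂ _,_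
          (trans (cong (K.from ∘ proj₁) (Fin.remQuot-combine (K.to (proj₁ (I.to (proj₁ ω)))) (J.to (image ω)))) (K.inverseʳ refl))
          (trans (cong (proj₁ ∘ J.from ∘ proj₂) (Fin.remQuot-combine (K.to (proj₁ (I.to (proj₁ ω)))) (J.to (image ω))))
            (J.inverseʳ {image ω} refl)))

    -- The event constrains only the second coordinate of a uniform pair. If m of the w + 1 points
    -- satisfy F, then (w+1)m of the (w+1)² pairs satisfy E, and the factor w + 1 cancels.
    equal-probability : ∃ λ r → HasProbability Ω E r × HasProbability (setoid X) F r
    equal-probability = + m ℚ./ suc w ,
      -- `HasProbability` records the predecessor of the size of Ω; `suc w * suc w` reduces to the
      -- successor of this number.
      (suc w ℕ.* m , w ℕ.+ w ℕ.* suc w , Ω-card , E-card , ratio) ,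
      (m , w , K , proj₂ counted , refl)
      where
      ratio : + m ℚ./ suc w ≡ + (suc w ℕ.* m) ℚ./ suc (w ℕ.+ w ℕ.* suc w)
      ratio = ℚ.fromℚᵘ-cong {mkℚᵘ (+ m) w} {mkℚᵘ (+ (suc w ℕ.* m)) (w ℕ.+ w ℕ.* suc w)}
        (*≡* (trans (sym (ℤ.pos-* m (suc w ℕ.* suc w))) (trans (cong +_ (begin
          m ℕ.* (suc w ℕ.* suc w)  ≡⟨ ℕ.*-assoc m (suc w) (suc w) ⟨
          m ℕ.* suc w ℕ.* suc w  ≡⟨ cong (ℕ._* suc w) (ℕ.*-comm m (suc w)) ⟩
          suc w ℕ.* m ℕ.* suc w  ∎)) (ℤ.pos-* (suc w ℕ.* m) (suc w)))))
        where open Relation.Binary.PropositionalEquality.≡-Reasoning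

  -- q is kept abstract so that powers with exponent q do not unfold.
  module TwicePrime {p′ q : ℕ} (q≡2p : q ≡ 2 ℕ.* suc p′) (p-prime : Prime (suc p′)) (3≤p : 3 ℕ.≤ suc p′) (N : ℕ)
                 {ζ : ℂ} (prim : IsPrimitiveRoot q ζ) where

    p : ℕ
    p = suc p′

    η ω : ℂ
    η = ζ ^ p
    ω = ζ ^ 2

    private
      2⊥p = primes⇒coprime prime[2] p-prime (ℕ.<⇒≢ 3≤p)
      η-primitive : IsPrimitive 2 η
      η-primitive = primitive-^ p 2 (s≤s z≤n) (subst (λ n → IsPrimitive n ζ) (trans q≡2p (ℕ.*-comm 2 p)) (isPrimitive {q} {ζ} prim))
      ω-primitive : IsPrimitive p ω
      ω-primitive = primitive-^ 2 p (s≤s z≤n) (subst (λ n → IsPrimitive n ζ) q≡2p (isPrimitive {q} {ζ} prim))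

    signIndex : Sign → Fin 2
    signIndex Sign.+ = zero
    signIndex Sign.- = suc zero

    sign : Fin 2 → Sign
    sign zero       = Sign.+
    sign (suc zero) = Sign.-

    signIndex-sign : ∀ s → signIndex (sign s) ≡ s
    signIndex-sign zero       = refl
    signIndex-sign (suc zero) = refl

    sign-signIndex : ∀ s → sign (signIndex s) ≡ s
    sign-signIndex Sign.+ = refl
    sign-signIndex Sign.- = refl

    -- The move s e_i corresponds to the root s ω^i.
    moveRoot : Move p → ℂ
    moveRoot (i , s) = η ^ toℕ (signIndex s) ⊗ ω ^ toℕ i

    moveRoot-^ : ∀ m → moveRoot m ^ q ≈ 𝟙
    moveRoot-^ (i , s) = subst (λ n → moveRoot (i , s) ^ n ≈ 𝟙) (sym q≡2p)
      (roots-^ (s≤s z≤n) (s≤s z≤n) 2⊥p η-primitive ω-primitive (signIndex s , i))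

    moveRoot-injective : ∀ {m m′} → moveRoot m ≈ moveRoot m′ → m ≡ m′
    moveRoot-injective {i , s} {j , t} eq = cong₂ _,_ (cong proj₂ same)
      (trans (sym (sign-signIndex s)) (trans (cong (sign ∘ proj₁) same) (sign-signIndex t)))
      where
      same : (signIndex s , i) ≡ (signIndex t , j)
      same = roots-injective (s≤s z≤n) (s≤s z≤n) 2⊥p η-primitive ω-primitive eq

    opaque
      moved : (z : RootOfUnity q) → ∃ λ m → value z ≈ moveRoot m
      moved z = let (s , i) , z≈ = roots-complete (s≤s z≤n) (s≤s z≤n) 2⊥p η-primitive ω-primitive
                                     (1? (2 ℕ.* p) (s≤s z≤n))
                                     (subst (λ n → value z ^ n ≈ 𝟙) q≡2p (root-^ q (value z) (isRoot z)))
                in (i , sign s) , ℂD.trans z≈ (ℂD.reflexive (cong (λ t → η ^ toℕ t ⊗ ω ^ toℕ i) (sym (signIndex-sign s))))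

    move : RootOfUnity q → Move p
    move z = proj₁ (moved z)

    value≈moveRoot : ∀ z → value z ≈ moveRoot (move z)
    value≈moveRoot z = proj₂ (moved z)

    move-unique : ∀ z {m} → value z ≈ moveRoot m → move z ≡ m
    move-unique z eq = moveRoot-injective (ℂD.trans (ℂD.sym (value≈moveRoot z)) eq)

    evaluate : (Fin p → ℤ) → ℂ
    evaluate e = sum λ c → ℂD.fromℤ (e c) ⊗ ω ^ toℕ c

    evaluate-+ : ∀ d e → evaluate (λ c → d c ℤ.+ e c) ≈ evaluate d ⊕ evaluate e
    evaluate-+ d e = ℂD.trans
      (sum-cong-≋ {p} (λ c → ℂD.trans (ℂD.*-congʳ {ω ^ toℕ c} (ℂD.fromℤ-+ (d c) (e c)))
        (ℂD.distribʳ (ω ^ toℕ c) (ℂD.fromℤ (d c)) (ℂD.fromℤ (e c)))))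
      (∑-distrib-+ (λ c → ℂD.fromℤ (d c) ⊗ ω ^ toℕ c) (λ c → ℂD.fromℤ (e c) ⊗ ω ^ toℕ c))

    -- (η - 1)(η + 1) = η² - 1 = 0, and the first factor is nonzero because η has exact order 2.
    η≈-1 : η ≈ ⊖ 𝟙
    η≈-1 = ℂ-Ring.x∙y⁻¹≈ε⇒x≈y η (⊖ 𝟙) (ℂD.zeroˡ-cancel {η ⊕ ⊖ 𝟙} {η ⊕ ⊖ (⊖ 𝟙)}
      (ℂD.trans (solve 1 (λ x → (x :- con 1ℤ) :* (x :- (:- con 1ℤ)) := x :* (x :* con 1ℤ) :- con 1ℤ) ℂD.refl η)
        (ℂ-Ring.x≈y⇒x∙y⁻¹≈ε (proj₁ η-primitive)))
      (λ eq → proj₂ η-primitive 1 (s≤s z≤n) (s≤s (s≤s z≤n)) (ℂD.trans (ℂD.*-identityʳ η) (ℂ-Ring.x∙y⁻¹≈ε⇒x≈y η 𝟙 eq))))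
      where open ℂD.Solver

    fromℤ-sign : ∀ s → ℂD.fromℤ (s ◃ 1) ≈ η ^ toℕ (signIndex s)
    fromℤ-sign Sign.+ = ℂD.refl
    fromℤ-sign Sign.- = ℂD.trans (ℂD.sym η≈-1) (ℂD.sym (ℂD.*-identityʳ η))

    evaluate-displacement : ∀ m → evaluate (displacement m) ≈ moveRoot m
    evaluate-displacement (i , s) = ℂD.trans
      (sum-cong-≋ {p} term)
      (ℂD.trans (SumByValue.sum-χ ℂD.+-commutativeMonoid i (λ c → ℂD.fromℤ (s ◃ 1) ⊗ ω ^ toℕ c))
        (ℂD.*-congʳ {ω ^ toℕ i} (fromℤ-sign s)))
      where
      term : ∀ c → ℂD.fromℤ (displacement (i , s) c) ⊗ ω ^ toℕ c ≈ χ i c ℂ-Ring.× (ℂD.fromℤ (s ◃ 1) ⊗ ω ^ toℕ c)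
      term c with i Fin.≟ c
      ... | yes _ = ℂD.sym (ℂD.+-identityʳ _)
      ... | no  _ = ℂD.zeroˡ (ω ^ toℕ c)

    walk-sum : ∀ {n} (w : Vec (Move p) n) → sum (λ k → moveRoot (lookup w k)) ≈ evaluate (endpoint w)
    walk-sum []      = ℂD.sym (ℂD.trans (sum-cong-≋ {p} (λ c → ℂD.zeroˡ (ω ^ toℕ c))) (sum-replicate-zero p))
    walk-sum (m ∷ w) = ℂD.trans (ℂD.+-cong (ℂD.sym (evaluate-displacement m)) (walk-sum w))
      (ℂD.sym (evaluate-+ (displacement m) (endpoint w)))

    -- The relations over ℤ among 1, ω, ..., ω^(p-1) are exactly the multiples of their sum.
    diagonal⇔ : ∀ e → evaluate e ≈ 𝟘 ⇔ OnDiagonal e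
    diagonal⇔ e = mk⇔ diagonal vanishing
      where
      diagonal : evaluate e ≈ 𝟘 → OnDiagonal e
      diagonal eq = e zero , λ c → fromℤ-injective
        -- Exponent p^1, so j ranges over one value; the inner sums have a single term followed by
        -- the zero of the empty sum.
        (relations-ℤ p-prime 0 (subst (λ n → IsPrimitive n ω) (sym (ℕ.*-identityʳ p)) ω-primitive)
          (λ i _ → ℂD.fromℤ (e i)) (λ i _ → fromℤ-closed (e i))
          (ℂD.trans (sum-cong-≋ {p} (λ c → ℂD.trans (ℂD.+-identityʳ _)
            (ℂD.*-congˡ {ℂD.fromℤ (e c)} (^-congʳ ω (ℕ.*-identityˡ (toℕ c)))))) eq) c zero)
      vanishing : OnDiagonal e → evaluate e ≈ 𝟘
      vanishing (t , e≡t) = ℂD.trans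
        (sum-cong-≋ {p} (λ c → ℂD.*-congʳ {ω ^ toℕ c} (ℂD.reflexive (cong ℂD.fromℤ (e≡t c)))))
        (ℂD.trans (ℂD.sym (*-distribˡ-sum {p} (ℂD.fromℤ t) (λ c → ω ^ toℕ c)))
          (ℂD.trans (ℂD.*-congˡ (∑-powers≈0 (prime>1 p-prime) ω-primitive)) (ℂD.zeroʳ (ℂD.fromℤ t))))

    onDiagonal? : ∀ (w : Vec (Move p) N) → Dec (OnDiagonal (endpoint w))
    onDiagonal? w = Dec.map′ (endpoint w zero ,_) (λ (t , eq) c → trans (eq c) (sym (eq zero)))
      (Fin.all? (λ c → endpoint w c ℤ.≟ endpoint w zero))

    Walk : Set
    Walk = Vec (Move p) N

    Matrices : Set
    Matrices = Matrix 2 N q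

    -- u v̄ recovers the second row from the first, because u ^ (q - 1) is
    -- the inverse of u.
    quotientRoot : RootOfUnity q → RootOfUnity q → RootOfUnity q
    quotientRoot u v = mkRoot (value u ⊗ conjugate (value v)) (root-^ℂ q (value u ⊗ conjugate (value v))
      (ℂD.trans (^-distrib-* (value u) (conjugate (value v)) q) (ℂD.trans
        (ℂD.*-cong (root-^ q (value u) (isRoot u)) (conj-root {q} {value v} (root-^ q (value v) (isRoot v)))) (ℂD.*-identityˡ 𝟙))))

    moveRoots : Move p → RootOfUnity q
    moveRoots m = mkRoot (moveRoot m) (root-^ℂ q (moveRoot m) (moveRoot-^ m))

    inverse : ∀ {u} → u ^ q ≈ 𝟙 → u ⊗ u ^ ℕ.pred q ≈ 𝟙
    -- The detour through 2p, a visible successor, rewrites the abstract q as `suc (pred q)`, so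
    -- that the power unfolds once.
    inverse {u} eq = subst (λ n → u ^ n ≈ 𝟙) (trans q≡2p (cong (λ n → suc (ℕ.pred n)) (sym q≡2p))) eq

    -- The solution v of u v̄ = w, where u and w are the roots of the two moves: v is the conjugate
    -- of w u^(q-1).
    secondEntry : Move p → Move p → RootOfUnity q
    secondEntry μ ν = mkRoot (conjugate (moveRoot ν ⊗ moveRoot μ ^ ℕ.pred q)) (root-^ℂ q (conjugate (moveRoot ν ⊗ moveRoot μ ^ ℕ.pred q)) (conj-root {q} {moveRoot ν ⊗ moveRoot μ ^ ℕ.pred q}
      (ℂD.trans (^-distrib-* (moveRoot ν) (moveRoot μ ^ ℕ.pred q) q) (ℂD.trans
        (ℂD.*-cong (moveRoot-^ ν) (ℂD.trans (Subrings.^-assocʳ ℂ-domain (moveRoot μ) (ℕ.pred q) q)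
          (Integers.^-multiple ℂ-domain (ℕ.pred q) q (moveRoot-^ μ)))) (ℂD.*-identityˡ 𝟙)))))

    fromMoves : Walk × Walk → Matrices
    fromMoves (μ , ν) zero       n = moveRoots (lookup μ n)
    fromMoves (μ , ν) (suc zero) n = secondEntry (lookup μ n) (lookup ν n)

    quotients : Matrices → Fin N → RootOfUnity q
    quotients H n = quotientRoot (H zero n) (H (suc zero) n)

    toMoves : Matrices → Walk × Walk
    toMoves H = tabulate (λ n → move (H zero n)) , tabulate (λ n → move (quotients H n))

    secondEntry-quotient : ∀ (u v : ℂ) μ ν → u ≈ moveRoot μ → v ≈ value (secondEntry μ ν) →
                           u ⊗ conjugate v ≈ moveRoot ν
    secondEntry-quotient u v μ ν u≈ v≈ = begin
      u ⊗ conjugate v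
        ≈⟨ ℂD.*-cong u≈ (ℂD.trans (conj-cong v≈) (conj-involutive (moveRoot ν ⊗ moveRoot μ ^ ℕ.pred q))) ⟩
      moveRoot μ ⊗ (moveRoot ν ⊗ moveRoot μ ^ ℕ.pred q)
        ≈⟨ solve 3 (λ a b c → a :* (b :* c) := b :* (a :* c)) ℂD.refl (moveRoot μ) (moveRoot ν) (moveRoot μ ^ ℕ.pred q) ⟩
      moveRoot ν ⊗ (moveRoot μ ⊗ moveRoot μ ^ ℕ.pred q)
        ≈⟨ ℂD.*-congˡ {moveRoot ν} (inverse (moveRoot-^ μ)) ⟩
      moveRoot ν ⊗ 𝟙
        ≈⟨ ℂD.*-identityʳ (moveRoot ν) ⟩
      moveRoot ν ∎
      where
      open ℂD.Solver using (solve; _:=_; _:*_)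
      open import Relation.Binary.Reasoning.Setoid ℂD.setoid

    quotient-secondEntry : ∀ (u v : ℂ) μ ν → u ≈ moveRoot μ → u ⊗ conjugate v ≈ moveRoot ν →
                           value (secondEntry μ ν) ≈ v
    quotient-secondEntry u v μ ν u≈ uv̄≈ = ℂD.trans (conj-cong (begin
      moveRoot ν ⊗ moveRoot μ ^ ℕ.pred q
        ≈⟨ ℂD.*-congʳ {moveRoot μ ^ ℕ.pred q} (ℂD.trans (ℂD.sym uv̄≈) (ℂD.*-congʳ {conjugate v} u≈)) ⟩
      (moveRoot μ ⊗ conjugate v) ⊗ moveRoot μ ^ ℕ.pred q
        ≈⟨ solve 3 (λ a b c → (a :* b) :* c := b :* (a :* c)) ℂD.refl (moveRoot μ) (conjugate v) (moveRoot μ ^ ℕ.pred q) ⟩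
      conjugate v ⊗ (moveRoot μ ⊗ moveRoot μ ^ ℕ.pred q)
        ≈⟨ ℂD.*-congˡ {conjugate v} (inverse (moveRoot-^ μ)) ⟩
      conjugate v ⊗ 𝟙
        ≈⟨ ℂD.*-identityʳ (conjugate v) ⟩
      conjugate v ∎)) (conj-involutive v)
      where
      open ℂD.Solver using (solve; _:=_; _:*_)
      open import Relation.Binary.Reasoning.Setoid ℂD.setoid

    module Ω = Setoid (matrixSetoid 2 N q)

    toMoves-cong : ∀ (H H′ : Matrices) → H Ω.≈ H′ → toMoves H ≡ toMoves H′
    toMoves-cong H H′ H≈ = cong₂ _,_
      (Vec.tabulate-cong λ n → move-unique (H zero n) (ℂD.trans (H≈ zero n) (value≈moveRoot (H′ zero n))))
      (Vec.tabulate-cong λ n → move-unique (quotients H n)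
        (ℂD.trans (ℂD.*-cong (H≈ zero n) (conj-cong (H≈ (suc zero) n))) (value≈moveRoot (quotients H′ n))))

    to-from : ∀ (s : Walk × Walk) (H : Matrices) → H Ω.≈ fromMoves s → toMoves H ≡ s
    to-from (μ , ν) H H≈ = cong₂ _,_
      (trans (Vec.tabulate-cong λ n → move-unique (H zero n) (H≈ zero n)) (Vec.tabulate∘lookup μ))
      (trans (Vec.tabulate-cong λ n → move-unique (quotients H n)
          (secondEntry-quotient (value (H zero n)) (value (H (suc zero) n)) (lookup μ n) (lookup ν n) (H≈ zero n) (H≈ (suc zero) n)))
        (Vec.tabulate∘lookup ν))

    from-to : ∀ (H : Matrices) → fromMoves (toMoves H) Ω.≈ H
    from-to H zero       n = ℂD.trans (ℂD.reflexive (cong moveRoot (Vec.lookup∘tabulate (λ n → move (H zero n)) n)))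
      (ℂD.sym (value≈moveRoot (H zero n)))
    from-to H (suc zero) n = quotient-secondEntry (value (H zero n)) (value (H (suc zero) n))
      (lookup (proj₁ (toMoves H)) n) (lookup (proj₂ (toMoves H)) n)
      (ℂD.trans (value≈moveRoot (H zero n)) (ℂD.reflexive (cong moveRoot (sym (Vec.lookup∘tabulate (λ n → move (H zero n)) n)))))
      (ℂD.trans (value≈moveRoot (quotients H n)) (ℂD.reflexive (cong moveRoot (sym (Vec.lookup∘tabulate (λ n → move (quotients H n)) n)))))

    -- Under this change of variables the first row stays free and the second component is a uniform
    -- walk, whose roots sum to the scalar product of the rows.
    matrices↔moves : Inverse (matrixSetoid 2 N q) (setoid (Walk × Walk))
    matrices↔moves = record
      { to        = toMoves
      ; from      = fromMoves
      ; to-cong   = λ {H} {H′} → toMoves-cong H H′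
      ; from-cong = λ { {s} refl → Ω.refl {fromMoves s} }
      ; inverse   = (λ {s} {H} → to-from s H) , λ { {H} refl → from-to H }
      }

    butson⇔diagonal : ∀ (H : Matrices) → PartialButson H ⇔ OnDiagonal (endpoint (proj₂ (toMoves H)))
    butson⇔diagonal H = mk⇔
      (λ pb → Equivalence.to (diagonal⇔ e) (ℂD.trans (ℂD.sym product≈) (Equivalence.to (partialButson⇔ {N} {q} H) pb)))
      (λ diagonal → Equivalence.from (partialButson⇔ {N} {q} H) (ℂD.trans product≈ (Equivalence.from (diagonal⇔ e) diagonal)))
      where
      w = proj₂ (toMoves H)
      e = endpoint w
      product≈ : product H zero (suc zero) ≈ evaluate e
      product≈ = ℂD.trans
        (sum-cong-≋ {N} (λ n → ℂD.trans (value≈moveRoot (quotients H n))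
          (ℂD.reflexive (cong moveRoot (sym (Vec.lookup∘tabulate (λ n → move (quotients H n)) n))))))
        (walk-sum w)

    move↔ : Move p ↔ Fin (p ℕ.* 2)
    move↔ = ↔-trans (↔-refl ×-↔ mk↔ₛ′ signIndex sign signIndex-sign sign-signIndex) (↔-sym Fin.*↔×)

    walk↔ : ∃ λ w → Walk ↔ Fin (suc w)
    walk↔ = go ((p ℕ.* 2) ℕ.^ N) (ℕ.m^n>0 (p ℕ.* 2) N) (Vec-↔ move↔ N)
      where
      go : ∀ n → 0 ℕ.< n → Walk ↔ Fin n → ∃ λ w → Walk ↔ Fin (suc w)
      go (suc w) _ K = w , K

    probabilities : ∃ λ (P₂ : ℚ) → HasProbability (matrixSetoid 2 N q) PartialButson P₂ ×
                                   HasProbability (walkSetoid p N) (λ w → OnDiagonal (endpoint w)) P₂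
    probabilities = equal-probability {matrixSetoid 2 N q} {Walk} matrices↔moves (proj₂ walk↔)
      {PartialButson {2} {N} {q}} {OnDiagonal ∘ endpoint} onDiagonal? butson⇔diagonal

open import Data.Nat.Base using (_*_; _^_; _≤_)

theoremB : ((p₁ k₁ p₂ k₂ N : ℕ) → Prime p₁ → Prime p₂ → p₁ ≢ p₂ → 1 ≤ k₁ → 1 ≤ k₂ → 1 ≤ N →
    (ζ₁ ζ₂ : ℂ) → IsPrimitiveRoot (p₁ ^ k₁) ζ₁ → IsPrimitiveRoot (p₂ ^ k₂) ζ₂ →
    ((H : Matrix 2 N (p₁ ^ k₁ * p₂ ^ k₂)) → Dephased H →
    (A : Multiplicities p₁ k₁ p₂ k₂) → IsMultiplicityMatrix p₁ k₁ p₂ k₂ ζ₁ ζ₂ H A →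
    PartialButson H ⇔ IsSumForm p₁ k₁ p₂ k₂ A)
    ×
    (∃ λ (f : Bijection (dephasedPartialButsonSetoid 1 N (p₁ ^ k₁ * p₂ ^ k₂))
    (sumFormSetoid p₁ k₁ p₂ k₂ N)) →
    ∀ H → IsMultiplicityMatrix p₁ k₁ p₂ k₂ ζ₁ ζ₂ (proj₁ H) (proj₁ (Bijection.to f H))))
    ×
    ((p N : ℕ) → Prime p → 3 ≤ p → 1 ≤ N →
    (ζ : ℂ) → IsPrimitiveRoot (2 * p) ζ →
    ∃ λ (P₂ : ℚ) →
    HasProbability (matrixSetoid 2 N (2 * p)) PartialButson P₂
    ×
    HasProbability (walkSetoid p N) (λ (w : Vec (Move p) N) → OnDiagonal (endpoint w)) P₂)
theoremB =
  (λ where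
    -- The remaining cases are empty: 0 is not prime and the exponents are at least 1. With
    -- successors in place, `k₁ ∸ 1` reduces to `k` in the types of the indices.
    (suc p′) (suc k) (suc q′) (suc l) N p-prime q-prime p≢q _ _ _ ζ₁ ζ₂ prim₁ prim₂ →
      let module M = ButsonMatrices.TwoPrimePowers {p′} {q′} {k} {l} {suc p′ ^ suc k * suc q′ ^ suc l} refl
                       p-prime q-prime p≢q N {ζ₁} {ζ₂} prim₁ prim₂
      in M.characterization , M.classification , λ H → M.multiplicities-correct (proj₁ H)) ,
  (λ where
    (suc p′) N p-prime 3≤p _ ζ prim → RandomWalks.TwicePrime.probabilities {p′} {2 * suc p′} refl p-prime 3≤p N {ζ} prim)
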